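{- Let $\Sigma=\{0,1\}$. For each $t,c,a\in\{\mathrm{Y},\mathrm{N},\ast\}$, there exists an $(\mathrm{N},t,c,a)$-OWF if and only if $\mathrm{P}\neq\mathrm{NP}$.
   Context: All functions considered are partial functions $\sigma:\Sigma^*\times\Sigma^*\to\Sigma^*$ (possibly undefined on some pairs), with $\Sigma=\{0,1\}$. $\langle\cdot,\cdot\rangle$ is a standard pairing function: a total, polynomial-time computable bijection $\Sigma^*\times\Sigma^*\to\Sigma^*$ with polynomial-time computable inverses, nondecreasing in each argument. FP is the class of (total or partial) polynomial-time computable functions. - $\sigma$ is honest if there is a polynomial $p$ such that every $z\in\mathrm{image}(\sigma)$ has some $(x,y)\in\mathrm{domain}(\sigma)$ with $\sigma(x,y)=z$ and $|x|+|y|\le p(|z|)$. - $\sigma$ is noninvertible if there is no $f\in\mathrm{FP}$ with $\sigma(f(z))=z$ for all $z\in\mathrm{image}(\sigma)$. - $\sigma$ is a one-way function if it is polynomial-time computable, honest and noninvertible. - $\sigma$ is total if it is defined on every pair, and nontotal otherwise. - Let $\Gamma=\Sigma^*\cup\{\bot\}$ and $\hat\sigma(x,y)=\sigma(x,y)$ if $x\ne\bot$, $y\ne\bot$ and $(x,y)\in\mathrm{domain}(\sigma)$, with $\hat\sigma(x,y)=\bot$ otherwise. $\sigma$ is associative if $\hat\sigma(\hat\sigma(x,y),z)=\hat\sigma(x,\hat\sigma(y,z))$ for all $x,y,z\in\Sigma^*$. It is commutative if $\hat\sigma(x,y)=\hat\sigma(y,x)$ for all $x,y\in\Sigma^*$.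 - $\sigma$ is s-honest if there is a polynomial $p$ such that (a) whenever $\sigma(x,y)=z$ for some $y$, there is $\hat y$ with $\sigma(x,\hat y)=z$ and $|\hat y|\le p(|x|+|z|)$; and (b) whenever $\sigma(x,y)=z$ for some $x$, there is $\hat x$ with $\sigma(\hat x,y)=z$ and $|\hat x|\le p(|y|+|z|)$. - $\sigma$ is invertible with respect to the first argument if there is $g_1\in\mathrm{FP}$ such that for all $z\in\mathrm{image}(\sigma)$ and all $(x,y)\in\mathrm{domain}(\sigma)$ with $\sigma(x,y)=z$, we have $\sigma(x,g_1(\langle x,z\rangle))=z$. It is invertible with respect to the second argument if there is $g_2\in\mathrm{FP}$ with $\sigma(g_2(\langle y,z\rangle),y)=z$ for all such $z,x,y$. - $\sigma$ is strongly noninvertible if it is invertible with respect to neither argument. - $\sigma$ is strong if it is polynomial-time computable, s-honest and strongly noninvertible. - For $s,t,c,a\in\{\mathrm{Y},\mathrm{N},\ast\}$, $\sigma$ is an $(s,t,c,a)$-OWF if $\sigma$ is a one-way function and all of the following hold: if $s=\mathrm{Y}$ then $\sigma$ is strong, and if $s=\mathrm{N}$ it is not strong; if $t=\mathrm{Y}$ it is total, and if $t=\mathrm{N}$ it is nontotal; if $c=\mathrm{Y}$ it is commutative, and if $c=\mathrm{N}$ it is not commutative; if $a=\mathrm{Y}$ it is associative, and if $a=\mathrm{N}$ it is not associative. The value $\ast$ imposes no condition. -}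

module Defs where

open import Data.Nat using (ℕ; zero; suc; _+_; _*_; _^_; _≤_)
open import Data.Fin using (Fin)
open import Data.Bool using (Bool; true; false)
open import Data.List using (List; []; _∷_; _++_; concatMap; length)
open import Data.Maybe using (Maybe; just; nothing; _>>=_)
open import Data.Product using (Σ; ∃; ∃-syntax; _×_; _,_)
open import Data.Sum using (_⊎_)
open import Data.Unit using (⊤)
open import Relation.Nullary using (¬_)
open import Relation.Binary.PropositionalEquality using (_≡_)

Str : Set
Str = List Bool

-- Concrete pairing function ⟨x,y⟩: each bit of x doubled, then 01, then y.
-- Polynomial-time computable, injective, nondecreasing (in length) in each
-- argument, with polynomial-time computable inverse on its range.
pair : Str → Str → Str
pair x y = concatMap (λ b → b ∷ b ∷ []) x ++ (false ∷ true ∷ []) ++ y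

-- Polynomial bounds: every polynomial is dominated by some  k·n^k + k.
poly : ℕ → ℕ → ℕ
poly k n = k * n ^ k + k

-- Model of computation: deterministic single-tape Turing machines
-- (two-way infinite tape, alphabet {0,1,blank}).

data Sym : Set where
  s0 s1 blank : Sym

data Move : Set where
  L R S : Move

data Action (n : ℕ) : Set where
  accept reject : Action n
  go : Fin n → Sym → Move → Action n

record TM : Set where
  field
    states : ℕ                                   -- states are Fin (suc states); start state is zero
    δ      : Fin (suc states) → Sym → Action (suc states)

record Config (n : ℕ) : Set where
  constructor conf
  field
    state : Fin n
    left  : List Sym       -- cells left of the head, nearest first
    cur   : Sym
    right : List Sym       -- cells right of the head, nearest first

toSym : Bool → Sym
toSym false = s0
toSym true  = s1

initConf : (n : ℕ) → Str → Config (suc n)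
initConf n []       = conf Fin.zero [] blank []
  where import Data.Fin as Fin
initConf n (b ∷ bs) = conf Fin.zero [] (toSym b) (Data.List.map toSym bs)
  where import Data.Fin as Fin
        import Data.List

moveConf : {n : ℕ} → Fin n → List Sym → Sym → List Sym → Move → Config n
moveConf q []       s r       L = conf q [] blank (s ∷ r)
moveConf q (l ∷ ls) s r       L = conf q ls l (s ∷ r)
moveConf q ls       s []      R = conf q (s ∷ ls) blank []
moveConf q ls       s (x ∷ r) R = conf q (s ∷ ls) x r
moveConf q ls       s r       S = conf q ls s r

run : (M : TM) → ℕ → Config (suc (TM.states M)) → Maybe (Bool × Config (suc (TM.states M)))
run M t c with TM.δ M (Config.state c) (Config.cur c)
... | accept = just (true , c)
... | reject = just (false , c)
run M zero    c | go q s m = nothing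
run M (suc t) c | go q s m = run M t (moveConf q (Config.left c) s (Config.right c) m)

-- output: maximal bit string starting at the head
takeBits : List Sym → Str
takeBits (s0 ∷ xs) = false ∷ takeBits xs
takeBits (s1 ∷ xs) = true ∷ takeBits xs
takeBits _ = []

-- exec M t x: nothing = not halted within t steps;
-- just nothing = halted rejecting (function undefined);
-- just (just y) = halted accepting with output y.
exec : TM → ℕ → Str → Maybe (Maybe Str)
exec M t x with run M t (initConf (TM.states M) x)
... | nothing = nothing
... | just (false , _) = just nothing
... | just (true , c) = just (just (takeBits (Config.cur c ∷ Config.right c)))

FP : (Str → Maybe Str) → Set
FP f = ∃[ M ] ∃[ k ] (∀ x → exec M (poly k (length x)) x ≡ just (f x))

Fun2 : Set
Fun2 = Str → Str → Maybe Str

FP₂ : Fun2 → Set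
FP₂ σ = ∃[ M ] ∃[ k ] (∀ x y → exec M (poly k (length (pair x y))) (pair x y) ≡ just (σ x y))

InP : (Str → Set) → Set
InP A = ∃[ M ] ∃[ k ] (∀ x →
  (exec M (poly k (length x)) x ≡ just nothing → ¬ A x) ×
  (∃[ y ] (exec M (poly k (length x)) x ≡ just (just y)) → A x) ×
  (∃[ r ] (exec M (poly k (length x)) x ≡ just r)))

InNP : (Str → Set) → Set₁
InNP A = ∃[ V ] ∃[ k ] (InP V × (∀ x →
  (A x → ∃[ w ] (length w ≤ poly k (length x) × V (pair x w))) ×
  (∃[ w ] (length w ≤ poly k (length x) × V (pair x w)) → A x)))

P≢NP : Set₁
P≢NP = ¬ (∀ (A : Str → Set) → InNP A → InP A)

Honest : Fun2 → Set
Honest σ = ∃[ k ] (∀ x y z → σ x y ≡ just z →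
  ∃[ x′ ] ∃[ y′ ] (σ x′ y′ ≡ just z × length x′ + length y′ ≤ poly k (length z)))

Noninvertible : Fun2 → Set
Noninvertible σ = ¬ (∃[ f ] (FP f × (∀ x y z → σ x y ≡ just z →
  ∃[ x′ ] ∃[ y′ ] (f z ≡ just (pair x′ y′) × σ x′ y′ ≡ just z))))

OneWay : Fun2 → Set
OneWay σ = FP₂ σ × Honest σ × Noninvertible σ

Total : Fun2 → Set
Total σ = ∀ x y → ∃[ z ] (σ x y ≡ just z)

-- σ̂ extended to ⊥ is represented by Maybe; σ̂(x,y) = σ(x,y) for strings x,y.
Commutative : Fun2 → Set
Commutative σ = ∀ x y → σ x y ≡ σ y x

Associative : Fun2 → Set
Associative σ = ∀ x y z → (σ x y >>= λ w → σ w z) ≡ (σ y z >>= λ w → σ x w)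

SHonest : Fun2 → Set
SHonest σ = ∃[ k ]
  ((∀ x y z → σ x y ≡ just z → ∃[ ŷ ] (σ x ŷ ≡ just z × length ŷ ≤ poly k (length x + length z))) ×
   (∀ x y z → σ x y ≡ just z → ∃[ x̂ ] (σ x̂ y ≡ just z × length x̂ ≤ poly k (length y + length z))))

InvertibleFirst : Fun2 → Set
InvertibleFirst σ = ∃[ g ] (FP g × (∀ x y z → σ x y ≡ just z →
  ∃[ y′ ] (g (pair x z) ≡ just y′ × σ x y′ ≡ just z)))

InvertibleSecond : Fun2 → Set
InvertibleSecond σ = ∃[ g ] (FP g × (∀ x y z → σ x y ≡ just z →
  ∃[ x′ ] (g (pair y z) ≡ just x′ × σ x′ y ≡ just z)))

StronglyNoninvertible : Fun2 → Set
StronglyNoninvertible σ = ¬ InvertibleFirst σ × ¬ InvertibleSecond σ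

Strong : Fun2 → Set
Strong σ = FP₂ σ × SHonest σ × StronglyNoninvertible σ

data Flag : Set where
  Y N ⋆ : Flag

Cond : Flag → Set → Set
Cond Y P = P
Cond N P = ¬ P
Cond ⋆ P = ⊤

IsOWF : Flag → Flag → Flag → Flag → Fun2 → Set
IsOWF s t c a σ = OneWay σ × Cond s (Strong σ) × Cond t (Total σ) ×
                  Cond c (Commutative σ) × Cond a (Associative σ)

{-# OPTIONS --safe #-}

-- If P = NP then a one-way function can be inverted by prefix search, a contradiction.
--
-- Conversely, an instance of the NP-complete problem used here consists of a tape prefix, a bound in
-- unary and a straight-line program, namely the transition table of a Turing machine repeated once per
-- step; a witness is a string within the bound that completes the prefix to an accepted tape.  σ maps
-- (1u , 1u) to the instance contained in u if u also contains a witness for it, and on all other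
-- arguments depends only on the first letters, through a finite table chosen according to t, c and a.
-- Inverting σ solves the problem, but y is easily found from x and z = σ x y: if z is an instance then
-- y = x, and otherwise one of the strings ε, 0 and 1 will do.  Hence σ is not strong.
--
-- All algorithms are written as programs on nine stacks of bits, which are interleaved on the tape.
module Submission where

open import Defs
open import Data.Bool using (Bool; true; false; if_then_else_)
open import Data.Bool.Properties using () renaming (_≟_ to _≟B_)
open import Data.Empty using (⊥-elim)
open import Data.Fin using (Fin; zero; suc; toℕ; combine; remQuot)
open import Data.Fin.Properties using (toℕ-fromℕ<; toℕ-injective; toℕ<n; remQuot-combine; toℕ-combine) renaming (_≟_ to _≟F_)
open import Data.List using (List; []; _∷_; _++_; concatMap; length; map; replicate; tabulate; lookup; reverse; _ʳ++_; allFin)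
open import Data.List.Membership.Propositional using (_∈_)
open import Data.List.Membership.Propositional.Properties using (∈-map⁺; ∈-concatMap⁺; ∈-++⁺ˡ; ∈-++⁺ʳ; ∈-allFin)
open import Data.List.Properties
  using (≡-dec; ++-assoc; ++-identityʳ; concatMap-++; length-++; length-map; length-replicate; length-reverse; length-tabulate;
         length-ʳ++; reverse-++; reverse-involutive; ʳ++-defn; ʳ++-ʳ++)
open import Data.List.Relation.Unary.Any as Any using (here; there; index)
open import Data.List.Relation.Unary.Any.Properties using (lookup-index)
open import Data.Maybe using (Maybe; just; nothing; _>>=_; is-just)
open import Data.Maybe.Properties using (just-injective)
open import Data.Nat using (ℕ; zero; suc; _+_; _*_; _^_; _∸_; _≤_; _<_; z≤n; s≤s; nonZero)
open import Data.Nat.Divisibility using (divides)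
open import Data.Nat.DivMod
  using (_/_; _mod_; m≡m%n+[m/n]*n; [m+kn]%n≡m%n; m<n⇒m%n≡m; m*n/n≡m; m<n⇒m/n≡0; +-distrib-/-∣ʳ; m%n<n)
open import Data.Nat.Properties
open import Data.Nat.Tactic.RingSolver using (solve-∀)
open import Data.Product using (Σ; ∃-syntax; _×_; _,_; proj₁; proj₂; map₁)
open import Data.Sum using (_⊎_; inj₁; inj₂)
open import Data.Unit using (⊤; tt)
open import Data.Vec as V using (Vec; _[_]≔_; []; _∷_) renaming (lookup to lookupV)
open import Data.Vec.Properties using (lookup∘update; lookup∘update′; lookup-replicate; []≔-commutes; []≔-idempotent; []≔-lookup)
open import Function using (_∘_; id; case_of_)
open import Function.Bundles using (_⇔_; mk⇔)
open import Relation.Binary.PropositionalEquality using (_≡_; _≢_; refl; sym; trans; cong; cong₂; subst; _≗_; module ≡-Reasoning)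
open import Relation.Nullary using (¬_; yes; no; Dec)

-- Polynomial bounds

-- `FP`, `FP₂` and `InP` ask for single-tape machines with explicit time bounds, for the prefix
-- search as well as for the reduction and σ itself; hence the layer of compiled programs. `P≢NP`
-- negates a statement about all of NP, whereas σ is fixed beforehand, so its instances must be able
-- to describe every verifier: this forces a complete problem. With one copy of the table per step
-- all jumps lead forward, so the interpreter consumes the program from a stack, needs a number of
-- operations linear in its length, and needs no clock. The tape prefix for an input x is ⟨x, ε⟩,
-- which a witness w completes to ⟨x, w⟩. Since an instance is at least as long as its bound, a
-- witness is no longer than the instance, and σ is honest. Values that are instances carry the tag
-- 01, which no entry of the finite table has. The tag does two jobs: every preimage of a tagged
-- value contains a witness, and one who knows x and z = σ x y can tell from z which kind of y to
-- return.

record Pol (t : ℕ → ℕ) : Set where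
  field
    mono  : ∀ {m n} → m ≤ n → t m ≤ t n
    coeff : ℕ
    deg   : ℕ
    -- The base `suc n` is never 0, so that an exponent may always be raised, as in `Pol-+`.
    bound : ∀ n → t n ≤ coeff * suc n ^ deg

open Pol

1≤1+n^d : ∀ n d → 1 ≤ suc n ^ d
1≤1+n^d n d = m^n>0 (suc n) d

Pol-const : ∀ c → Pol (λ _ → c)
Pol-const c = record { mono = λ _ → ≤-refl ; coeff = c ; deg = 0 ; bound = λ n → ≤-reflexive (sym (*-identityʳ c)) }

Pol-id : Pol (λ n → n)
Pol-id = record { mono = id ; coeff = 1 ; deg = 1
                ; bound = λ n → ≤-trans (n≤1+n n) (≤-reflexive (sym (trans (+-identityʳ _) (*-identityʳ (suc n))))) }

Pol-+ : ∀ {f g} → Pol f → Pol g → Pol (λ n → f n + g n)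
Pol-+ {f} {g} p q = record
  { mono = λ m≤n → +-mono-≤ (mono p m≤n) (mono q m≤n)
  ; coeff = coeff p + coeff q ; deg = deg p + deg q
  ; bound = λ n → ≤-trans (+-mono-≤ (bound p n) (bound q n))
      (≤-trans (+-mono-≤ (*-monoʳ-≤ (coeff p) (^-monoʳ-≤ (suc n) (m≤m+n (deg p) (deg q))))
                         (*-monoʳ-≤ (coeff q) (^-monoʳ-≤ (suc n) (m≤n+m (deg q) (deg p)))))
               (≤-reflexive (sym (*-distribʳ-+ (suc n ^ (deg p + deg q)) (coeff p) (coeff q))))) }

Pol-* : ∀ {f g} → Pol f → Pol g → Pol (λ n → f n * g n)
Pol-* {f} {g} p q = record
  { mono = λ m≤n → *-mono-≤ (mono p m≤n) (mono q m≤n)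
  ; coeff = coeff p * coeff q ; deg = deg p + deg q
  ; bound = λ n → ≤-trans (*-mono-≤ (bound p n) (bound q n))
      (≤-reflexive (trans ([m*n]*[o*p]≡[m*o]*[n*p] (coeff p) _ (coeff q) _)
        (cong (coeff p * coeff q *_) (sym (^-distribˡ-+-* (suc n) (deg p) (deg q)))))) }

^-distribʳ-* : ∀ d a b → (a * b) ^ d ≡ a ^ d * b ^ d
^-distribʳ-* zero    a b = refl
^-distribʳ-* (suc d) a b = trans (cong (a * b *_) (^-distribʳ-* d a b)) ([m*n]*[o*p]≡[m*o]*[n*p] a b (a ^ d) (b ^ d))

Pol-∘ : ∀ {f g} → Pol f → Pol g → Pol (λ n → f (g n))
Pol-∘ {f} {g} p q = record
  { mono = λ m≤n → mono p (mono q m≤n)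
  ; coeff = coeff p * suc (coeff q) ^ deg p ; deg = deg q * deg p
  ; bound = λ n → begin
      f (g n)                                             ≤⟨ bound p (g n) ⟩
      coeff p * suc (g n) ^ deg p                         ≤⟨ *-monoʳ-≤ (coeff p) (^-monoˡ-≤ (deg p) (inner n)) ⟩
      coeff p * (suc (coeff q) * suc n ^ deg q) ^ deg p   ≡⟨ cong (coeff p *_) (^-distribʳ-* (deg p) (suc (coeff q)) (suc n ^ deg q)) ⟩
      coeff p * (suc (coeff q) ^ deg p * (suc n ^ deg q) ^ deg p) ≡⟨ cong (λ z → coeff p * (suc (coeff q) ^ deg p * z)) (^-*-assoc (suc n) (deg q) (deg p)) ⟩
      coeff p * (suc (coeff q) ^ deg p * suc n ^ (deg q * deg p)) ≡⟨ sym (*-assoc (coeff p) _ _) ⟩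
      coeff p * suc (coeff q) ^ deg p * suc n ^ (deg q * deg p) ∎ }
  where
  open ≤-Reasoning
  inner : ∀ n → suc (g n) ≤ suc (coeff q) * suc n ^ deg q
  inner n = +-mono-≤ (1≤1+n^d n (deg q)) (bound q n)

Pol-^ : ∀ k → Pol (λ n → n ^ k)
Pol-^ zero    = Pol-const 1
Pol-^ (suc k) = Pol-* Pol-id (Pol-^ k)

Pol-poly : ∀ k → Pol (poly k)
Pol-poly k = Pol-+ (Pol-* (Pol-const k) (Pol-^ k)) (Pol-const k)

-- The shape of most loop times: each round consumes a letter of some stack, hence at most `n`
-- rounds, and one more that finds the stack empty.
iterated : (ℕ → ℕ) → ℕ → ℕ
iterated β n = suc n * β n

Pol-suc : Pol suc
Pol-suc = Pol-+ (Pol-const 1) Pol-id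

Pol-iterated : ∀ {β} → Pol β → Pol (iterated β)
Pol-iterated = Pol-* Pol-suc

iterated-≤ : ∀ (β : ℕ → ℕ) l n → l ≤ n → suc l * β n ≤ iterated β n
iterated-≤ β l n le = *-monoˡ-≤ (β n) (s≤s le)

linear : ℕ → ℕ → ℕ
linear c = iterated (λ _ → c)

Pol-linear : ∀ c → Pol (linear c)
Pol-linear c = Pol-iterated (Pol-const c)

poly-dominates : ∀ {t} → Pol t → ∃[ k ] (∀ n → t n ≤ poly k n)
poly-dominates {t} p = k , dom
  where
  c = coeff p
  d = deg p
  -- `c * 2 ^ d` pays for replacing `suc n` by `2 * n`, which needs `n` positive; `d` is for the
  -- exponent. At `n = 0` the power may vanish, and the additive constant of `poly` has to exceed
  -- `c`.
  k = c * 2 ^ d + d + c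
  open ≤-Reasoning
  dom : ∀ n → t n ≤ poly k n
  dom zero = begin
    t 0            ≤⟨ bound p 0 ⟩
    c * 1 ^ d      ≡⟨ trans (cong (c *_) (^-zeroˡ d)) (*-identityʳ c) ⟩
    c              ≤⟨ m≤n+m c (c * 2 ^ d + d) ⟩
    k              ≤⟨ m≤n+m k (k * 0 ^ k) ⟩
    poly k 0       ∎
  dom n@(suc m) = begin
    t n                   ≤⟨ bound p n ⟩
    c * suc n ^ d         ≤⟨ *-monoʳ-≤ c (^-monoˡ-≤ d suc≤double) ⟩
    c * (2 * n) ^ d       ≡⟨ cong (c *_) (^-distribʳ-* d 2 n) ⟩
    c * (2 ^ d * n ^ d)   ≡⟨ sym (*-assoc c (2 ^ d) (n ^ d)) ⟩
    c * 2 ^ d * n ^ d     ≤⟨ *-mono-≤ (≤-trans (m≤m+n (c * 2 ^ d) d) (m≤m+n _ c)) (^-monoʳ-≤ n (≤-trans (m≤n+m d (c * 2 ^ d)) (m≤m+n _ c))) ⟩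
    k * n ^ k             ≤⟨ m≤m+n (k * n ^ k) k ⟩
    poly k n              ∎
    where
    suc≤double : suc n ≤ 2 * n
    suc≤double = ≤-trans (+-monoˡ-≤ n (s≤s z≤n)) (≤-reflexive (cong (n +_) (sym (+-identityʳ n))))

-- Turing machine fragments

-- Results of fragments and loop variables live in the control state, so their types must be
-- enumerable. Repetitions in the list do no harm: only some index for each element is needed.
record Finite (A : Set) : Set where
  field
    elems    : List A
    complete : ∀ a → a ∈ elems

open Finite {{...}}

instance
  Finite-⊤ : Finite ⊤
  Finite-⊤ = record { elems = tt ∷ [] ; complete = λ _ → here refl }

  Finite-Bool : Finite Bool
  Finite-Bool = record { elems = true ∷ false ∷ [] ; complete = λ { true → here refl ; false → there (here refl) } }

  Finite-Sym : Finite Sym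
  Finite-Sym = record { elems = s0 ∷ s1 ∷ blank ∷ []
                      ; complete = λ { s0 → here refl ; s1 → there (here refl) ; blank → there (there (here refl)) } }

  Finite-Fin : ∀ {n} → Finite (Fin n)
  Finite-Fin = record { elems = allFin _ ; complete = ∈-allFin }

  Finite-⊎ : ∀ {A B : Set} → {{Finite A}} → {{Finite B}} → Finite (A ⊎ B)
  Finite-⊎ = record { elems = map inj₁ elems ++ map inj₂ elems
                    ; complete = λ { (inj₁ a) → ∈-++⁺ˡ (∈-map⁺ inj₁ (complete a)) ; (inj₂ b) → ∈-++⁺ʳ _ (∈-map⁺ inj₂ (complete b)) } }

  Finite-Maybe : ∀ {A : Set} → {{Finite A}} → Finite (Maybe A)
  Finite-Maybe = record { elems = nothing ∷ map just elems
                        ; complete = λ { nothing → here refl ; (just a) → there (∈-map⁺ just (complete a)) } }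

Finite-Σ : ∀ {A : Set} {P : A → Set} → Finite A → (∀ a → Finite (P a)) → Finite (Σ A P)
Finite-Σ FA FP = record
  { elems = concatMap (λ a → map (a ,_) (Finite.elems (FP a))) (Finite.elems FA)
  ; complete = λ { (a , p) → ∈-concatMap⁺ _ (Any.map (λ { refl → ∈-map⁺ (a ,_) (Finite.complete (FP a) p) }) (Finite.complete FA a)) } }

instance
  Finite-× : ∀ {A B : Set} → {{Finite A}} → {{Finite B}} → Finite (A × B)
  Finite-× {{FA}} {{FB}} = Finite-Σ FA (λ _ → FB)

record Tape : Set where
  constructor tape
  field
    left  : List Sym
    cur   : Sym
    right : List Sym

open Tape

hd : List Sym → Sym
hd []      = blank
hd (s ∷ _) = s

tl : List Sym → List Sym
tl []      = []
tl (_ ∷ l) = l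

moveT : Tape → Sym → Move → Tape
moveT (tape l _ r) s L = tape (tl l) (hd l) (s ∷ r)
moveT (tape l _ r) s R = tape (s ∷ l) (hd r) (tl r)
moveT (tape l _ r) s S = tape l s r

toConf : ∀ {n} → Fin n → Tape → Config n
toConf q (tape l c r) = conf q l c r

moveConf≡ : ∀ {n} (q : Fin n) w s m → moveConf q (left w) s (right w) m ≡ toConf q (moveT w s m)
moveConf≡ q (tape [] c r) s L = refl
moveConf≡ q (tape (x ∷ l) c r) s L = refl
moveConf≡ q (tape [] c []) s R = refl
moveConf≡ q (tape [] c (x ∷ r)) s R = refl
moveConf≡ q (tape (_ ∷ _) c []) s R = refl
moveConf≡ q (tape (_ ∷ _) c (x ∷ r)) s R = refl
moveConf≡ q (tape [] c []) s S = refl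
moveConf≡ q (tape [] c (_ ∷ _)) s S = refl
moveConf≡ q (tape (_ ∷ _) c []) s S = refl
moveConf≡ q (tape (_ ∷ _) c (_ ∷ _)) s S = refl

-- A fragment of a Turing machine that leaves with a result in A instead of halting.
record Mach (A : Set) : Set₁ where
  field
    St    : Set
    fin   : Finite St
    start : St
    step  : St → Sym → (St ⊎ A) × Sym × Move

open Mach

-- The step that leaves a fragment also writes and moves. Passing control to another fragment
-- therefore costs nothing, and the times of consecutive runs add up exactly.
data Reach {A : Set} (m : Mach A) : St m → Tape → A → Tape → ℕ → Set where
  stop : ∀ {q w a s mv} → step m q (cur w) ≡ (inj₂ a , s , mv) → Reach m q w a (moveT w s mv) 1
  next : ∀ {q w q′ s mv a w′ t} → step m q (cur w) ≡ (inj₁ q′ , s , mv) →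
         Reach m q′ (moveT w s mv) a w′ t → Reach m q w a w′ (suc t)

Run : ∀ {A} → Mach A → Tape → A → Tape → ℕ → Set
Run m = Reach m (start m)

actM : ∀ {A} → (Sym → A × Sym × Move) → Mach A
actM φ = record { St = ⊤ ; fin = Finite-⊤ ; start = tt ; step = λ _ s → map₁ inj₂ (φ s) }

Run-act : ∀ {A} {φ : Sym → A × Sym × Move} {a s mv} w → φ (cur w) ≡ (a , s , mv) → Run (actM φ) w a (moveT w s mv) 1
Run-act w eq = stop (cong (map₁ inj₂) eq)

module _ {A B : Set} where

  enter : (m : Mach B) (f : B → Mach A) → St m ⊎ B → (St m ⊎ Σ B (St ∘ f)) ⊎ A
  enter m f (inj₁ q) = inj₁ (inj₁ q)
  enter m f (inj₂ b) = inj₁ (inj₂ (b , start (f b)))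

  stay : (m : Mach B) (f : B → Mach A) → ∀ b → St (f b) ⊎ A → (St m ⊎ Σ B (St ∘ f)) ⊎ A
  stay m f b (inj₁ q) = inj₁ (inj₂ (b , q))
  stay m f b (inj₂ a) = inj₂ a

  again : (f : B → Mach (B ⊎ A)) → ∀ b → St (f b) ⊎ (B ⊎ A) → Σ B (St ∘ f) ⊎ A
  again f b (inj₁ q)         = inj₁ (b , q)
  again f b (inj₂ (inj₁ b′)) = inj₁ (b′ , start (f b′))
  again f b (inj₂ (inj₂ a))  = inj₂ a

  bindM : Finite B → Mach B → (B → Mach A) → Mach A
  bindM FB m f = record
    { St = St m ⊎ Σ B (St ∘ f)
    ; fin = Finite-⊎ {{fin m}} {{Finite-Σ FB (fin ∘ f)}}
    ; start = inj₁ (start m)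
    ; step = λ { (inj₁ q) s → map₁ (enter m f) (step m q s) ; (inj₂ (b , q)) s → map₁ (stay m f b) (step (f b) q s) } }

  Run-bind : ∀ (FB : Finite B) {m : Mach B} {f : B → Mach A} {w b w₁ a w₂ t t′} →
             Run m w b w₁ t → Run (f b) w₁ a w₂ t′ → Run (bindM FB m f) w a w₂ (t + t′)
  Run-bind FB {m} {f} r r′ = first r r′
    where
    second : ∀ {b q w a w₂ t} → Reach (f b) q w a w₂ t → Reach (bindM FB m f) (inj₂ (b , q)) w a w₂ t
    second (stop eq)   = stop (cong (map₁ (stay m f _)) eq)
    second (next eq r) = next (cong (map₁ (stay m f _)) eq) (second r)
    first : ∀ {q w b w₁ a w₂ t t′} → Reach m q w b w₁ t → Run (f b) w₁ a w₂ t′ →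
            Reach (bindM FB m f) (inj₁ q) w a w₂ (t + t′)
    first (stop eq) r′   = next (cong (map₁ (enter m f)) eq) (second r′)
    first (next eq r) r′ = next (cong (map₁ (enter m f)) eq) (first r r′)

  loopM : Finite B → (B → Mach (B ⊎ A)) → B → Mach A
  loopM FB f b₀ = record
    { St = Σ B (St ∘ f)
    ; fin = Finite-Σ FB (fin ∘ f)
    ; start = b₀ , start (f b₀)
    ; step = λ { (b , q) s → map₁ (again f b) (step (f b) q s) } }

  Run-loop-exit : ∀ (FB : Finite B) {f : B → Mach (B ⊎ A)} {b w a w₁ t} →
                  Run (f b) w (inj₂ a) w₁ t → Run (loopM FB f b) w a w₁ t
  Run-loop-exit FB {f} {b} r = body r
    where
    body : ∀ {q w a w₁ t} → Reach (f b) q w (inj₂ a) w₁ t → Reach (loopM FB f b) (b , q) w a w₁ t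
    body (stop eq)   = stop (cong (map₁ (again f b)) eq)
    body (next eq r) = next (cong (map₁ (again f b)) eq) (body r)

  Run-loop-again : ∀ (FB : Finite B) {f : B → Mach (B ⊎ A)} {b b′ w a w₁ w₂ t t′} →
                   Run (f b) w (inj₁ b′) w₁ t → Run (loopM FB f b′) w₁ a w₂ t′ → Run (loopM FB f b) w a w₂ (t + t′)
  Run-loop-again FB {f} {b} r r′ = body r r′
    where
    -- The loops for different initial values have the same states and transitions and differ only
    -- in `start`, which a run from a given state never consults.
    unstart : ∀ {b₁ b₂ q w a w₂ t} → Reach (loopM FB f b₁) q w a w₂ t → Reach (loopM FB f b₂) q w a w₂ t
    unstart (stop eq)   = stop eq
    unstart (next eq r) = next eq (unstart r)
    body : ∀ {q b′ w a w₁ w₂ t t′} → Reach (f b) q w (inj₁ b′) w₁ t → Run (loopM FB f b′) w₁ a w₂ t′ →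
           Reach (loopM FB f b) (b , q) w a w₂ (t + t′)
    body (stop eq) r′   = next (cong (map₁ (again f b)) eq) (unstart r′)
    body (next eq r) r′ = next (cong (map₁ (again f b)) eq) (body r r′)

module Compile (m : Mach Bool) where

  FS : Finite (St m)
  FS = fin m

  states : ℕ
  states = suc (suc (length (Finite.elems FS)))

  halt : Bool → Fin (suc states)
  halt true  = suc zero
  halt false = suc (suc zero)

  encode : St m ⊎ Bool → Fin (suc states)
  encode (inj₁ q) = suc (suc (suc (index (Finite.complete FS q))))
  encode (inj₂ b) = halt b

  act : (St m ⊎ Bool) × Sym × Move → Action (suc states)
  act (q , s , mv) = go (encode q) s mv

  δ : Fin (suc states) → Sym → Action (suc states)
  δ zero                s = act (step m (start m) s)
  δ (suc zero)          s = accept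
  δ (suc (suc zero))    s = reject
  δ (suc (suc (suc i))) s = act (step m (lookup (Finite.elems FS) i) s)

  toTM : TM
  toTM = record { states = states ; δ = δ }

  -- The model fixes state `zero` as the start, so the start state of `m` is represented twice.
  -- Comparing transitions instead of state numbers covers both copies.
  Simulates : Fin (suc states) → St m → Set
  Simulates i q = ∀ s → δ i s ≡ act (step m q s)

  encode-simulates : ∀ q → Simulates (encode (inj₁ q)) q
  encode-simulates q s = cong (λ q → act (step m q s)) (sym (lookup-index (Finite.complete FS q)))

  run-go : ∀ {i q′ : Fin (suc states)} {s mv} t w → δ i (cur w) ≡ go q′ s mv → run toTM (suc t) (toConf i w) ≡ run toTM t (toConf q′ (moveT w s mv))
  run-go {q′ = q′} {s} {mv} t w eq rewrite eq = cong (run toTM t) (moveConf≡ q′ w s mv)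

  -- `run` looks for a halting action before it looks at the clock, so no time need be left.
  run-halt : ∀ b t w → run toTM t (toConf (halt b) w) ≡ just (b , toConf (halt b) w)
  run-halt true  zero    w = refl
  run-halt true  (suc t) w = refl
  run-halt false zero    w = refl
  run-halt false (suc t) w = refl

  run-reach : ∀ i {q w b w′ t} e → Simulates i q → Reach m q w b w′ t →
              run toTM (t + e) (toConf i w) ≡ just (b , toConf (halt b) w′)
  run-reach i {w = w} e sim (stop {s = s} {mv} eq) =
    trans (run-go e w (trans (sim (cur w)) (cong act eq))) (run-halt _ e (moveT w s mv))
  run-reach i {w = w} e sim (next {q′ = q′} {t = t} eq r) =
    trans (run-go (t + e) w (trans (sim (cur w)) (cong act eq))) (run-reach (encode (inj₁ q′)) e (encode-simulates q′) r)

initTape : Str → Tape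
initTape x = tape [] (hd (map toSym x)) (tl (map toSym x))

output : Tape → Bool → Maybe Str
output w true  = just (takeBits (cur w ∷ right w))
output w false = nothing

exec-halts : ∀ M T x b q w → run M T (initConf (TM.states M) x) ≡ just (b , toConf q w) → exec M T x ≡ just (output w b)
exec-halts M T x true  q w eq rewrite eq = refl
exec-halts M T x false q w eq rewrite eq = refl

initConf≡ : ∀ n x → initConf n x ≡ toConf zero (initTape x)
initConf≡ n []      = refl
initConf≡ n (_ ∷ _) = refl

exec-run : ∀ {m : Mach Bool} {x b w t T} → Run m (initTape x) b w t → t ≤ T → exec (Compile.toTM m) T x ≡ just (output w b)
exec-run {m} {x} {b} {w} {t} {T} r t≤T = exec-halts toTM T x b (halt b) w (begin
  run toTM T (initConf states x)                          ≡⟨ cong (run toTM T) (initConf≡ states x) ⟩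
  run toTM T (toConf zero (initTape x))                   ≡⟨ cong (λ T → run toTM T (toConf zero (initTape x))) (sym (m+[n∸m]≡n t≤T)) ⟩
  run toTM (t + (T ∸ t)) (toConf zero (initTape x))       ≡⟨ run-reach zero (T ∸ t) (λ s → refl) r ⟩
  just (b , toConf (halt b) w)                            ∎)
  where
  open Compile m
  open ≡-Reasoning

-- Stacks on a tape

look : List Sym → ℕ → Sym
look l zero    = hd l
look l (suc n) = look (tl l) n

look-[] : ∀ n → look [] n ≡ blank
look-[] zero    = refl
look-[] (suc n) = look-[] n

infixr 5 _◂_

_◂_ : Sym → (ℕ → Sym) → ℕ → Sym
(s ◂ h) zero    = s
(s ◂ h) (suc n) = h n

data Dir : Set where
  lft rgt : Dir

opp : Dir → Dir
opp lft = rgt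
opp rgt = lft

toward : Dir → Move
toward lft = L
toward rgt = R

side : Dir → Tape → List Sym
side lft = left
side rgt = right

-- The view backwards from distance `p`: the cells `p - 1` down to 0 of one half, then the other
-- half.
glue : (ℕ → Sym) → ℕ → (ℕ → Sym) → ℕ → Sym
glue h zero    g = g
glue h (suc p) g = h p ◂ glue h p g

-- The head is p cells away from home in direction d; the half tape from home in that direction
-- reads h, the rest of the tape reads g.
record At (d : Dir) (p : ℕ) (h g : ℕ → Sym) (w : Tape) : Set where
  constructor at
  field
    ahead  : ∀ n → look (side d w) n ≡ h (n + suc p)
    under  : cur w ≡ h p
    behind : ∀ n → look (side (opp d) w) n ≡ glue h p g n

At-fwd : ∀ {d p h g w} → At d p h g w → At d (suc p) h g (moveT w (cur w) (toward d))
At-fwd {lft} {p} {h} (at a c b) = at (λ n → trans (a (suc n)) (cong h (sym (+-suc n (suc p))))) (a 0) λ { zero → c ; (suc n) → b n }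
At-fwd {rgt} {p} {h} (at a c b) = at (λ n → trans (a (suc n)) (cong h (sym (+-suc n (suc p))))) (a 0) λ { zero → c ; (suc n) → b n }

At-bwd : ∀ {d p h g w} → At d (suc p) h g w → At d p h g (moveT w (cur w) (toward (opp d)))
At-bwd {lft} {p} {h} (at a c b) = at (λ { zero → c ; (suc n) → trans (a n) (cong h (+-suc n (suc p))) }) (b 0) (b ∘ suc)
At-bwd {rgt} {p} {h} (at a c b) = at (λ { zero → c ; (suc n) → trans (a n) (cong h (+-suc n (suc p))) }) (b 0) (b ∘ suc)

glue-cong : ∀ {h h′ g g′} p → (∀ a → a < p → h a ≡ h′ a) → g ≗ g′ → glue h p g ≗ glue h′ p g′
glue-cong zero    eqh eqg n       = eqg n
glue-cong (suc p) eqh eqg zero    = eqh p ≤-refl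
glue-cong (suc p) eqh eqg (suc n) = glue-cong p (λ a a<p → eqh a (m<n⇒m<1+n a<p)) eqg n

At-write : ∀ {d p h g w h′ s} → h′ p ≡ s → (∀ a → a ≢ p → h′ a ≡ h a) → At d p h g w → At d p h′ g (moveT w s S)
At-write {d} {p} {h} {g} {w} {h′} {s} eq neq (at a c b) = at (ahead′ d a) (sym eq) (behind′ d b)
  where
  ahead′ : ∀ d → (∀ n → look (side d w) n ≡ h (n + suc p)) → ∀ n → look (side d (moveT w s S)) n ≡ h′ (n + suc p)
  ahead′ lft a n = trans (a n) (sym (neq (n + suc p) (m+1+n≢n n)))
  ahead′ rgt a n = trans (a n) (sym (neq (n + suc p) (m+1+n≢n n)))
  same : ∀ n → glue h p g n ≡ glue h′ p g n
  same = glue-cong p (λ a a<p → sym (neq a (<⇒≢ a<p))) (λ _ → refl)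
  behind′ : ∀ d → (∀ n → look (side (opp d) w) n ≡ glue h p g n) → ∀ n → look (side (opp d) (moveT w s S)) n ≡ glue h′ p g n
  behind′ lft b n = trans (b n) (same n)
  behind′ rgt b n = trans (b n) (same n)

At-cong : ∀ {d p h g w h′ g′} → h ≗ h′ → g ≗ g′ → At d p h g w → At d p h′ g′ w
At-cong {p = p} eqh eqg (at a c b) =
  at (λ n → trans (a n) (eqh _)) (trans c (eqh _)) (λ n → trans (b n) (glue-cong p (λ a _ → eqh a) eqg n))

-- At home the cell under the head may be counted to either half; the flip hands it over to the
-- other one.
At-flip : ∀ {d h g w} → At d 0 h g w → At (opp d) 0 (h 0 ◂ g) (h ∘ suc) w
At-flip {lft} {h} (at a c b) = at (λ n → trans (b n) (cong (h 0 ◂ _) (sym (+-comm n 1)))) c (λ n → trans (a n) (cong h (+-comm n 1)))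
At-flip {rgt} {h} (at a c b) = at (λ n → trans (b n) (cong (h 0 ◂ _) (sym (+-comm n 1)))) c (λ n → trans (a n) (cong h (+-comm n 1)))

retM : ∀ {A} → A → Mach A
retM a = actM (λ s → a , s , S)

Run-ret : ∀ {A} {a : A} w → Run (retM a) w a w 1
Run-ret w = Run-act {s = cur w} {mv = S} w refl

moveN : Move → ℕ → Mach ⊤
moveN mv zero    = retM tt
moveN mv (suc n) = bindM Finite-⊤ (actM (λ s → tt , s , mv)) (λ _ → moveN mv n)

RunTo : ∀ {A} → Mach A → Tape → A → (Tape → Set) → ℕ → Set
RunTo m w a P t = ∃[ w′ ] (Run m w a w′ t × P w′)

RunTo-bind : ∀ {A B : Set} (FB : Finite B) {m : Mach B} {f : B → Mach A} {w b P a Q t t′} →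
             RunTo m w b P t → (∀ {w₁} → P w₁ → RunTo (f b) w₁ a Q t′) → RunTo (bindM FB m f) w a Q (t + t′)
RunTo-bind FB (w₁ , r , p) k with k p
... | w₂ , r′ , q = w₂ , Run-bind FB r r′ , q

moveN-out : ∀ {d p h g w} n → At d p h g w → RunTo (moveN (toward d) n) w tt (At d (n + p) h g) (suc n)
moveN-out zero a = _ , Run-ret _ , a
moveN-out {d} {p} {h} {g} (suc n) a with moveN-out n (At-fwd a)
... | w′ , r , a′ = w′ , Run-bind Finite-⊤ (Run-act _ refl) r , subst (λ p → At d p h g w′) (+-suc n p) a′

moveN-back : ∀ {d p h g w} n → At d (n + p) h g w → RunTo (moveN (toward (opp d)) n) w tt (At d p h g) (suc n)
moveN-back zero a = _ , Run-ret _ , a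
moveN-back (suc n) a with moveN-back n (At-bwd a)
... | w′ , r , a′ = w′ , Run-bind Finite-⊤ (Run-act _ refl) r , a′

-- Level 0 of a stack is an unused blank cell, so that the walk back to it can stop at a blank.
cell : Str → ℕ → Sym
cell []       j = blank
cell (b ∷ st) j with j ≟ suc (length st)
... | yes _ = toSym b
... | no  _ = cell st j

cell-0 : ∀ st → cell st 0 ≡ blank
cell-0 []       = refl
cell-0 (b ∷ st) with 0 ≟ suc (length st)
... | no _ = cell-0 st

cell-top : ∀ b st → cell (b ∷ st) (suc (length st)) ≡ toSym b
cell-top b st with suc (length st) ≟ suc (length st)
... | yes _ = refl
... | no ¬p = ⊥-elim (¬p refl)

cell-below : ∀ b st j → j ≢ suc (length st) → cell (b ∷ st) j ≡ cell st j
cell-below b st j ne with j ≟ suc (length st)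
... | yes p = ⊥-elim (ne p)
... | no _ = refl

cell-above : ∀ st j → length st < j → cell st j ≡ blank
cell-above []       j lt = refl
cell-above (b ∷ st) j lt = trans (cell-below b st j (λ e → <⇒≢ lt (sym e))) (cell-above st j (<-trans (n<1+n _) lt))

isBlank : Sym → Bool
isBlank s0    = false
isBlank s1    = false
isBlank blank = true

toSym-nonblank : ∀ b → isBlank (toSym b) ≡ false
toSym-nonblank false = refl
toSym-nonblank true  = refl

cell-nonblank : ∀ st j → j < length st → isBlank (cell st (suc j)) ≡ false
cell-nonblank (b ∷ st) j lt with suc j ≟ suc (length st)
... | yes _ = toSym-nonblank b
... | no ne = cell-nonblank st j (≤∧≢⇒< (≤-pred lt) (ne ∘ cong suc))

fromSym : Sym → Maybe Bool
fromSym s0    = just false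
fromSym s1    = just true
fromSym blank = nothing

fromSym-toSym : ∀ b → fromSym (toSym b) ≡ just b
fromSym-toSym false = refl
fromSym-toSym true  = refl

exitIf : Bool → ⊤ ⊎ ⊤
exitIf true  = inj₂ tt
exitIf false = inj₁ tt

module Stack (d : Dir) (o m : ℕ) where

  -- In this recursive form a move by the offset or by the stride changes the address by computation
  -- alone, in the shape `n + p` of `moveN-out` and `moveN-back`.
  addr : ℕ → ℕ
  addr zero    = o + 0
  addr (suc j) = m + addr j

  -- It moves before it tests, so the blank of level 0 does not stop it and it ends on the first
  -- free level. `walkBack` tests first and so ends on level 0.
  walkOut : Mach ⊤
  walkOut = loopM Finite-⊤ (λ _ → bindM Finite-⊤ (moveN (toward d) m)
    (λ _ → actM (λ s → exitIf (isBlank s) , s , S))) tt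

  stepBack : Bool → Mach (⊤ ⊎ ⊤)
  stepBack true  = retM (inj₂ tt)
  stepBack false = bindM Finite-⊤ (moveN (toward (opp d)) m) (λ _ → retM (inj₁ tt))

  walkBack : Mach ⊤
  walkBack = loopM Finite-⊤ (λ _ → bindM Finite-Bool (actM (λ s → isBlank s , s , S)) stepBack) tt

  pushM : Bool → Mach ⊤
  pushM b = bindM Finite-⊤ (moveN (toward d) o) λ _ → bindM Finite-⊤ walkOut λ _ →
            bindM Finite-⊤ (actM (λ _ → tt , toSym b , S)) λ _ → bindM Finite-⊤ walkBack λ _ → moveN (toward (opp d)) o

  popM : Mach (Maybe Bool)
  popM = bindM Finite-⊤ (moveN (toward d) o) λ _ → bindM Finite-⊤ walkOut λ _ → bindM Finite-⊤ (moveN (toward (opp d)) m) λ _ →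
         bindM Finite-Sym (actM (λ s → s , blank , S)) λ s →
         -- The cell just erased would stop `walkBack` at once, so the head first goes down one
         -- level. If a blank was read, the stack was empty and the head is already at level 0.
         bindM Finite-⊤ (if isBlank s then retM tt else moveN (toward (opp d)) m) λ _ →
         bindM Finite-⊤ walkBack λ _ → bindM Finite-⊤ (moveN (toward (opp d)) o) λ _ → retM (fromSym s)

  Holds : (ℕ → Sym) → Str → Set
  Holds h st = ∀ j → h (addr j) ≡ cell st j

  walkOut-run : ∀ {h g w} st → Holds h st → ∀ r j → r + j ≡ length st → At d (addr j) h g w →
                RunTo walkOut w tt (At d (addr (suc (length st))) h g) (suc r * (suc m + 1))
  walkOut-run {h} {g} {w} st H zero j refl a with moveN-out m a
  ... | w₁ , r₁ , a₁ = w₁ , subst (Run walkOut w tt w₁) (sym (+-identityʳ (suc m + 1)))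
                              (Run-loop-exit Finite-⊤ (Run-bind Finite-⊤ r₁ (Run-act w₁ found))) , a₁
    where
    found : (exitIf (isBlank (cur w₁)) , cur w₁ , S) ≡ (inj₂ tt , cur w₁ , S)
    found = cong (λ s → exitIf (isBlank s) , cur w₁ , S) (trans (At.under a₁) (trans (H (suc j)) (cell-above st (suc j) ≤-refl)))
  walkOut-run {h} {g} {w} st H (suc r) j eq a with moveN-out m a
  ... | w₁ , r₁ , a₁ with walkOut-run st H r (suc j) (trans (+-suc r j) eq) a₁
  ...   | w₂ , r₂ , a₂ = w₂ , Run-loop-again Finite-⊤ (Run-bind Finite-⊤ r₁ (Run-act w₁ notyet)) r₂ , a₂
    where
    notyet : (exitIf (isBlank (cur w₁)) , cur w₁ , S) ≡ (inj₁ tt , cur w₁ , S)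
    notyet = cong (λ b → exitIf b , cur w₁ , S) (trans (cong isBlank (trans (At.under a₁) (H (suc j))))
               (cell-nonblank st j (≤-trans (s≤s (m≤n+m j r)) (≤-reflexive eq))))

  backTime : ℕ → ℕ
  backTime j = j * (1 + (suc m + 1)) + 2

  walkBack-run : ∀ {h g w} st → Holds h st → ∀ j → j ≤ length st → At d (addr j) h g w →
                 RunTo walkBack w tt (At d (addr 0) h g) (backTime j)
  walkBack-run {h} {g} {w} st H zero j≤ a = w , Run-loop-exit Finite-⊤ (Run-bind Finite-Bool {f = stepBack} (Run-act w found) (Run-ret w)) , a
    where
    found : (isBlank (cur w) , cur w , S) ≡ (true , cur w , S)
    found = cong (λ s → isBlank s , cur w , S) (trans (At.under a) (trans (H 0) (cell-0 st)))
  walkBack-run {h} {g} {w} st H (suc j) j≤ a with moveN-back m a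
  ... | w₁ , r₁ , a₁ with walkBack-run st H j (<⇒≤ j≤) a₁
  ...   | w₂ , r₂ , a₂ = w₂ , subst (Run walkBack w tt w₂) (sym (+-assoc (1 + (suc m + 1)) (j * (1 + (suc m + 1))) 2))
            (Run-loop-again Finite-⊤ (Run-bind Finite-Bool {f = stepBack} (Run-act w notyet) (Run-bind Finite-⊤ r₁ (Run-ret w₁))) r₂) , a₂
    where
    notyet : (isBlank (cur w) , cur w , S) ≡ (false , cur w , S)
    notyet = cong (λ b → b , cur w , S) (trans (cong isBlank (trans (At.under a) (H (suc j)))) (cell-nonblank st j j≤))

  pushTime : ℕ → ℕ
  pushTime n = suc o + (suc n * (suc m + 1) + (1 + (backTime (suc n) + suc o)))

  push-run : ∀ {h h′ g w st} b → Holds h st → Holds h′ (b ∷ st) → (∀ a → a ≢ addr (suc (length st)) → h′ a ≡ h a) →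
             At d 0 h g w → RunTo (pushM b) w tt (At d 0 h′ g) (pushTime (length st))
  push-run {st = st} b H H′ same a =
    RunTo-bind Finite-⊤ (moveN-out o a) λ a₁ →
    RunTo-bind Finite-⊤ (walkOut-run st H (length st) 0 (+-identityʳ _) a₁) λ a₂ →
    RunTo-bind Finite-⊤ (_ , Run-act _ refl , At-write (trans (H′ (suc (length st))) (cell-top b st)) same a₂) λ a₃ →
    RunTo-bind Finite-⊤ (walkBack-run (b ∷ st) H′ (suc (length st)) ≤-refl a₃) λ a₄ → moveN-back o a₄

  popTime : ℕ → ℕ → ℕ
  popTime n m′ = suc o + (suc n * (suc m + 1) + (suc m + (1 + (m′ + (backTime n + (suc o + 1))))))

  pop-empty : ∀ {h g w} → Holds h [] → At d 0 h g w → RunTo popM w nothing (At d 0 h g) (popTime 0 1)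
  pop-empty {h} {g} H a =
    RunTo-bind Finite-⊤ (moveN-out o a) λ a₁ →
    RunTo-bind Finite-⊤ (walkOut-run [] H 0 0 refl a₁) λ a₂ →
    RunTo-bind Finite-⊤ (moveN-back m a₂) λ a₃ →
    RunTo-bind Finite-Sym {b = blank} (_ , Run-act _ (cong (λ s → s , blank , S) (trans (At.under a₃) (H 0))) , At-write (H 0) (λ _ _ → refl) a₃) λ a₄ →
    RunTo-bind Finite-⊤ (_ , Run-ret _ , a₄) λ a₅ →
    RunTo-bind Finite-⊤ (walkBack-run [] H 0 z≤n a₅) λ a₆ →
    RunTo-bind Finite-⊤ (moveN-back o a₆) λ a₇ → _ , Run-ret _ , a₇

  pop-run : ∀ {h h′ g w} b st → Holds h (b ∷ st) → Holds h′ st → (∀ a → a ≢ addr (suc (length st)) → h′ a ≡ h a) →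
            At d 0 h g w → RunTo popM w (just b) (At d 0 h′ g) (suc o + (suc (suc (length st)) * (suc m + 1) + (suc m + (1 + (suc m + (backTime (length st) + (suc o + 1)))))))
  pop-run {h} {h′} {g} b st H H′ same a =
    RunTo-bind Finite-⊤ (moveN-out o a) λ a₁ →
    RunTo-bind Finite-⊤ (walkOut-run (b ∷ st) H (suc (length st)) 0 (+-identityʳ _) a₁) λ a₂ →
    RunTo-bind Finite-⊤ (moveN-back m a₂) λ a₃ →
    RunTo-bind Finite-Sym {b = toSym b} (_ , Run-act _ (cong (λ s → s , blank , S) (trans (At.under a₃) (trans (H (suc (length st))) (cell-top b st))))
                            , At-write (trans (H′ (suc (length st))) (cell-above st (suc (length st)) ≤-refl)) same a₃) λ a₄ →
    RunTo-bind Finite-⊤ (skip b a₄) λ a₅ →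
    RunTo-bind Finite-⊤ (walkBack-run st H′ (length st) ≤-refl a₅) λ a₆ →
    RunTo-bind Finite-⊤ (moveN-back o a₆) λ {w} a₇ → w , Run-act {s = cur w} {mv = S} w (cong (λ r → r , cur w , S) (fromSym-toSym b)) , a₇
    where
    skip : ∀ b {w} → At d (addr (suc (length st))) h′ g w →
           RunTo (if isBlank (toSym b) then retM tt else moveN (toward (opp d)) m) w tt (At d (addr (length st)) h′ g) (suc m)
    skip false = moveN-back m
    skip true  = moveN-back m

  opTime : ℕ → ℕ
  opTime n = suc o + (suc n * (suc m + 1) + (suc m + (1 + (suc m + (backTime (suc n) + (suc o + 1))))))

  backTime-mono : ∀ {i j} → i ≤ j → backTime i ≤ backTime j
  backTime-mono i≤j = +-monoˡ-≤ 2 (*-monoˡ-≤ (1 + (suc m + 1)) i≤j)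

  pushTime≤ : ∀ n → pushTime n ≤ opTime n
  pushTime≤ n = +-monoʳ-≤ (suc o) (+-monoʳ-≤ (suc n * (suc m + 1)) (≤-trans
    (+-monoʳ-≤ 1 (≤-trans (+-monoʳ-≤ (backTime (suc n)) (m≤m+n (suc o) 1)) (m≤n+m _ (suc m)))) (m≤n+m _ (suc m))))

  pop-empty≤ : popTime 0 1 ≤ opTime 0
  pop-empty≤ = +-monoʳ-≤ (suc o) (+-monoʳ-≤ (1 * (suc m + 1)) (+-monoʳ-≤ (suc m) (+-monoʳ-≤ 1
    (+-mono-≤ (s≤s z≤n) (+-monoˡ-≤ (suc o + 1) (backTime-mono {0} {1} z≤n))))))

  opTime-mono : ∀ {i j} → i ≤ j → opTime i ≤ opTime j
  opTime-mono i≤j = +-monoʳ-≤ (suc o) (+-mono-≤ (*-monoˡ-≤ (suc m + 1) (s≤s i≤j)) (+-monoʳ-≤ (suc m) (+-monoʳ-≤ 1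
    (+-monoʳ-≤ (suc m) (+-monoˡ-≤ (suc o + 1) (backTime-mono (s≤s i≤j)))))))

  pop-run≤ : ∀ n → suc o + (suc (suc n) * (suc m + 1) + (suc m + (1 + (suc m + (backTime n + (suc o + 1)))))) ≤ opTime (suc n)
  pop-run≤ n = +-monoʳ-≤ (suc o) (+-monoʳ-≤ (suc (suc n) * (suc m + 1)) (+-monoʳ-≤ (suc m) (+-monoʳ-≤ 1
    (+-monoʳ-≤ (suc m) (+-monoˡ-≤ (suc o + 1) (backTime-mono (m≤n+m n 2)))))))

  Pol-opTime : Pol opTime
  Pol-opTime = Pol-+ (Pol-const (suc o)) (Pol-+ (Pol-* Pol-suc (Pol-const (suc m + 1))) (Pol-+ (Pol-const (suc m))
    (Pol-+ (Pol-const 1) (Pol-+ (Pol-const (suc m)) (Pol-+ (Pol-+ (Pol-* Pol-suc (Pol-const (1 + (suc m + 1)))) (Pol-const 2)) (Pol-const (suc o + 1)))))))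

-- Stack 0 holds input and output and lives on the right half of the tape; the other eight are
-- interleaved on the left half.
Env : Set
Env = Vec Str 9

half : Env → Dir → ℕ → Sym
half e lft a = cell (lookupV e (suc (a mod 8))) (a / 8)
half e rgt a = cell (lookupV e zero) a

dir : Fin 9 → Dir
dir zero    = rgt
dir (suc _) = lft

offset : Fin 9 → ℕ
offset zero    = 0
offset (suc i) = toℕ i

stride : Fin 9 → ℕ
stride zero    = 1
stride (suc _) = 8

module Stk (i : Fin 9) = Stack (dir i) (offset i) (stride i)

addr-rgt : ∀ d j → Stack.addr d 0 1 j ≡ j
addr-rgt d zero    = refl
addr-rgt d (suc j) = cong suc (addr-rgt d j)

addr-lft : ∀ d o j → Stack.addr d o 8 j ≡ o + j * 8
addr-lft d o zero    = refl
addr-lft d o (suc j) = trans (cong (8 +_) (addr-lft d o j)) (trans (sym (+-assoc 8 o (j * 8))) (trans (cong (_+ j * 8) (+-comm 8 o)) (+-assoc o 8 (j * 8))))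

track-mod : ∀ (i : Fin 8) j → (toℕ i + j * 8) mod 8 ≡ i
track-mod i j = toℕ-injective (trans (toℕ-fromℕ< (m%n<n (toℕ i + j * 8) 8)) (trans ([m+kn]%n≡m%n (toℕ i) j 8) (m<n⇒m%n≡m (toℕ<n i))))

track-div : ∀ (i : Fin 8) j → (toℕ i + j * 8) / 8 ≡ j
track-div i j = trans (+-distrib-/-∣ʳ (toℕ i) (divides j refl)) (cong₂ _+_ (m<n⇒m/n≡0 (toℕ<n i)) (m*n/n≡m j 8))

half-holds : ∀ e i → Stk.Holds i (half e (dir i)) (lookupV e i)
half-holds e zero    j = cong (cell (lookupV e zero)) (addr-rgt rgt j)
half-holds e (suc i) j = trans (cong (half e lft) (addr-lft lft (toℕ i) j))
  (cong₂ (λ r q → cell (lookupV e (suc r)) q) (track-mod i j) (track-div i j))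

AgreeOff : ℕ → Str → Str → Set
AgreeOff j₀ st′ st = ∀ j → j ≢ j₀ → cell st′ j ≡ cell st j

-- A left address determines its stack and its level as remainder and quotient by 8. A cell can
-- change only if both agree with those of the updated cell, that is, at a single address.
half-update : ∀ e i st j₀ → AgreeOff j₀ st (lookupV e i) →
              ∀ a → a ≢ Stk.addr i j₀ → half (e [ i ]≔ st) (dir i) a ≡ half e (dir i) a
half-update e zero st j₀ off a ne =
  trans (cong (λ s → cell s a) (lookup∘update zero e st)) (off a (λ eq → ne (trans eq (sym (addr-rgt rgt j₀)))))
half-update e (suc i) st j₀ off a ne with (a mod 8) ≟F i
... | no neq = cong (λ s → cell s (a / 8)) (lookup∘update′ (λ { refl → neq refl }) e st)
... | yes refl = trans (cong (λ s → cell s (a / 8)) (lookup∘update (suc i) e st)) (off (a / 8) λ eq →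
        ne (trans (m≡m%n+[m/n]*n a 8) (trans (cong₂ (λ r q → r + q * 8) (sym (toℕ-fromℕ< (m%n<n a 8))) eq) (sym (addr-lft lft (toℕ i) j₀)))))

half-other : ∀ e i st → half (e [ i ]≔ st) (opp (dir i)) ≗ half e (opp (dir i))
half-other e zero    st a = cong (λ s → cell s (a / 8)) (lookup∘update′ {i = suc (a mod 8)} {j = zero} (λ ()) e st)
half-other e (suc i) st a = cong (λ s → cell s a) (lookup∘update′ {i = zero} {j = suc i} (λ ()) e st)

record Rep (d : Dir) (e : Env) (w : Tape) : Set where
  constructor rep
  field home : At d 0 (half e d) (half e (opp d) ∘ suc) w

open Rep

-- The home cell is level 0 of stack 0 and of stack 1 at once. Both require a blank there, so
-- sharing it causes no conflict.
half-0 : ∀ e d → half e d 0 ≡ blank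
half-0 e lft = cell-0 (lookupV e (suc zero))
half-0 e rgt = cell-0 (lookupV e zero)

Rep-flip : ∀ {d e w} → Rep d e w → Rep (opp d) e w
Rep-flip {d} {e} (rep r) = rep (At-cong flipped other (At-flip r))
  where
  flipped : (half e d 0 ◂ (half e (opp d) ∘ suc)) ≗ half e (opp d)
  flipped zero    = trans (half-0 e d) (sym (half-0 e (opp d)))
  flipped (suc n) = refl
  other : ∀ n → half e d (suc n) ≡ half e (opp (opp d)) (suc n)
  other n = cong (λ d → half e d (suc n)) (sym (opp-opp d))
    where opp-opp : ∀ d → opp (opp d) ≡ d
          opp-opp lft = refl
          opp-opp rgt = refl

Rep-to : ∀ d {e w} → Rep lft e w → Rep d e w
Rep-to lft r = r
Rep-to rgt r = Rep-flip r

Rep-from : ∀ d {e w} → Rep d e w → Rep lft e w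
Rep-from lft r = r
Rep-from rgt r = Rep-flip r

Rep-update : ∀ {e w} i st → At (dir i) 0 (half (e [ i ]≔ st) (dir i)) (half e (opp (dir i)) ∘ suc) w → Rep lft (e [ i ]≔ st) w
Rep-update {e} i st a = Rep-from (dir i) (rep (At-cong (λ _ → refl) (λ n → sym (half-other e i st (suc n))) a))

holds-update : ∀ e i st → Stk.Holds i (half (e [ i ]≔ st) (dir i)) st
holds-update e i st j = trans (half-holds (e [ i ]≔ st) i j) (cong (λ s → cell s j) (lookup∘update i e st))

RunTo-map : ∀ {A} {m : Mach A} {w a P Q t} → (∀ {w′} → P w′ → Q w′) → RunTo m w a P t → RunTo m w a Q t
RunTo-map f (w′ , r , p) = w′ , r , f p

Rep-push : ∀ {e w} i b → Rep lft e w → RunTo (Stk.pushM i b) w tt (Rep lft (e [ i ]≔ (b ∷ lookupV e i))) (Stk.pushTime i (length (lookupV e i)))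
Rep-push {e} i b r = RunTo-map (Rep-update i (b ∷ lookupV e i))
  (Stk.push-run i {h = half e (dir i)} {st = lookupV e i} b (half-holds e i) (holds-update e i (b ∷ lookupV e i))
    (half-update e i (b ∷ lookupV e i) (suc (length (lookupV e i))) (cell-below b (lookupV e i))) (home (Rep-to (dir i) r)))

Rep-pop-[] : ∀ {e w} i → lookupV e i ≡ [] → Rep lft e w → RunTo (Stk.popM i) w nothing (Rep lft e) (Stk.popTime i 0 1)
Rep-pop-[] {e} i eq r = RunTo-map (Rep-from (dir i) ∘ rep)
  (Stk.pop-empty i (subst (Stk.Holds i (half e (dir i))) eq (half-holds e i)) (home (Rep-to (dir i) r)))

Rep-pop-∷ : ∀ {e w} i {b st} → lookupV e i ≡ b ∷ st → Rep lft e w →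
            ∃[ t ] (RunTo (Stk.popM i) w (just b) (Rep lft (e [ i ]≔ st)) t × t ≤ Stk.opTime i (suc (length st)))
Rep-pop-∷ {e} i {b} {st} eq r = _ , RunTo-map (Rep-update i st)
  (Stk.pop-run i {h = half e (dir i)} b st (subst (Stk.Holds i (half e (dir i))) eq (half-holds e i)) (holds-update e i st)
    (half-update e i st (suc (length st)) λ j ne → trans (sym (cell-below b st j ne)) (cong (λ s → cell s j) (sym eq))) (home (Rep-to (dir i) r))) ,
  Stk.pop-run≤ i (length st)

sumOver : ∀ {A : Set} → List A → (A → ℕ) → ℕ
sumOver []       f = 0
sumOver (x ∷ xs) f = f x + sumOver xs f

≤-sumOver : ∀ {A : Set} {xs : List A} {x} (f : A → ℕ) → x ∈ xs → f x ≤ sumOver xs f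
≤-sumOver f (here refl) = m≤m+n _ _
≤-sumOver {xs = y ∷ ys} f (there p) = ≤-trans (≤-sumOver f p) (m≤n+m _ (f y))

Pol-sumOver : ∀ {A : Set} xs {f : A → ℕ → ℕ} → (∀ x → Pol (f x)) → Pol (λ n → sumOver xs (λ x → f x n))
Pol-sumOver []       p = Pol-const 0
Pol-sumOver (x ∷ xs) p = Pol-+ (p x) (Pol-sumOver xs p)

abstract
  cost : ℕ → ℕ
  -- The 1 pays for the machine step of `ret`, and the sum bounds an operation on any stack.
  cost n = 1 + sumOver (allFin 9) (λ i → Stk.opTime i n)

  Pol-cost : Pol cost
  Pol-cost = Pol-+ (Pol-const 1) (Pol-sumOver (allFin 9) (λ i → Stk.Pol-opTime i))

  1≤cost : ∀ n → 1 ≤ cost n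
  1≤cost n = s≤s z≤n

  opTime≤cost : ∀ i n → Stk.opTime i n ≤ cost n
  opTime≤cost i n = m≤n⇒m≤1+n (≤-sumOver (λ i → Stk.opTime i n) (complete i))

size : ∀ {n} → Vec Str n → ℕ
size []       = 0
size (s ∷ e) = length s + size e

length≤size : ∀ {n} (e : Vec Str n) i → length (lookupV e i) ≤ size e
length≤size (s ∷ e) zero    = m≤m+n _ _
length≤size (s ∷ e) (suc i) = ≤-trans (length≤size e i) (m≤n+m _ (length s))

size-push : ∀ {n} (e : Vec Str n) i b → size (e [ i ]≔ (b ∷ lookupV e i)) ≡ suc (size e)
size-push (s ∷ e) zero    b = refl
size-push (s ∷ e) (suc i) b = trans (cong (length s +_) (size-push e i b)) (+-suc (length s) (size e))

size-pop : ∀ {n} (e : Vec Str n) i {b st} → lookupV e i ≡ b ∷ st → suc (size (e [ i ]≔ st)) ≡ size e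
size-pop (s ∷ e) zero    refl = refl
size-pop (s ∷ e) (suc i) eq   = trans (sym (+-suc (length s) _)) (cong (length s +_) (size-pop e i eq))

-- Stack programs

data Prog : Set → Set₁ where
  ret  : ∀ {A} → A → Prog A
  push : Fin 9 → Bool → Prog ⊤
  pop  : Fin 9 → Prog (Maybe Bool)
  bind : ∀ {A B} → {{Finite B}} → Prog B → (B → Prog A) → Prog A
  loop : ∀ {A B} → {{Finite B}} → (t : ℕ → ℕ) → Pol t → (B → Prog (B ⊎ A)) → B → Prog A

infixr 4 bind
syntax bind p (λ b → q) = b ← p ⨾ q

infixr 4 _⨾_

_⨾_ : ∀ {A} → Prog ⊤ → Prog A → Prog A
p ⨾ q = bind p (λ _ → q)

⟦_⟧ : ∀ {A} → Prog A → Mach A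
⟦ ret a ⟧               = retM a
⟦ push i b ⟧            = Stk.pushM i b
⟦ pop i ⟧               = Stk.popM i
⟦ bind {{F}} p f ⟧      = bindM F ⟦ p ⟧ (λ b → ⟦ f b ⟧)
⟦ loop {{F}} _ _ f b ⟧  = loopM F (λ b → ⟦ f b ⟧) b

-- The time of a loop is merely declared; Runs asserts that it is kept.
time : ∀ {A} → Prog A → ℕ → ℕ
time (ret a)           n = 1
time (push i b)        n = 1
time (pop i)           n = 1
time (bind {{F}} p f)  n = time p n + sumOver (Finite.elems F) (λ b → time (f b) (n + time p n))
time (loop t _ f b)    n = t n

Pol-time : ∀ {A} (p : Prog A) → Pol (time p)
Pol-time (ret a)          = Pol-const 1
Pol-time (push i b)       = Pol-const 1
Pol-time (pop i)          = Pol-const 1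
Pol-time (bind {{F}} p f) = Pol-+ (Pol-time p) (Pol-sumOver (Finite.elems F) (λ b → Pol-∘ (Pol-time (f b)) (Pol-+ Pol-id (Pol-time p))))
Pol-time (loop t pt f b)  = pt

-- t counts stack operations; each of them costs at most cost n machine steps as long as the stacks
-- have total size at most n.
record J {A : Set} (p : Prog A) (e : Env) (a : A) (e′ : Env) (t : ℕ) : Set where
  constructor mkJ
  field
    growth : size e′ ≤ size e + t
    runs   : ∀ n → size e + t ≤ n → ∀ {w} → Rep lft e w → ∃[ c ] (RunTo ⟦ p ⟧ w a (Rep lft e′) c × c ≤ t * cost n)

open J

J-ret : ∀ {A} {a : A} {e} → J (ret a) e a e 1
J-ret = mkJ (m≤m+n _ 1) λ n _ {w} r → 1 , (w , Run-ret w , r) , ≤-trans (1≤cost n) (≤-reflexive (sym (*-identityˡ (cost n))))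

within : ∀ i {c l n} → c ≤ Stk.opTime i l → l ≤ n → c ≤ 1 * cost n
within i {n = n} c≤ l≤ = ≤-trans c≤ (≤-trans (Stk.opTime-mono i l≤) (≤-trans (opTime≤cost i n) (≤-reflexive (sym (*-identityˡ (cost n))))))

J-push : ∀ {i b e} → J (push i b) e tt (e [ i ]≔ (b ∷ lookupV e i)) 1
J-push {i} {b} {e} = mkJ (≤-reflexive (trans (size-push e i b) (+-comm 1 (size e)))) λ n le r →
  _ , Rep-push i b r , within i (Stk.pushTime≤ i (length (lookupV e i))) (≤-trans (length≤size e i) (≤-trans (m≤m+n _ 1) le))

J-pop-[] : ∀ {i e} → lookupV e i ≡ [] → J (pop i) e nothing e 1
J-pop-[] {i} eq = mkJ (m≤m+n _ 1) λ n le r → _ , Rep-pop-[] i eq r , within i (Stk.pop-empty≤ i) z≤n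

J-pop-∷ : ∀ {i b st e} → lookupV e i ≡ b ∷ st → J (pop i) e (just b) (e [ i ]≔ st) 1
J-pop-∷ {i} {b} {st} {e} eq = mkJ (≤-trans (≤-trans (n≤1+n _) (≤-reflexive (size-pop e i eq))) (m≤m+n _ 1)) λ n le r →
  let c , run , c≤ = Rep-pop-∷ i eq r
  in c , run , within i c≤ (≤-trans (≤-reflexive (sym (cong length eq))) (≤-trans (length≤size e i) (≤-trans (m≤m+n _ 1) le)))

J-weaken : ∀ {A} {p : Prog A} {e a e′ t t′} → J p e a e′ t → t ≤ t′ → J p e a e′ t′
J-weaken {e = e} (mkJ g r) le = mkJ (≤-trans g (+-monoʳ-≤ (size e) le)) weaker
  where
  weaker : ∀ n → _ → ∀ {w} → _ → _
  weaker n b ρ with r n (≤-trans (+-monoʳ-≤ (size e) le) b) ρ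
  ... | c , run , c≤ = c , run , ≤-trans c≤ (*-monoˡ-≤ (cost n) le)

fits-left : ∀ s t {g n} → s + (t + g) ≤ n → s + t ≤ n
fits-left s t {g} = ≤-trans (+-monoʳ-≤ s (m≤m+n t g))

fits-right : ∀ s t {g s′} → s′ ≤ s + t → s′ + g ≤ s + (t + g)
fits-right s t {g} le = ≤-trans (+-monoˡ-≤ g le) (≤-reflexive (+-assoc s t g))

J-bind : ∀ {A B} {{_ : Finite B}} {p : Prog B} {f : B → Prog A} {e b e₁ a e₂ t t′} →
         J p e b e₁ t → J (f b) e₁ a e₂ t′ → J (bind p f) e a e₂ (t + t′)
J-bind {{F}} {p} {f} {e} {b} {e₁} {a} {e₂} {t} {t′} (mkJ g r) (mkJ g′ r′) =
  mkJ (≤-trans g′ (fits-right (size e) t g)) both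
  where
  both : ∀ n → size e + (t + t′) ≤ n → ∀ {w} → Rep lft e w → ∃[ c ] (RunTo ⟦ bind p f ⟧ w a (Rep lft e₂) c × c ≤ (t + t′) * cost n)
  both n le ρ with r n (fits-left (size e) t le) ρ
  ... | c , (w₁ , run , ρ₁) , c≤ with r′ n (≤-trans (fits-right (size e) t g) le) ρ₁
  ...   | c′ , (w₂ , run′ , ρ₂) , c′≤ =
    c + c′ , (w₂ , Run-bind F run run′ , ρ₂) , ≤-trans (+-mono-≤ c≤ c′≤) (≤-reflexive (sym (*-distribʳ-+ (cost n) t t′)))

module _ {A B : Set} {{F : Finite B}} {τ : ℕ → ℕ} {pτ : Pol τ} {f : B → Prog (B ⊎ A)} where

  J-exit : ∀ {b e a e₁ t} → J (f b) e (inj₂ a) e₁ t → J (loop τ pτ f b) e a e₁ t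
  J-exit {b} {e} {a} {e₁} {t} (mkJ g r) = mkJ g exits
    where
    exits : ∀ n → size e + t ≤ n → ∀ {w} → Rep lft e w → ∃[ c ] (RunTo ⟦ loop τ pτ f b ⟧ w a (Rep lft e₁) c × c ≤ t * cost n)
    exits n le ρ with r n le ρ
    ... | c , (w₁ , run , ρ₁) , c≤ = c , (w₁ , Run-loop-exit F run , ρ₁) , c≤

  J-again : ∀ {b b′ e a e₁ e₂ t t′} → J (f b) e (inj₁ b′) e₁ t → J (loop τ pτ f b′) e₁ a e₂ t′ → J (loop τ pτ f b) e a e₂ (t + t′)
  J-again {b} {b′} {e} {a} {e₁} {e₂} {t} {t′} (mkJ g r) (mkJ g′ r′) = mkJ (≤-trans g′ (fits-right (size e) t g)) both
    where
    both : ∀ n → size e + (t + t′) ≤ n → ∀ {w} → Rep lft e w → ∃[ c ] (RunTo ⟦ loop τ pτ f b ⟧ w a (Rep lft e₂) c × c ≤ (t + t′) * cost n)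
    both n le ρ with r n (fits-left (size e) t le) ρ
    ... | c , (w₁ , run , ρ₁) , c≤ with r′ n (≤-trans (fits-right (size e) t g) le) ρ₁
    ...   | c′ , (w₂ , run′ , ρ₂) , c′≤ =
      c + c′ , (w₂ , Run-loop-again F run run′ , ρ₂) , ≤-trans (+-mono-≤ c≤ c′≤) (≤-reflexive (sym (*-distribʳ-+ (cost n) t t′)))

-- Ties the time to the one computed from the program text, so that correctness proofs of programs
-- without new loops contain no arithmetic.
record Runs {A : Set} (p : Prog A) (e : Env) (a : A) (e′ : Env) : Set where
  constructor mkRuns
  field judged : J p e a e′ (time p (size e))

open Runs

Runs-ret : ∀ {A} {a : A} {e} → Runs (ret a) e a e
Runs-ret = mkRuns J-ret

Runs-push : ∀ {i b e} → Runs (push i b) e tt (e [ i ]≔ (b ∷ lookupV e i))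
Runs-push = mkRuns J-push

Runs-pop-[] : ∀ {i e} → lookupV e i ≡ [] → Runs (pop i) e nothing e
Runs-pop-[] eq = mkRuns (J-pop-[] eq)

Runs-pop-∷ : ∀ {i b st e} → lookupV e i ≡ b ∷ st → Runs (pop i) e (just b) (e [ i ]≔ st)
Runs-pop-∷ eq = mkRuns (J-pop-∷ eq)

-- `time` charges all branches, each for the largest stacks that the first part could leave. By
-- `growth` the actual stacks are no larger, and the branch taken is one summand.
Runs-bind : ∀ {A B} {{_ : Finite B}} {p : Prog B} {f : B → Prog A} {e b e₁ a e₂} →
            Runs p e b e₁ → Runs (f b) e₁ a e₂ → Runs (bind p f) e a e₂
Runs-bind {{F}} {p} {f} {e} {b} (mkRuns j) (mkRuns j′) = mkRuns (J-bind j (J-weaken j′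
  (≤-trans (mono (Pol-time (f b)) (growth j)) (≤-sumOver (λ b → time (f b) (size e + time p (size e))) (complete b)))))

-- Stacks grow away from home, so the first letter of the input is the bottom of stack 0.
initEnv : Str → Env
initEnv x = reverse x ∷ V.replicate 8 []

cell-ʳ++-low : ∀ y acc j → j ≤ length acc → cell (y ʳ++ acc) j ≡ cell acc j
cell-ʳ++-low []      acc j le = refl
cell-ʳ++-low (b ∷ y) acc j le = trans (cell-ʳ++-low y (b ∷ acc) j (m≤n⇒m≤1+n le)) (cell-below b acc j (<⇒≢ (s≤s le)))

cell-ʳ++-high : ∀ y acc n → cell (y ʳ++ acc) (suc (length acc + n)) ≡ look (map toSym y) n
cell-ʳ++-high []      acc n       = trans (cell-above acc _ (s≤s (m≤m+n _ n))) (sym (look-[] n))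
cell-ʳ++-high (b ∷ y) acc zero    = trans (cell-ʳ++-low y (b ∷ acc) _ (≤-reflexive (cong suc (+-identityʳ _))))
                                      (trans (cong (λ l → cell (b ∷ acc) (suc l)) (+-identityʳ (length acc))) (cell-top b acc))
cell-ʳ++-high (b ∷ y) acc (suc n) = trans (cong (λ l → cell (y ʳ++ b ∷ acc) (suc l)) (+-suc (length acc) n)) (cell-ʳ++-high y (b ∷ acc) n)

cell-reverse : ∀ y n → cell (reverse y) (suc n) ≡ look (map toSym y) n
cell-reverse y = cell-ʳ++-high y []

takeBits-hd-tl : ∀ r → takeBits (hd r ∷ tl r) ≡ takeBits r
takeBits-hd-tl []      = refl
takeBits-hd-tl (_ ∷ _) = refl

takeBits-look : ∀ y r → (∀ n → look r n ≡ look (map toSym y) n) → takeBits r ≡ y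
takeBits-look []          []          eq = refl
takeBits-look []          (blank ∷ r) eq = refl
takeBits-look []          (s0 ∷ r)    eq with () ← eq 0
takeBits-look []          (s1 ∷ r)    eq with () ← eq 0
takeBits-look (false ∷ y) (s0 ∷ r)    eq = cong (false ∷_) (takeBits-look y r (eq ∘ suc))
takeBits-look (true ∷ y)  (s1 ∷ r)    eq = cong (true ∷_) (takeBits-look y r (eq ∘ suc))
takeBits-look (true ∷ y)  (s0 ∷ r)    eq with () ← eq 0
takeBits-look (true ∷ y)  (blank ∷ r) eq with () ← eq 0
takeBits-look (false ∷ y) (s1 ∷ r)    eq with () ← eq 0
takeBits-look (false ∷ y) (blank ∷ r) eq with () ← eq 0
takeBits-look (true ∷ y)  []          eq with () ← eq 0
takeBits-look (false ∷ y) []          eq with () ← eq 0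

Rep-init : ∀ x → Rep lft (initEnv x) (moveT (initTape x) (cur (initTape x)) L)
Rep-init x = rep (at (λ n → trans (look-[] n) (sym (cong (λ s → cell s ((n + 1) / 8)) (lookup-replicate ((n + 1) mod 8) []))))
                refl (λ n → trans (start-look x n) (sym (cell-reverse x n))))
  where
  start-look : ∀ x n → look (hd (map toSym x) ∷ tl (map toSym x)) n ≡ look (map toSym x) n
  start-look x zero    = refl
  start-look x (suc n) = refl

wholeM : Prog Bool → Mach Bool
-- Home is the blank cell to the left of the input, as level 0 of stack 0 must be blank. The last
-- move puts the head on the first letter of the output.
wholeM p = bindM Finite-⊤ (actM (λ s → tt , s , L)) λ _ → bindM Finite-Bool ⟦ p ⟧ λ b → actM (λ s → b , s , R)

outcome : Bool → Str → Maybe Str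
outcome true  y = just y
outcome false y = nothing

wholeTime : Prog Bool → ℕ → ℕ
wholeTime p n = 1 + (time p n * cost (n + time p n) + 1)

Pol-wholeTime : ∀ p → Pol (wholeTime p)
Pol-wholeTime p = Pol-+ (Pol-const 1) (Pol-+ (Pol-* (Pol-time p) (Pol-∘ Pol-cost (Pol-+ Pol-id (Pol-time p)))) (Pol-const 1))

size-init : ∀ x → size (initEnv x) ≡ length x
size-init x = trans (+-identityʳ _) (trans (length-ʳ++ x) (+-identityʳ _))

exec-prog : ∀ p x b y e → Runs p (initEnv x) b (reverse y ∷ e) → ∀ T → wholeTime p (length x) ≤ T →
            exec (Compile.toTM (wholeM p)) T x ≡ just (outcome b y)
exec-prog p x b y e (mkRuns j) T le with runs j _ ≤-refl (Rep-init x)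
... | c , (w , run , r) , c≤ = trans (exec-run {m = wholeM p} {x = x} total (≤-trans bound′ le)) (cong just (out b))
  where
  total : Run (wholeM p) (initTape x) b (moveT w (cur w) R) (1 + (c + 1))
  total = Run-bind Finite-⊤ (Run-act (initTape x) refl) (Run-bind Finite-Bool run (Run-act w refl))
  bound′ : 1 + (c + 1) ≤ wholeTime p (length x)
  bound′ = s≤s (+-monoˡ-≤ 1 (subst (λ n → c ≤ time p n * cost (n + time p n)) (size-init x) c≤))
  out : ∀ b → output (moveT w (cur w) R) b ≡ outcome b y
  out true  = cong just (trans (takeBits-hd-tl (right w)) (takeBits-look y (right w) (λ n → trans (At.behind (home r) n) (cell-reverse y n))))
  out false = refl

abstract
  machine : Prog Bool → TM
  machine p = Compile.toTM (wholeM p)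

  degree : Prog Bool → ℕ
  degree p = proj₁ (poly-dominates (Pol-wholeTime p))

  machine-computes : ∀ p x {b y e} → Runs p (initEnv x) b (reverse y ∷ e) → exec (machine p) (poly (degree p) (length x)) x ≡ just (outcome b y)
  machine-computes p x r = exec-prog p x _ _ _ r _ (proj₂ (poly-dominates (Pol-wholeTime p)) (length x))

J-to : ∀ {A} {p : Prog A} {e a e′ e″ t} → J p e a e′ t → e′ ≡ e″ → J p e a e″ t
J-to j refl = j

J-from : ∀ {A} {p : Prog A} {e e₀ a e′ t} → e ≡ e₀ → J p e₀ a e′ t → J p e a e′ t
J-from refl j = j

Runs-to : ∀ {A} {p : Prog A} {e a e′ e″} → Runs p e a e′ → e′ ≡ e″ → Runs p e a e″
Runs-to r refl = r

Runs-loop : ∀ {A B} {{_ : Finite B}} {τ pτ} {f : B → Prog (B ⊎ A)} {b e a e′ t} →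
            J (loop τ pτ f b) e a e′ t → t ≤ τ (size e) → Runs (loop τ pτ f b) e a e′
Runs-loop j le = mkRuns (J-weaken j le)

-- Transferring and parsing the contents of stacks

pushWord : Fin 9 → Str → Prog ⊤
pushWord i []      = ret tt
pushWord i (b ∷ w) = pushWord i w ⨾ push i b

J-pushWord : ∀ {i e} w → J (pushWord i w) e tt (e [ i ]≔ (w ++ lookupV e i)) (suc (length w))
J-pushWord {i} {e} []      = J-to J-ret (sym ([]≔-lookup e i))
J-pushWord {i} {e} (b ∷ w) = J-weaken (J-bind (J-pushWord w) (J-to J-push
  (trans ([]≔-idempotent e i) (cong (λ s → e [ i ]≔ (b ∷ s)) (lookup∘update i e _))))) (≤-reflexive (+-comm (suc (length w)) 1))

Runs-pushWord : ∀ {i e} w → Runs (pushWord i w) e tt (e [ i ]≔ (w ++ lookupV e i))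
Runs-pushWord {i} {e} w = mkRuns (J-weaken (J-pushWord w) (pushWord-time w (size e)))
  where
  pushWord-time : ∀ w n → suc (length w) ≤ time (pushWord i w) n
  pushWord-time []      n = ≤-refl
  pushWord-time (b ∷ w) n = ≤-trans (≤-reflexive (+-comm 1 (suc (length w)))) (+-monoˡ-≤ 1 (pushWord-time w n))

module _ {i j : Fin 9} (i≢j : i ≢ j) where

  set₁ : ∀ (e : Env) {a b a′} → ((e [ i ]≔ a) [ j ]≔ b) [ i ]≔ a′ ≡ (e [ i ]≔ a′) [ j ]≔ b
  set₁ e {a} {b} {a′} = trans ([]≔-commutes (e [ i ]≔ a) j i (i≢j ∘ sym)) (cong (_[ j ]≔ b) ([]≔-idempotent e i))

  get₁ : ∀ (e : Env) {a b} → lookupV ((e [ i ]≔ a) [ j ]≔ b) i ≡ a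
  get₁ e {a} {b} = trans (lookup∘update′ i≢j (e [ i ]≔ a) b) (lookup∘update i e a)

  reset : ∀ (e : Env) → e ≡ (e [ i ]≔ lookupV e i) [ j ]≔ lookupV e j
  reset e = sym (trans (cong (_[ j ]≔ lookupV e j) ([]≔-lookup e i)) ([]≔-lookup e j))

-- The effect of popping `s` and pushing a word for each letter: the letters come in reverse order,
-- but every word stays as it is.
rewords : (Bool → Str) → Str → Str → Str
rewords w []      acc = acc
rewords w (b ∷ s) acc = rewords w s (w b ++ acc)

rewords-concatMap : ∀ w s acc → rewords w s acc ≡ concatMap w (reverse s) ++ acc
rewords-concatMap w []      acc = refl
rewords-concatMap w (b ∷ s) acc = begin
  rewords w s (w b ++ acc)                          ≡⟨ rewords-concatMap w s (w b ++ acc) ⟩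
  concatMap w (reverse s) ++ w b ++ acc             ≡⟨ sym (++-assoc (concatMap w (reverse s)) (w b) acc) ⟩
  (concatMap w (reverse s) ++ w b) ++ acc           ≡⟨ cong (λ z → (concatMap w (reverse s) ++ z) ++ acc) (sym (++-identityʳ (w b))) ⟩
  (concatMap w (reverse s) ++ concatMap w (b ∷ [])) ++ acc ≡⟨ cong (_++ acc) (sym (concatMap-++ w (reverse s) (b ∷ []))) ⟩
  concatMap w (reverse s ++ b ∷ []) ++ acc          ≡⟨ cong (λ z → concatMap w z ++ acc) (sym (ʳ++-defn s)) ⟩
  concatMap w (s ʳ++ b ∷ []) ++ acc                 ∎
  where open ≡-Reasoning

rewords-move : ∀ s acc → rewords (_∷ []) s acc ≡ s ʳ++ acc
rewords-move []      acc = refl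
rewords-move (b ∷ s) acc = rewords-move s (b ∷ acc)

rewords-clear : ∀ s acc → rewords (λ _ → []) s acc ≡ acc
rewords-clear []      acc = refl
rewords-clear (b ∷ s) acc = rewords-clear s acc

-- A single loop for most data handling. Depending on the words it moves, copies, clears, doubles,
-- counts or repeats; a stack can be copied only by emptying it onto two others.
module Spill (i j : Fin 9) (w : Bool → Str) (k : Fin 9) (v : Bool → Str) where

  spillCost : ℕ
  spillCost = 1 + ((1 + (length (w true) + length (w false))) + ((1 + (length (v true) + length (v false))) + 1))

  after : Maybe Bool → Prog (⊤ ⊎ ⊤)
  after nothing  = ret (inj₂ tt)
  after (just b) = pushWord j (w b) ⨾ pushWord k (v b) ⨾ ret (inj₁ tt)

  spill : Prog ⊤
  spill = loop (linear spillCost) (Pol-linear spillCost) (λ _ → bind (pop i) after) tt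

  module _ (i≢j : i ≢ j) (i≢k : i ≢ k) (j≢k : j ≢ k) (e : Env) where

    state : Str → Str → Str → Env
    state a b c = ((e [ i ]≔ a) [ j ]≔ b) [ k ]≔ c

    one : ∀ b → length (w b) ≤ length (w true) + length (w false)
    one true  = m≤m+n _ _
    one false = m≤n+m _ (length (w true))

    one-v : ∀ b → length (v b) ≤ length (v true) + length (v false)
    one-v true  = m≤m+n _ _
    one-v false = m≤n+m _ (length (v true))

    get-i : ∀ {a b c} → lookupV (state a b c) i ≡ a
    get-i {a} {b} {c} = trans (lookup∘update′ i≢k ((e [ i ]≔ a) [ j ]≔ b) c) (get₁ i≢j e)

    popped : ∀ {a b c a′} → state a b c [ i ]≔ a′ ≡ state a′ b c
    popped {a} {b} {c} = trans ([]≔-commutes _ k i (i≢k ∘ sym)) (cong (_[ k ]≔ c) (set₁ i≢j e))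

    pushed-j : ∀ {a b c} u → state a b c [ j ]≔ (u ++ lookupV (state a b c) j) ≡ state a (u ++ b) c
    pushed-j {a} {b} {c} u = trans ([]≔-commutes _ k j (j≢k ∘ sym)) (cong (_[ k ]≔ c) (trans ([]≔-idempotent (e [ i ]≔ a) j)
      (cong (λ z → (e [ i ]≔ a) [ j ]≔ (u ++ z)) (trans (lookup∘update′ j≢k ((e [ i ]≔ a) [ j ]≔ b) c) (lookup∘update j (e [ i ]≔ a) b)))))

    pushed-k : ∀ {a b c} u → state a b c [ k ]≔ (u ++ lookupV (state a b c) k) ≡ state a b (u ++ c)
    pushed-k {a} {b} {c} u = trans ([]≔-idempotent _ k) (cong (λ z → ((e [ i ]≔ a) [ j ]≔ b) [ k ]≔ (u ++ z)) (lookup∘update k ((e [ i ]≔ a) [ j ]≔ b) c))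

    J-spill : ∀ s b c → J spill (state s b c) tt (state [] (rewords w s b) (rewords v s c)) (suc (length s) * spillCost)
    J-spill []      b c = J-weaken (J-exit (J-bind (J-pop-[] get-i) J-ret)) (≤-trans (s≤s (≤-trans (s≤s z≤n)
                            (+-monoʳ-≤ (1 + (length (w true) + length (w false))) (m≤n+m 1 (1 + (length (v true) + length (v false))))))) (m≤m+n spillCost 0))
    J-spill (x ∷ s) b c = J-weaken
      (J-again (J-bind (J-to (J-pop-∷ get-i) popped) (J-bind (J-to (J-pushWord (w x)) (pushed-j (w x)))
                 (J-bind (J-to (J-pushWord (v x)) (pushed-k (v x))) J-ret))) (J-spill s (w x ++ b) (v x ++ c)))
      (+-monoˡ-≤ (suc (length s) * spillCost) (+-monoʳ-≤ 1 (+-mono-≤ (s≤s (one x)) (+-monoˡ-≤ 1 (s≤s (one-v x))))))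

    initial : e ≡ state (lookupV e i) (lookupV e j) (lookupV e k)
    initial = trans (reset i≢j e) (sym (trans (cong (_ [ k ]≔_) (cong (λ e → lookupV e k) (reset i≢j e))) ([]≔-lookup _ k)))

  spilled : Env → Env
  spilled e = ((e [ i ]≔ []) [ j ]≔ rewords w (lookupV e i) (lookupV e j)) [ k ]≔ rewords v (lookupV e i) (lookupV e k)

  J-spilled : i ≢ j → i ≢ k → j ≢ k → ∀ {e} → J spill e tt (spilled e) (suc (length (lookupV e i)) * spillCost)
  J-spilled i≢j i≢k j≢k {e} = J-from (initial i≢j i≢k j≢k e) (J-spill i≢j i≢k j≢k e (lookupV e i) (lookupV e j) (lookupV e k))

  Runs-spill : i ≢ j → i ≢ k → j ≢ k → ∀ {e} → Runs spill e tt (spilled e)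
  Runs-spill i≢j i≢k j≢k {e} = Runs-loop (J-spilled i≢j i≢k j≢k) (*-monoˡ-≤ spillCost (s≤s (length≤size e i)))

open Spill using (spill; J-spilled; Runs-spill)

-- Follows the stack program `unpair`: the first component arrives reversed, being pushed as it is
-- popped, and the second is what has not been read. The strings returned on failure describe the
-- stacks at that moment.
undouble : Str → Str → Bool × Str × Str
undouble acc (false ∷ false ∷ s) = undouble (false ∷ acc) s
undouble acc (true ∷ true ∷ s)   = undouble (true ∷ acc) s
undouble acc (false ∷ true ∷ s)  = true , acc , s
undouble acc (true ∷ false ∷ s)  = false , acc , s
undouble acc (b ∷ [])            = false , acc , []
undouble acc []                  = false , acc , []

undouble-pair : ∀ acc x y → undouble acc (pair x y) ≡ (true , x ʳ++ acc , y)
undouble-pair acc []          y = refl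
undouble-pair acc (false ∷ x) y = undouble-pair (false ∷ acc) x y
undouble-pair acc (true ∷ x)  y = undouble-pair (true ∷ acc) x y

undouble-pair⁻ : ∀ acc s {xr y} → undouble acc s ≡ (true , xr , y) → ∃[ x ] (xr ≡ x ʳ++ acc × s ≡ pair x y)
undouble-pair⁻ acc (false ∷ false ∷ s) eq = let x , p , q = undouble-pair⁻ (false ∷ acc) s eq in false ∷ x , p , cong (λ s → false ∷ false ∷ s) q
undouble-pair⁻ acc (true ∷ true ∷ s)   eq = let x , p , q = undouble-pair⁻ (true ∷ acc) s eq in true ∷ x , p , cong (λ s → true ∷ true ∷ s) q
undouble-pair⁻ acc (false ∷ true ∷ s)  refl = [] , refl , refl
undouble-pair⁻ acc (true ∷ false ∷ s)  ()
undouble-pair⁻ acc (false ∷ [])        ()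
undouble-pair⁻ acc (true ∷ [])         ()
undouble-pair⁻ acc []                  ()

module Unpair (i k : Fin 9) where

  dispatch : Bool → Bool → Prog (⊤ ⊎ Bool)
  dispatch false false = push k false ⨾ ret (inj₁ tt)
  dispatch true  true  = push k true ⨾ ret (inj₁ tt)
  dispatch false true  = ret (inj₂ true)
  dispatch true  false = ret (inj₂ false)

  second : Bool → Maybe Bool → Prog (⊤ ⊎ Bool)
  second b nothing  = ret (inj₂ false)
  second b (just c) = dispatch b c

  first : Maybe Bool → Prog (⊤ ⊎ Bool)
  first nothing  = ret (inj₂ false)
  first (just b) = bind (pop i) (second b)

  unpair : Prog Bool
  unpair = loop (linear 4) (Pol-linear 4) (λ _ → bind (pop i) first) tt

  module _ (i≢k : i ≢ k) (e : Env) where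

    state : Str → Str → Env
    state a b = (e [ i ]≔ a) [ k ]≔ b

    result : Bool × Str × Str → Env
    result (_ , acc , s) = state s acc

    pushed : ∀ {a b} c → state a b [ k ]≔ (c ∷ lookupV (state a b) k) ≡ state a (c ∷ b)
    pushed {a} {b} c = trans ([]≔-idempotent (e [ i ]≔ a) k) (cong (λ z → (e [ i ]≔ a) [ k ]≔ (c ∷ z)) (lookup∘update k (e [ i ]≔ a) b))

    J-pop₂ : ∀ {b c s acc a e′ t} → J (dispatch b c) (state s acc) a e′ t → J (bind (pop i) first) (state (b ∷ c ∷ s) acc) a e′ (1 + (1 + t))
    J-pop₂ j = J-bind (J-to (J-pop-∷ (get₁ i≢k e)) (set₁ i≢k e)) (J-bind (J-to (J-pop-∷ (get₁ i≢k e)) (set₁ i≢k e)) j)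

    two-more : ∀ l → 4 + suc l * 4 ≤ suc (suc (suc l)) * 4
    two-more l = +-monoʳ-≤ 4 (m≤n+m (suc l * 4) 4)

    J-unpair : ∀ s acc → J unpair (state s acc) (proj₁ (undouble acc s)) (result (undouble acc s)) (suc (length s) * 4)
    J-unpair (false ∷ false ∷ s) acc = J-weaken (J-again (J-pop₂ (J-bind (J-to J-push (pushed false)) J-ret)) (J-unpair s (false ∷ acc))) (two-more (length s))
    J-unpair (true ∷ true ∷ s)   acc = J-weaken (J-again (J-pop₂ (J-bind (J-to J-push (pushed true)) J-ret)) (J-unpair s (true ∷ acc))) (two-more (length s))
    J-unpair (false ∷ true ∷ s)  acc = J-weaken (J-exit (J-pop₂ J-ret)) (s≤s (s≤s (s≤s z≤n)))
    J-unpair (true ∷ false ∷ s)  acc = J-weaken (J-exit (J-pop₂ J-ret)) (s≤s (s≤s (s≤s z≤n)))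
    J-unpair (false ∷ [])        acc = J-weaken (J-exit (J-bind (J-to (J-pop-∷ (get₁ i≢k e)) (set₁ i≢k e)) (J-bind (J-pop-[] (get₁ i≢k e)) J-ret))) (s≤s (s≤s (s≤s z≤n)))
    J-unpair (true ∷ [])         acc = J-weaken (J-exit (J-bind (J-to (J-pop-∷ (get₁ i≢k e)) (set₁ i≢k e)) (J-bind (J-pop-[] (get₁ i≢k e)) J-ret))) (s≤s (s≤s (s≤s z≤n)))
    J-unpair []                  acc = J-weaken (J-exit (J-bind (J-pop-[] (get₁ i≢k e)) J-ret)) (s≤s (s≤s z≤n))

  Runs-unpair : i ≢ k → ∀ {e ok acc s} → undouble (lookupV e k) (lookupV e i) ≡ (ok , acc , s) →
                Runs unpair e ok ((e [ i ]≔ s) [ k ]≔ acc)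
  Runs-unpair i≢k {e} refl = Runs-loop (J-from (reset i≢k e) (J-unpair i≢k e (lookupV e i) (lookupV e k))) (*-monoˡ-≤ 4 (s≤s (length≤size e i)))

open Unpair using (unpair; Runs-unpair)

infixr 3 _⟫_

_⟫_ : ∀ {A B} {{_ : Finite B}} {p : Prog B} {f : B → Prog A} {e b e₁ a e₂} →
      Runs p e b e₁ → Runs (f b) e₁ a e₂ → Runs (bind p f) e a e₂
_⟫_ = Runs-bind

J-is : ∀ {A} {p p′ : Prog A} {e a e′ t} → p ≡ p′ → J p′ e a e′ t → J p e a e′ t
J-is refl j = j

pattern #0 = zero
pattern #1 = suc #0
pattern #2 = suc #1
pattern #3 = suc #2
pattern #4 = suc #3
pattern #5 = suc #4
pattern #6 = suc #5
pattern #7 = suc #6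
pattern #8 = suc #7

spill₁ : (i j : Fin 9) → (Bool → Str) → Fin 9 → Prog ⊤
spill₁ i j w k = spill i j w k (λ _ → [])

Runs-spill₁ : ∀ {i j w k} → i ≢ j → i ≢ k → j ≢ k → ∀ {e} →
              Runs (spill₁ i j w k) e tt ((e [ i ]≔ []) [ j ]≔ rewords w (lookupV e i) (lookupV e j))
Runs-spill₁ {i} {j} {w} {k} i≢j i≢k j≢k {e} = Runs-to (Runs-spill i j w k (λ _ → []) i≢j i≢k j≢k)
  (trans (cong (e′ [ k ]≔_) (trans (rewords-clear (lookupV e i) (lookupV e k)) (sym other))) ([]≔-lookup e′ k))
  where
  e′ : Env
  e′ = (e [ i ]≔ []) [ j ]≔ rewords w (lookupV e i) (lookupV e j)
  other : lookupV e′ k ≡ lookupV e k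
  other = trans (lookup∘update′ (j≢k ∘ sym) (e [ i ]≔ []) _) (lookup∘update′ (i≢k ∘ sym) e [])

move : Fin 9 → Fin 9 → Fin 9 → Prog ⊤
move i j k = spill₁ i j (_∷ []) k

Runs-move : ∀ {i j k} → i ≢ j → i ≢ k → j ≢ k → ∀ {e} →
            Runs (move i j k) e tt ((e [ i ]≔ []) [ j ]≔ (lookupV e i ʳ++ lookupV e j))
Runs-move {i} {j} i≢j i≢k j≢k {e} = Runs-to (Runs-spill₁ i≢j i≢k j≢k) (cong ((e [ i ]≔ []) [ j ]≔_) (rewords-move (lookupV e i) (lookupV e j)))

clear : Fin 9 → Fin 9 → Fin 9 → Prog ⊤
clear i j k = spill₁ i j (λ _ → []) k

Runs-clear : ∀ {i j k} → i ≢ j → i ≢ k → j ≢ k → ∀ {e} → Runs (clear i j k) e tt (e [ i ]≔ [])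
Runs-clear {i} {j} i≢j i≢k j≢k {e} = Runs-to (Runs-spill₁ i≢j i≢k j≢k)
  (trans (cong ((e [ i ]≔ []) [ j ]≔_) (trans (rewords-clear (lookupV e i) (lookupV e j)) (sym (lookup∘update′ (i≢j ∘ sym) e [])))) ([]≔-lookup (e [ i ]≔ []) j))

-- Running a Turing machine on stacks

-- A prefix code, so that symbols can be popped bit by bit. An exhausted stack is read as a blank,
-- just as the tape beyond its listed cells.
symWord : Sym → Str
symWord s0    = true ∷ false ∷ []
symWord s1    = true ∷ true ∷ []
symWord blank = false ∷ []

code : List Sym → Str
code = concatMap symWord

bitWord : Bool → Str
bitWord b = true ∷ b ∷ []

code-bits : ∀ x → concatMap bitWord x ≡ code (map toSym x)
code-bits []          = refl
code-bits (false ∷ x) = cong (λ z → true ∷ false ∷ z) (code-bits x)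
code-bits (true ∷ x)  = cong (λ z → true ∷ true ∷ z) (code-bits x)

rewords-bits : ∀ x → rewords bitWord (reverse x) [] ≡ code (map toSym x)
rewords-bits x = trans (rewords-concatMap bitWord (reverse x) []) (trans (++-identityʳ _) (trans (cong (concatMap bitWord) (reverse-involutive x)) (code-bits x)))

length≤code : ∀ l → length l ≤ length (code l)
length≤code []          = z≤n
length≤code (s0 ∷ l)    = s≤s (m≤n⇒m≤1+n (length≤code l))
length≤code (s1 ∷ l)    = s≤s (m≤n⇒m≤1+n (length≤code l))
length≤code (blank ∷ l) = s≤s (length≤code l)

bitSym : Maybe Bool → Sym
bitSym nothing  = blank
bitSym (just b) = toSym b

popSym : Fin 9 → Prog Sym
popSym i = bind (pop i) rest
  where
  rest : Maybe Bool → Prog Sym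
  rest nothing      = ret blank
  rest (just false) = ret blank
  rest (just true)  = bind (pop i) (λ b → ret (bitSym b))

J-popSym : ∀ {i e} l → lookupV e i ≡ code l → J (popSym i) e (hd l) (e [ i ]≔ code (tl l)) 3
J-popSym {i} {e} []          eq = J-to (J-weaken (J-bind (J-pop-[] eq) J-ret) (s≤s (s≤s z≤n))) (sym (trans (cong (e [ i ]≔_) (sym eq)) ([]≔-lookup e i)))
J-popSym {i} {e} (blank ∷ l) eq = J-weaken (J-bind (J-pop-∷ eq) J-ret) (s≤s (s≤s z≤n))
J-popSym {i} {e} (s0 ∷ l)    eq = J-to (J-bind (J-pop-∷ eq) (J-bind (J-pop-∷ (lookup∘update i e _)) J-ret)) ([]≔-idempotent e i)
J-popSym {i} {e} (s1 ∷ l)    eq = J-to (J-bind (J-pop-∷ eq) (J-bind (J-pop-∷ (lookup∘update i e _)) J-ret)) ([]≔-idempotent e i)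

Runs-popSym : ∀ {i e} l → lookupV e i ≡ code l → Runs (popSym i) e (hd l) (e [ i ]≔ code (tl l))
Runs-popSym l eq = mkRuns (J-weaken (J-popSym l eq) (s≤s (s≤s (s≤s z≤n))))

pushSym : Fin 9 → Sym → Prog ⊤
pushSym i s = pushWord i (symWord s)

J-pushSym : ∀ {i e} s → J (pushSym i s) e tt (e [ i ]≔ (symWord s ++ lookupV e i)) 3
J-pushSym s = J-weaken (J-pushWord (symWord s)) (s≤s (word≤2 s))
  where
  word≤2 : ∀ s → length (symWord s) ≤ 2
  word≤2 s0    = ≤-refl
  word≤2 s1    = ≤-refl
  word≤2 blank = s≤s z≤n

-- A tape is kept with its halves on stacks 2 and 3 and the scanned symbol in the control state.
tapeEnv : Str → Str → Tape → Vec Str 5 → Env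
tapeEnv io x w rest = io ∷ x ∷ code (left w) ∷ code (right w) ∷ rest

moveHead : Sym → Move → Prog Sym
moveHead s L = pushSym #3 s ⨾ popSym #2
moveHead s R = pushSym #2 s ⨾ popSym #3
moveHead s S = ret s

J-moveHead : ∀ {io x rest} w s m → J (moveHead s m) (tapeEnv io x w rest) (cur (moveT w s m)) (tapeEnv io x (moveT w s m) rest) 6
J-moveHead w s L = J-bind (J-pushSym s) (J-popSym (left w) refl)
J-moveHead w s R = J-bind (J-pushSym s) (J-popSym (right w) refl)
J-moveHead w s S = J-weaken J-ret (s≤s z≤n)

confTape : ∀ {n} → Config n → Tape
confTape (conf q l c r) = tape l c r

module Call (M : TM) where

  simAct : Sym → Action (suc (TM.states M)) → Prog ((Fin (suc (TM.states M)) × Sym) ⊎ (Bool × Sym))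
  simAct c accept      = ret (inj₂ (true , c))
  simAct c reject      = ret (inj₂ (false , c))
  simAct c (go q s m)  = bind (moveHead s m) (λ c′ → ret (inj₁ (q , c′)))

  simulate : (τ : ℕ → ℕ) → Pol τ → Fin (suc (TM.states M)) × Sym → Prog (Bool × Sym)
  simulate τ pτ = loop τ pτ (λ { (q , c) → simAct c (TM.δ M q c) })

  J-simulate : ∀ {τ pτ io x rest b c} T q w → run M T (toConf q w) ≡ just (b , c) →
               J (simulate τ pτ (q , cur w)) (tapeEnv io x w rest) (b , cur (confTape c)) (tapeEnv io x (confTape c) rest) (T * 7 + 1)
  J-simulate T q w r with TM.δ M q (cur w) in eq
  J-simulate T q w refl | accept = J-weaken (J-exit (J-is (cong (simAct (cur w)) eq) J-ret)) (m≤n+m 1 (T * 7))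
  J-simulate T q w refl | reject = J-weaken (J-exit (J-is (cong (simAct (cur w)) eq) J-ret)) (m≤n+m 1 (T * 7))
  J-simulate (suc T) q w r | go q′ s m =
    J-again (J-is (cong (simAct (cur w)) eq) (J-bind (J-moveHead w s m) J-ret))
            (J-simulate T q′ (moveT w s m) (trans (cong (run M T) (sym (moveConf≡ q′ w s m))) r))

  readSym : Sym → Prog (Sym ⊎ ⊤)
  readSym s0    = push #1 false ⨾ bind (popSym #3) (λ c → ret (inj₁ c))
  readSym s1    = push #1 true ⨾ bind (popSym #3) (λ c → ret (inj₁ c))
  readSym blank = ret (inj₂ tt)

  readout : Sym → Prog ⊤
  readout = loop (λ n → (n + 2) * 5) (Pol-* (Pol-+ Pol-id (Pol-const 2)) (Pol-const 5)) readSym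

  J-readout : ∀ {io l rest} r c out → ∃[ z ] J (readout c) (io ∷ out ∷ l ∷ code r ∷ rest) tt (io ∷ (takeBits (c ∷ r) ʳ++ out) ∷ l ∷ z ∷ rest) ((length r + 2) * 5)
  J-readout r blank out = _ , J-weaken (J-exit J-ret) (*-mono-≤ {1} {length r + 2} {1} {5} (≤-trans (s≤s z≤n) (m≤n+m 2 (length r))) (s≤s z≤n))
  J-readout []      s0 out = _ , J-again (J-bind J-push (J-bind (J-popSym [] refl) J-ret)) (J-weaken (J-exit J-ret) (s≤s z≤n))
  J-readout []      s1 out = _ , J-again (J-bind J-push (J-bind (J-popSym [] refl) J-ret)) (J-weaken (J-exit J-ret) (s≤s z≤n))
  J-readout (s ∷ r) s0 out = let z , j = J-readout r s (false ∷ out) in z , J-again (J-bind J-push (J-bind (J-popSym (s ∷ r) refl) J-ret)) j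
  J-readout (s ∷ r) s1 out = let z , j = J-readout r s (true ∷ out) in z , J-again (J-bind J-push (J-bind (J-popSym (s ∷ r) refl) J-ret)) j

  Runs-readout : ∀ {io l rest} r c out → ∃[ z ] Runs (readout c) (io ∷ out ∷ l ∷ code r ∷ rest) tt (io ∷ (takeBits (c ∷ r) ʳ++ out) ∷ l ∷ z ∷ rest)
  Runs-readout {io} {l} {rest} r c out = let z , j = J-readout r c out in
    z , Runs-loop j (*-monoˡ-≤ 5 (+-monoˡ-≤ 2 (≤-trans (length≤code r) (length≤size (io ∷ out ∷ l ∷ code r ∷ rest) #3))))

  finish : Bool × Sym → Prog Bool
  -- `readout` leaves the output reversed, so an odd number of moves must bring it back to stack 1;
  -- a single move cannot return to its source, three can.
  finish (true , c)  = readout c ⨾ clear #2 #4 #5 ⨾ clear #3 #4 #5 ⨾ move #1 #2 #4 ⨾ move #2 #3 #4 ⨾ move #3 #1 #4 ⨾ ret true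
  finish (false , c) = clear #2 #4 #5 ⨾ clear #3 #4 #5 ⨾ ret false

  -- The declared time sees only the stacks, while the first symbol of the input is in the control
  -- state: hence `suc n`. Each step takes six operations for the head and one `ret`.
  simTime : ℕ → ℕ → ℕ
  simTime k n = poly k (suc n) * 7 + 1

  Pol-simTime : ∀ k → Pol (simTime k)
  Pol-simTime k = Pol-+ (Pol-* (Pol-∘ (Pol-poly k) Pol-suc) (Pol-const 7)) (Pol-const 1)

  call : ℕ → Prog Bool
  call k = move #1 #2 #4 ⨾ spill₁ #2 #3 bitWord #4 ⨾ bind (popSym #3) λ c → bind (simulate (simTime k) (Pol-simTime k) (zero , c)) finish

  result : Bool → Tape → Maybe Str
  result true  w = just (takeBits (cur w ∷ right w))
  result false w = nothing

  exec-run⁻ : ∀ T x {r} → exec M T x ≡ just r → ∃[ b ] ∃[ c ] (run M T (initConf (TM.states M) x) ≡ just (b , c) × r ≡ result b (confTape c))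
  exec-run⁻ T x eq with run M T (initConf (TM.states M) x)
  exec-run⁻ T x refl | just (true , c)  = true , c , refl , refl
  exec-run⁻ T x refl | just (false , c) = false , c , refl , refl

  answer : Maybe Str → Str
  answer (just y) = y
  answer nothing  = []

  Runs-finish : ∀ {io rest} b w → Runs (finish (b , cur w)) (tapeEnv io [] w rest) (is-just (result b w)) (io ∷ answer (result b w) ∷ [] ∷ [] ∷ rest)
  Runs-finish {io} {rest} true w = let z , r = Runs-readout (right w) (cur w) [] in
    r ⟫ Runs-clear (λ ()) (λ ()) (λ ()) ⟫ Runs-clear (λ ()) (λ ()) (λ ()) ⟫
    Runs-move (λ ()) (λ ()) (λ ()) ⟫ Runs-move (λ ()) (λ ()) (λ ()) ⟫ Runs-move (λ ()) (λ ()) (λ ()) ⟫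
    Runs-to Runs-ret (cong (λ y → io ∷ y ∷ [] ∷ [] ∷ rest) (trans (cong (_ʳ++ []) (cong (_ʳ++ []) (reverse-involutive y))) (reverse-involutive y)))
    where
    y : Str
    y = takeBits (cur w ∷ right w)
  Runs-finish false w = Runs-clear (λ ()) (λ ()) (λ ()) ⟫ Runs-clear (λ ()) (λ ()) (λ ()) ⟫ Runs-ret

  Runs-call : ∀ k {x io rest r} → exec M (poly k (length x)) x ≡ just r →
              Runs (call k) (io ∷ x ∷ [] ∷ [] ∷ rest) (is-just r) (io ∷ answer r ∷ [] ∷ [] ∷ rest)
  Runs-call k {x} {io} {rest} eq with exec-run⁻ (poly k (length x)) x eq
  ... | b , c , halted , refl =
    Runs-move (λ ()) (λ ()) (λ ()) ⟫
    Runs-to (Runs-spill₁ (λ ()) (λ ()) (λ ())) (cong (λ z → io ∷ [] ∷ [] ∷ z ∷ rest) (rewords-bits x)) ⟫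
    Runs-popSym xs refl ⟫
    Runs-loop (J-simulate (poly k (length x)) zero (initTape x) (trans (cong (run M (poly k (length x))) (sym (initConf≡ _ x))) halted)) enough ⟫
    Runs-finish b (confTape c)
    where
    xs = map toSym x
    length-tl : ∀ (l : List Sym) → length l ≤ suc (length (tl l))
    length-tl []      = z≤n
    length-tl (_ ∷ l) = ≤-refl
    enough : poly k (length x) * 7 + 1 ≤ simTime k (size (io ∷ [] ∷ [] ∷ code (tl xs) ∷ rest))
    enough = +-monoˡ-≤ 1 (*-monoˡ-≤ 7 (Pol.mono (Pol-poly k) (≤-trans (≤-reflexive (sym (length-map toSym x)))
      (≤-trans (length-tl xs) (s≤s (≤-trans (length≤code (tl xs)) (length≤size (io ∷ [] ∷ [] ∷ code (tl xs) ∷ rest) #3)))))))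

open Call using (call; Runs-call; answer)

-- From stack programs to polynomial-time functions

inputEnv : Str → Env
inputEnv x = [] ∷ x ∷ V.replicate 7 []

-- The result is moved to stack 0 afterwards, which therefore has to be empty; a rejection may leave
-- anything.
data Yields (p : Prog Bool) (e : Env) : Maybe Str → Set where
  accepts : ∀ {y e′} → Runs p e true ([] ∷ y ∷ e′) → Yields p e (just y)
  rejects : ∀ {e′} → Runs p e false e′ → Yields p e nothing

infixr 3 _⟫ʸ_

_⟫ʸ_ : ∀ {B} {{_ : Finite B}} {p : Prog B} {f : B → Prog Bool} {e b e₁ r} →
       Runs p e b e₁ → Yields (f b) e₁ r → Yields (bind p f) e r
run ⟫ʸ accepts run′ = accepts (Runs-bind run run′)
run ⟫ʸ rejects run′ = rejects (Runs-bind run run′)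

unload : Bool → Prog Bool
unload true  = move #1 #0 #2 ⨾ ret true
unload false = ret false

withIO : Prog Bool → Prog Bool
withIO p = move #0 #1 #2 ⨾ bind p unload

Runs-load : ∀ x → Runs (move #0 #1 #2) (initEnv x) tt (inputEnv x)
Runs-load x = Runs-to (Runs-move (λ ()) (λ ()) (λ ())) (cong (λ y → [] ∷ y ∷ V.replicate 7 []) (reverse-involutive x))

withIO-computes : ∀ p x {r} → Yields p (inputEnv x) r → exec (machine (withIO p)) (poly (degree (withIO p)) (length x)) x ≡ just r
withIO-computes p x (accepts {y} r) = machine-computes (withIO p) x {y = y} (Runs-load x ⟫ r ⟫ Runs-move (λ ()) (λ ()) (λ ()) ⟫ Runs-ret)
withIO-computes p x (rejects {s ∷ e′} r) = machine-computes (withIO p) x {y = reverse s}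
  (Runs-load x ⟫ r ⟫ Runs-to Runs-ret (cong (_∷ e′) (sym (reverse-involutive s))))

FP-intro : ∀ p {f : Str → Maybe Str} → (∀ x → Yields p (inputEnv x) (f x)) → FP f
FP-intro p h = machine (withIO p) , degree (withIO p) , λ x → withIO-computes p x (h x)

FP₂-intro : ∀ p {σ : Fun2} → (∀ x y → Yields p (inputEnv (pair x y)) (σ x y)) → FP₂ σ
FP₂-intro p h = machine (withIO p) , degree (withIO p) , λ x y → withIO-computes p (pair x y) (h x y)

-- Every letter moved from stack 1 to stack 5 uses up a letter of stack 3, so that success means that
-- stack 1 was not longer than stack 3.
moveWithin : Prog Bool
moveWithin = loop (linear 5) (Pol-linear 5) (λ _ → bind (pop #1) first) tt
  where
  second : Bool → Maybe Bool → Prog (⊤ ⊎ Bool)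
  second b nothing  = ret (inj₂ false)
  second b (just _) = push #5 b ⨾ ret (inj₁ tt)
  first : Maybe Bool → Prog (⊤ ⊎ Bool)
  first nothing  = ret (inj₂ true)
  first (just b) = bind (pop #3) (second b)

module _ {io s₂ s₄ : Str} {rest : Vec Str 3} where

  J-moveWithin : ∀ w r acc → length w ≤ length r → ∃[ r′ ] J moveWithin (io ∷ w ∷ s₂ ∷ r ∷ s₄ ∷ acc ∷ rest) true (io ∷ [] ∷ s₂ ∷ r′ ∷ s₄ ∷ (w ʳ++ acc) ∷ rest) (suc (length w) * 5)
  J-moveWithin []      r       acc le       = r , J-weaken (J-exit (J-bind (J-pop-[] refl) J-ret)) (s≤s (s≤s z≤n))
  J-moveWithin (b ∷ w) (_ ∷ r) acc (s≤s le) = let r′ , j = J-moveWithin w r (b ∷ acc) le in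
    r′ , J-weaken (J-again (J-bind (J-pop-∷ refl) (J-bind (J-pop-∷ refl) (J-bind J-push J-ret))) j) (+-monoˡ-≤ (suc (length w) * 5) (n≤1+n 4))

  J-moveWithin-fails : ∀ w r acc → ¬ length w ≤ length r → ∃[ w′ ] ∃[ acc′ ] J moveWithin (io ∷ w ∷ s₂ ∷ r ∷ s₄ ∷ acc ∷ rest) false (io ∷ w′ ∷ s₂ ∷ [] ∷ s₄ ∷ acc′ ∷ rest) (suc (length w) * 5)
  J-moveWithin-fails []      r       acc nle = ⊥-elim (nle z≤n)
  J-moveWithin-fails (b ∷ w) []      acc nle = w , acc , J-weaken (J-exit (J-bind (J-pop-∷ refl) (J-bind (J-pop-[] refl) J-ret))) (s≤s (s≤s (s≤s z≤n)))
  J-moveWithin-fails (b ∷ w) (_ ∷ r) acc nle = let w′ , acc′ , j = J-moveWithin-fails w r (b ∷ acc) (nle ∘ s≤s) in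
    w′ , acc′ , J-weaken (J-again (J-bind (J-pop-∷ refl) (J-bind (J-pop-∷ refl) (J-bind J-push J-ret))) j) (+-monoˡ-≤ (suc (length w) * 5) (n≤1+n 4))

  Runs-moveWithin : ∀ w r acc → length w ≤ length r → ∃[ r′ ] Runs moveWithin (io ∷ w ∷ s₂ ∷ r ∷ s₄ ∷ acc ∷ rest) true (io ∷ [] ∷ s₂ ∷ r′ ∷ s₄ ∷ (w ʳ++ acc) ∷ rest)
  Runs-moveWithin w r acc le = let r′ , j = J-moveWithin w r acc le in
    r′ , Runs-loop j (*-monoˡ-≤ 5 (s≤s (length≤size (io ∷ w ∷ s₂ ∷ r ∷ s₄ ∷ acc ∷ rest) #1)))

  Runs-moveWithin-fails : ∀ w r acc → ¬ length w ≤ length r → ∃[ w′ ] ∃[ acc′ ] Runs moveWithin (io ∷ w ∷ s₂ ∷ r ∷ s₄ ∷ acc ∷ rest) false (io ∷ w′ ∷ s₂ ∷ [] ∷ s₄ ∷ acc′ ∷ rest)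
  Runs-moveWithin-fails w r acc nle = let w′ , acc′ , j = J-moveWithin-fails w r acc nle in
    w′ , acc′ , Runs-loop j (*-monoˡ-≤ 5 (s≤s (length≤size (io ∷ w ∷ s₂ ∷ r ∷ s₄ ∷ acc ∷ rest) #1)))

-- Comparing uses up both copies, so the common prefix is saved on stack 6.
compare : Prog Bool
compare = loop (linear 4) (Pol-linear 4) (λ _ → bind (pop #1) λ b → bind (pop #5) (test b)) tt
  where
  test : Maybe Bool → Maybe Bool → Prog (⊤ ⊎ Bool)
  test nothing      nothing      = ret (inj₂ true)
  test (just false) (just false) = push #6 false ⨾ ret (inj₁ tt)
  test (just true)  (just true)  = push #6 true ⨾ ret (inj₁ tt)
  test _            _            = ret (inj₂ false)

module _ {io s₂ s₃ s₄ : Str} {rest : Vec Str 2} where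

  J-compare-same : ∀ x acc → J compare (io ∷ x ∷ s₂ ∷ s₃ ∷ s₄ ∷ x ∷ acc ∷ rest) true (io ∷ [] ∷ s₂ ∷ s₃ ∷ s₄ ∷ [] ∷ (x ʳ++ acc) ∷ rest) (suc (length x) * 4)
  J-compare-same []          acc = J-weaken (J-exit (J-bind (J-pop-[] refl) (J-bind (J-pop-[] refl) J-ret))) (s≤s (s≤s (s≤s z≤n)))
  J-compare-same (false ∷ x) acc = J-again (J-bind (J-pop-∷ refl) (J-bind (J-pop-∷ refl) (J-bind J-push J-ret))) (J-compare-same x (false ∷ acc))
  J-compare-same (true ∷ x)  acc = J-again (J-bind (J-pop-∷ refl) (J-bind (J-pop-∷ refl) (J-bind J-push J-ret))) (J-compare-same x (true ∷ acc))

  Differs : Str → Str → Str → Set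
  Differs x y acc = ∃[ x′ ] ∃[ y′ ] ∃[ acc′ ] J compare (io ∷ x ∷ s₂ ∷ s₃ ∷ s₄ ∷ y ∷ acc ∷ rest) false (io ∷ x′ ∷ s₂ ∷ s₃ ∷ s₄ ∷ y′ ∷ acc′ ∷ rest) (suc (length x) * 4)

  J-compare-diff : ∀ x y acc → x ≢ y → Differs x y acc
  J-compare-diff []          []          acc ne = ⊥-elim (ne refl)
  J-compare-diff []          (_ ∷ y)     acc ne = _ , _ , _ , J-weaken (J-exit (J-bind (J-pop-[] refl) (J-bind (J-pop-∷ refl) J-ret))) (s≤s (s≤s (s≤s z≤n)))
  J-compare-diff (false ∷ x) []          acc ne = _ , _ , _ , J-weaken (J-exit (J-bind (J-pop-∷ refl) (J-bind (J-pop-[] refl) J-ret))) (s≤s (s≤s (s≤s z≤n)))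
  J-compare-diff (true ∷ x)  []          acc ne = _ , _ , _ , J-weaken (J-exit (J-bind (J-pop-∷ refl) (J-bind (J-pop-[] refl) J-ret))) (s≤s (s≤s (s≤s z≤n)))
  J-compare-diff (false ∷ x) (true ∷ y)  acc ne = _ , _ , _ , J-weaken (J-exit (J-bind (J-pop-∷ refl) (J-bind (J-pop-∷ refl) J-ret))) (s≤s (s≤s (s≤s z≤n)))
  J-compare-diff (true ∷ x)  (false ∷ y) acc ne = _ , _ , _ , J-weaken (J-exit (J-bind (J-pop-∷ refl) (J-bind (J-pop-∷ refl) J-ret))) (s≤s (s≤s (s≤s z≤n)))
  J-compare-diff (false ∷ x) (false ∷ y) acc ne = let _ , _ , _ , j = J-compare-diff x y (false ∷ acc) (ne ∘ cong (false ∷_)) in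
    _ , _ , _ , J-again (J-bind (J-pop-∷ refl) (J-bind (J-pop-∷ refl) (J-bind J-push J-ret))) j
  J-compare-diff (true ∷ x)  (true ∷ y)  acc ne = let _ , _ , _ , j = J-compare-diff x y (true ∷ acc) (ne ∘ cong (true ∷_)) in
    _ , _ , _ , J-again (J-bind (J-pop-∷ refl) (J-bind (J-pop-∷ refl) (J-bind J-push J-ret))) j

  Runs-compare-same : ∀ x acc → Runs compare (io ∷ x ∷ s₂ ∷ s₃ ∷ s₄ ∷ x ∷ acc ∷ rest) true (io ∷ [] ∷ s₂ ∷ s₃ ∷ s₄ ∷ [] ∷ (x ʳ++ acc) ∷ rest)
  Runs-compare-same x acc = Runs-loop (J-compare-same x acc) (*-monoˡ-≤ 4 (s≤s (length≤size (io ∷ x ∷ s₂ ∷ s₃ ∷ s₄ ∷ x ∷ acc ∷ rest) #1)))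

  Runs-compare-diff : ∀ x y acc → x ≢ y → ∃[ x′ ] ∃[ y′ ] ∃[ acc′ ] Runs compare (io ∷ x ∷ s₂ ∷ s₃ ∷ s₄ ∷ y ∷ acc ∷ rest) false (io ∷ x′ ∷ s₂ ∷ s₃ ∷ s₄ ∷ y′ ∷ acc′ ∷ rest)
  Runs-compare-diff x y acc ne = let _ , _ , _ , j = J-compare-diff x y acc ne in
    _ , _ , _ , Runs-loop j (*-monoˡ-≤ 4 (s≤s (length≤size (io ∷ x ∷ s₂ ∷ s₃ ∷ s₄ ∷ y ∷ acc ∷ rest) #1)))

-- Polynomials in unary

unary : ℕ → Str
unary n = replicate n true

one : Bool → Str
one _ = true ∷ []

rewords-one : ∀ s m → rewords one s (unary m) ≡ unary (length s + m)
rewords-one []      m = refl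
rewords-one (b ∷ s) m = trans (rewords-one s (suc m)) (cong unary (+-suc (length s) m))

unary-+ : ∀ m n → unary m ++ unary n ≡ unary (m + n)
unary-+ zero    n = refl
unary-+ (suc m) n = cong (true ∷_) (unary-+ m n)

-- Reading a stack destroys it, so the factor on stack 3 travels to stack 5 and back, and on the way
-- back its letters are counted onto stack 6.
mulStep : Maybe Bool → Prog (⊤ ⊎ ⊤)
mulStep nothing  = ret (inj₂ tt)
mulStep (just _) = spill #3 #5 (_∷ []) #7 (λ _ → []) ⨾ spill #5 #3 (_∷ []) #6 one ⨾ ret (inj₁ tt)

mulTime : ℕ → ℕ → ℕ
mulTime u n = suc u * (1 + (suc n * 6 + (suc n * 8 + 1)))

mulLoop : Prog ⊤
mulLoop = loop (λ n → mulTime n n) (Pol-* Pol-suc (Pol-+ (Pol-const 1) (Pol-+ (Pol-* Pol-suc (Pol-const 6)) (Pol-+ (Pol-* Pol-suc (Pol-const 8)) (Pol-const 1)))))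
  (λ _ → bind (pop #4) mulStep) tt

mul : Prog ⊤
mul = mulLoop ⨾ spill₁ #6 #4 one #7

muls : ℕ → Prog ⊤
muls zero    = ret tt
muls (suc j) = mul ⨾ muls j

polyUnary : ℕ → Prog ⊤
polyUnary k = pushWord #4 (unary k) ⨾ muls k ⨾ pushWord #4 (unary k)

module _ {io s₁ s₂ : Str} (N : Str) {s₇ s₈ : Str} where

  mulEnv : Str → ℕ → Env
  mulEnv u m = io ∷ s₁ ∷ s₂ ∷ N ∷ u ∷ [] ∷ unary m ∷ s₇ ∷ s₈ ∷ []

  J-mulLoop : ∀ u m → J mulLoop (mulEnv u m) tt (mulEnv [] (length u * length N + m)) (mulTime (length u) (length N))
  J-mulLoop []      m = J-weaken (J-exit (J-bind (J-pop-[] refl) J-ret)) (s≤s (s≤s z≤n))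
  J-mulLoop (b ∷ u) m = J-to (J-again (J-bind (J-pop-∷ refl) (J-bind (J-spilled #3 #5 (_∷ []) #7 (λ _ → []) (λ ()) (λ ()) (λ ()))
    (J-bind (J-to (J-weaken (J-spilled #5 #3 (_∷ []) #6 one (λ ()) (λ ()) (λ ())) same-length) restored) J-ret))) (J-mulLoop u (length N + m)))
    (cong (mulEnv []) (trans (sym (+-assoc (length u * length N) (length N) m)) (cong (_+ m) (+-comm (length u * length N) (length N)))))
    where
    N′ : Str
    N′ = rewords (_∷ []) N []
    N′-reverse : N′ ≡ reverse N
    N′-reverse = rewords-move N []
    same-length : suc (length N′) * 8 ≤ suc (length N) * 8
    same-length = ≤-reflexive (cong (λ n → suc n * 8) (trans (cong length N′-reverse) (length-reverse N)))
    restored : (io ∷ s₁ ∷ s₂ ∷ rewords (_∷ []) N′ [] ∷ u ∷ [] ∷ rewords one N′ (unary m) ∷ rewords (λ _ → []) N s₇ ∷ s₈ ∷ []) ≡ mulEnv u (length N + m)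
    restored rewrite N′-reverse | rewords-move (reverse N) [] | reverse-involutive N | rewords-one (reverse N) m | length-reverse N | rewords-clear N s₇ = refl

  Runs-mul : ∀ u → Runs mul (mulEnv u 0) tt (mulEnv (unary (length u * length N)) 0)
  Runs-mul u = Runs-loop (J-mulLoop u 0) (*-mono-≤ (s≤s (length≤size e #4)) (+-monoʳ-≤ 1 (+-mono-≤ (*-monoˡ-≤ 6 (s≤s (length≤size e #3)))
                 (+-monoˡ-≤ 1 (*-monoˡ-≤ 8 (s≤s (length≤size e #3))))))) ⟫
               Runs-to (Runs-spill₁ (λ ()) (λ ()) (λ ())) (cong (λ u → mulEnv u 0) (trans (rewords-one (unary (length u * length N + 0)) 0)
                 (cong unary (trans (+-identityʳ _) (trans (length-replicate (length u * length N + 0)) (+-identityʳ _))))))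
    where
    e : Env
    e = mulEnv u 0

  Runs-muls : ∀ j m → Runs (muls j) (mulEnv (unary m) 0) tt (mulEnv (unary (m * length N ^ j)) 0)
  Runs-muls zero    m = Runs-to Runs-ret (cong (λ m → mulEnv (unary m) 0) (sym (*-identityʳ m)))
  Runs-muls (suc j) m = Runs-to (Runs-mul (unary m)) (cong (λ l → mulEnv (unary (l * length N)) 0) (length-replicate m)) ⟫
    Runs-to (Runs-muls j (m * length N)) (cong (λ m → mulEnv (unary m) 0) (*-assoc m (length N) (length N ^ j)))

  Runs-polyUnary : ∀ k → Runs (polyUnary k) (mulEnv [] 0) tt (mulEnv (unary (poly k (length N))) 0)
  Runs-polyUnary k = Runs-to (Runs-pushWord (unary k)) (cong (λ u → mulEnv u 0) (++-identityʳ (unary k))) ⟫ Runs-muls k k ⟫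
    Runs-to (Runs-pushWord (unary k)) (cong (λ u → mulEnv u 0) (trans (unary-+ k _) (cong unary (+-comm k _))))
--

data PairView : Str → Set where
  isPair  : ∀ x y → PairView (pair x y)
  notPair : ∀ {t acc s} → undouble [] t ≡ (false , acc , s) → (∀ x y → t ≢ pair x y) → PairView t

pairView : ∀ t → PairView t
pairView t = view (undouble [] t) refl
  where
  view : ∀ u → undouble [] t ≡ u → PairView t
  view (true , xr , y) eq with undouble-pair⁻ [] t eq
  ... | x , _ , refl = isPair x y
  view (false , acc , s) eq = notPair eq λ { x y refl → case trans (sym eq) (undouble-pair [] x y) of λ () }

pair-injective : ∀ x y x′ y′ → pair x y ≡ pair x′ y′ → x ≡ x′ × y ≡ y′
pair-injective x y x′ y′ eq with trans (sym (undouble-pair [] x y)) (trans (cong (undouble []) eq) (undouble-pair [] x′ y′))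
... | e = trans (sym (reverse-involutive x)) (trans (cong reverse (cong (proj₁ ∘ proj₂) e)) (reverse-involutive x′)) , cong (proj₂ ∘ proj₂) e

length-pair : ∀ x y → length (pair x y) ≡ 2 * length x + (2 + length y)
length-pair []      y = refl
length-pair (b ∷ x) y = trans (cong (2 +_) (length-pair x y)) (cong (λ n → suc n + (2 + length y)) (sym (+-suc (length x) (length x + 0))))

applyParsed : Fun2 → Bool × Str × Str → Maybe Str
applyParsed σ (true , xr , y)  = σ (reverse xr) y
applyParsed σ (false , _ , _) = nothing

onPairs : Fun2 → Str → Maybe Str
onPairs σ s = applyParsed σ (undouble [] s)

onPairs-pair : ∀ σ x y → onPairs σ (pair x y) ≡ σ x y
onPairs-pair σ x y = trans (cong (applyParsed σ) (undouble-pair [] x y)) (cong (λ x → σ x y) (reverse-involutive x))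

onPairs⁻ : ∀ σ t {z} → onPairs σ t ≡ just z → ∃[ x ] ∃[ y ] (t ≡ pair x y × σ x y ≡ just z)
onPairs⁻ σ t eq with pairView t
... | isPair x y = x , y , refl , trans (sym (onPairs-pair σ x y)) eq
... | notPair fails _ = case trans (sym (cong (applyParsed σ) fails)) eq of λ ()

onTrue : Prog Bool → Bool → Prog Bool
onTrue p true  = p
onTrue p false = ret false

yields-call : ∀ M k {x rest r} → exec M (poly k (length x)) x ≡ just r → Yields (call M k) ([] ∷ x ∷ [] ∷ [] ∷ rest) r
yields-call M k {r = just y}  eq = accepts (Runs-call M k eq)
yields-call M k {r = nothing} eq = rejects (Runs-call M k eq)

-- `FP₂` promises nothing, not even halting in time, on strings that are not pairs. A copy of the
-- input is therefore parsed before the machine is called on it.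
guarded : TM → ℕ → Prog Bool
guarded M k = spill #1 #2 (_∷ []) #3 (_∷ []) ⨾ move #2 #1 #8 ⨾ move #3 #4 #8 ⨾ bind (unpair #4 #5) (onTrue (call M k))

FP-onPairs : ∀ {σ} → FP₂ σ → FP (onPairs σ)
FP-onPairs {σ} (M , k , computes) = FP-intro (guarded M k) λ x → copied x (parsed x (pairView x))
  where
  copy : Str → Env
  copy x = [] ∷ x ∷ [] ∷ [] ∷ x ∷ V.replicate 4 []
  parsed : ∀ x → PairView x → Yields (bind (unpair #4 #5) (onTrue (call M k))) (copy x) (onPairs σ x)
  parsed .(pair x y) (isPair x y) = Runs-unpair #4 #5 (λ ()) (undouble-pair [] x y) ⟫ʸ
    yields-call M k (trans (computes x y) (cong just (sym (onPairs-pair σ x y))))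
  parsed x (notPair fails _) = Runs-unpair #4 #5 (λ ()) fails ⟫ʸ subst (Yields _ _) (sym (cong (applyParsed σ) fails)) (rejects Runs-ret)
  copied : ∀ x {r} → Yields (bind (unpair #4 #5) (onTrue (call M k))) (copy x) r → Yields (guarded M k) (inputEnv x) r
  copied x y = Runs-to (Runs-spill #1 #2 (_∷ []) #3 (_∷ []) (λ ()) (λ ()) (λ ())) (cong (λ s → [] ∷ [] ∷ s ∷ s ∷ V.replicate 5 []) (rewords-move x [])) ⟫ʸ
    Runs-to (Runs-move (λ ()) (λ ()) (λ ())) (cong (λ s → [] ∷ s ∷ [] ∷ reverse x ∷ V.replicate 5 []) (reverse-involutive x)) ⟫ʸ
    Runs-to (Runs-move (λ ()) (λ ()) (λ ())) (cong (λ s → [] ∷ x ∷ [] ∷ [] ∷ s ∷ V.replicate 4 []) (reverse-involutive x)) ⟫ʸ y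

-- Deciding languages by stack programs

data Decides (p : Prog Bool) (e : Env) (A : Set) : Set where
  accepts : ∀ {y e′} → A → Runs p e true ([] ∷ y ∷ e′) → Decides p e A
  rejects : ∀ {e′} → ¬ A → Runs p e false e′ → Decides p e A

infixr 3 _⟫ᵈ_

_⟫ᵈ_ : ∀ {B} {{_ : Finite B}} {p : Prog B} {f : B → Prog Bool} {e b e₁ A} →
       Runs p e b e₁ → Decides (f b) e₁ A → Decides (bind p f) e A
run ⟫ᵈ accepts a run′  = accepts a (Runs-bind run run′)
run ⟫ᵈ rejects ¬a run′ = rejects ¬a (Runs-bind run run′)

InP-intro : ∀ p {A : Str → Set} → (∀ x → Decides p (inputEnv x) (A x)) → InP A
InP-intro p {A} h = machine (withIO p) , degree (withIO p) , λ x → decided x (h x)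
  where
  decided : ∀ x → Decides p (inputEnv x) (A x) → let r = exec (machine (withIO p)) (poly (degree (withIO p)) (length x)) x in
            (r ≡ just nothing → ¬ A x) × (∃[ y ] (r ≡ just (just y)) → A x) × (∃[ s ] (r ≡ just s))
  decided x (accepts a run) = let eq = withIO-computes p x (Yields.accepts run) in
    (λ eq′ → case trans (sym eq) eq′ of λ ()) , (λ _ → a) , _ , eq
  decided x (rejects ¬a run) = let eq = withIO-computes p x (Yields.rejects run) in
    (λ _ → ¬a) , (λ { (y , eq′) → case trans (sym eq) eq′ of λ () }) , _ , eq

-- Prefix search

module Inverter (σ : Fun2) (FPσ : FP₂ σ) (pnp : ∀ A → InNP A → InP A) where

  τ : Str → Maybe Str
  τ = onPairs σ

  FPτ : FP τ
  FPτ = FP-onPairs FPσ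

  Mτ : TM
  Mτ = proj₁ FPτ

  kτ : ℕ
  kτ = proj₁ (proj₂ FPτ)

  -- The number of letters still allowed is given by the length of `r`. A witness is thus no longer
  -- than the query, which is why the bound `poly 1` suffices in `Extendable`.
  query : Str → Str → Str → Str
  query z p r = pair z (pair p r)

  record Extends (z p r w : Str) : Set where
    constructor extends
    field
      short : length w ≤ length r
      hits  : τ (p ++ w) ≡ just z

  Verified : Str → Set
  Verified t = ∃[ z ] ∃[ p ] ∃[ r ] ∃[ w ] (t ≡ pair (query z p r) w × Extends z p r w)

  afterCall : Bool → Prog Bool
  afterCall = onTrue (move #4 #5 #8 ⨾ compare)

  tail₄ : Bool → Prog Bool
  tail₄ = onTrue (clear #3 #7 #8 ⨾ move #5 #1 #8 ⨾ bind (call Mτ kτ) afterCall)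

  tail₃ : Bool → Prog Bool
  tail₃ = onTrue (bind moveWithin tail₄)

  tail₂ : Bool → Prog Bool
  tail₂ = onTrue (bind (unpair #3 #5) tail₃)

  tail₁ : Bool → Prog Bool
  tail₁ = onTrue (move #2 #3 #8 ⨾ bind (unpair #3 #4) tail₂)

  verify : Prog Bool
  verify = bind (unpair #1 #2) tail₁

  verified⇒extends : ∀ z p r w → Verified (pair (query z p r) w) → Extends z p r w
  verified⇒extends z p r w (z′ , p′ , r′ , w′ , eq , ex) with pair-injective (query z p r) w (query z′ p′ r′) w′ eq
  ... | eqs , refl with pair-injective z (pair p r) z′ (pair p′ r′) eqs
  ... | refl , eqr with pair-injective p r p′ r′ eqr
  ... | refl , refl = ex

  decide-hit : ∀ z p r w r′ → length w ≤ length r → Decides (tail₄ true)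
    ([] ∷ [] ∷ [] ∷ r′ ∷ reverse z ∷ (w ʳ++ reverse p) ∷ [] ∷ [] ∷ [] ∷ []) (Verified (pair (query z p r) w))
  decide-hit z p r w r′ le = Runs-clear (λ ()) (λ ()) (λ ()) ⟫ᵈ
    Runs-to (Runs-move (λ ()) (λ ()) (λ ())) (cong (λ v → [] ∷ v ∷ [] ∷ [] ∷ reverse z ∷ [] ∷ [] ∷ [] ∷ [] ∷ []) joined) ⟫ᵈ
    called (τ (p ++ w)) refl
    where
    joined : (w ʳ++ reverse p) ʳ++ [] ≡ p ++ w
    joined = trans (ʳ++-ʳ++ w) (trans (ʳ++-ʳ++ p) (cong (p ++_) (++-identityʳ w)))
    compared : ∀ y → τ (p ++ w) ≡ just y → Dec (y ≡ z) → Decides compare ([] ∷ y ∷ [] ∷ [] ∷ [] ∷ z ∷ [] ∷ [] ∷ [] ∷ []) (Verified (pair (query z p r) w))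
    compared y eq (yes refl) = accepts (z , p , r , w , refl , extends le eq) (Runs-compare-same y [])
    compared y eq (no ne)    = let _ , _ , _ , run = Runs-compare-diff y z [] ne in
      rejects (λ v → ne (just-injective (trans (sym eq) (Extends.hits (verified⇒extends z p r w v))))) run
    called : ∀ y → τ (p ++ w) ≡ y → Decides (bind (call Mτ kτ) afterCall) ([] ∷ (p ++ w) ∷ [] ∷ [] ∷ reverse z ∷ [] ∷ [] ∷ [] ∷ [] ∷ []) (Verified (pair (query z p r) w))
    called (just y) eq = Runs-call Mτ kτ (trans (proj₂ (proj₂ FPτ) (p ++ w)) (cong just eq)) ⟫ᵈ
      Runs-to (Runs-move (λ ()) (λ ()) (λ ())) (cong (λ z → [] ∷ y ∷ [] ∷ [] ∷ [] ∷ z ∷ [] ∷ [] ∷ [] ∷ []) (reverse-involutive z)) ⟫ᵈ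
      compared y eq (≡-dec _≟B_ y z)
    called nothing  eq = Runs-call Mτ kτ (trans (proj₂ (proj₂ FPτ) (p ++ w)) (cong just eq)) ⟫ᵈ
      rejects (λ v → case trans (sym (Extends.hits (verified⇒extends z p r w v))) eq of λ ()) Runs-ret

  decide-within : ∀ z p r w → Dec (length w ≤ length r) → Decides (tail₃ true)
    ([] ∷ w ∷ [] ∷ r ∷ reverse z ∷ reverse p ∷ [] ∷ [] ∷ [] ∷ []) (Verified (pair (query z p r) w))
  decide-within z p r w (yes le) = let r′ , run = Runs-moveWithin w r (reverse p) le in run ⟫ᵈ decide-hit z p r w r′ le
  decide-within z p r w (no nle) = let _ , _ , run = Runs-moveWithin-fails w r (reverse p) nle in
    run ⟫ᵈ rejects (λ v → nle (Extends.short (verified⇒extends z p r w v))) Runs-ret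

  decide-pr : ∀ z q w → PairView q → Decides (tail₂ true) ([] ∷ w ∷ [] ∷ q ∷ reverse z ∷ [] ∷ [] ∷ [] ∷ [] ∷ []) (Verified (pair (pair z q) w))
  decide-pr z .(pair p r) w (isPair p r) = Runs-unpair #3 #5 (λ ()) (undouble-pair [] p r) ⟫ᵈ decide-within z p r w (length w ≤? length r)
  decide-pr z q w (notPair fails np) = Runs-unpair #3 #5 (λ ()) fails ⟫ᵈ
    rejects (λ { (z′ , p , r , w′ , eq , _) → np p r (proj₂ (pair-injective z q z′ (pair p r) (proj₁ (pair-injective (pair z q) w (query z′ p r) w′ eq)))) }) Runs-ret

  decide-s : ∀ s w → PairView s → Decides (tail₁ true) ([] ∷ w ∷ reverse s ∷ [] ∷ [] ∷ [] ∷ [] ∷ [] ∷ [] ∷ []) (Verified (pair s w))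
  decide-s s w v = Runs-to (Runs-move (λ ()) (λ ()) (λ ())) (cong (λ s → [] ∷ w ∷ [] ∷ s ∷ [] ∷ [] ∷ [] ∷ [] ∷ [] ∷ []) (reverse-involutive s)) ⟫ᵈ split s v
    where
    split : ∀ s → PairView s → Decides (bind (unpair #3 #4) tail₂) ([] ∷ w ∷ [] ∷ s ∷ [] ∷ [] ∷ [] ∷ [] ∷ [] ∷ []) (Verified (pair s w))
    split .(pair z q) (isPair z q) = Runs-unpair #3 #4 (λ ()) (undouble-pair [] z q) ⟫ᵈ decide-pr z q w (pairView q)
    split s (notPair fails np) = Runs-unpair #3 #4 (λ ()) fails ⟫ᵈ
      rejects (λ { (z , p , r , w′ , eq , _) → np z (pair p r) (proj₁ (pair-injective s w (query z p r) w′ eq)) }) Runs-ret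

  decide-t : ∀ t → PairView t → Decides verify (inputEnv t) (Verified t)
  decide-t .(pair s w) (isPair s w) = Runs-unpair #1 #2 (λ ()) (undouble-pair [] s w) ⟫ᵈ decide-s s w (pairView s)
  decide-t t (notPair fails np) = Runs-unpair #1 #2 (λ ()) fails ⟫ᵈ
    rejects (λ { (z , p , r , w , eq , _) → np (query z p r) w eq }) Runs-ret

  Extendable : Str → Set
  Extendable s = ∃[ w ] (length w ≤ poly 1 (length s) × Verified (pair s w))

  Extendable∈P : InP Extendable
  Extendable∈P = pnp Extendable (Verified , 1 , InP-intro verify (λ t → decide-t t (pairView t)) , λ s → id , id)

  MA : TM
  MA = proj₁ Extendable∈P

  kA : ℕ
  kA = proj₁ (proj₂ Extendable∈P)

  -- `InP` leaves open which string an accepting run outputs, so only the presence of an output is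
  -- used.
  verdict : Str → Maybe Str
  verdict s = proj₁ (proj₂ (proj₂ (proj₂ (proj₂ Extendable∈P) s)))

  exec-verdict : ∀ s → exec MA (poly kA (length s)) s ≡ just (verdict s)
  exec-verdict s = proj₂ (proj₂ (proj₂ (proj₂ (proj₂ Extendable∈P) s)))

  verdict-sound : ∀ s → is-just (verdict s) ≡ true → Extendable s
  verdict-sound s eq = proj₁ (proj₂ (proj₂ (proj₂ Extendable∈P) s)) (found (verdict s) (exec-verdict s) eq)
    where
    found : ∀ v → exec MA (poly kA (length s)) s ≡ just v → is-just v ≡ true → ∃[ y ] (exec MA (poly kA (length s)) s ≡ just (just y))
    found (just y) ex _ = y , ex

  verdict-complete : ∀ s → is-just (verdict s) ≡ false → ¬ Extendable s
  verdict-complete s eq = proj₁ (proj₂ (proj₂ Extendable∈P) s) (lost (verdict s) (exec-verdict s) eq)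
    where
    lost : ∀ v → exec MA (poly kA (length s)) s ≡ just v → is-just v ≡ false → exec MA (poly kA (length s)) s ≡ just nothing
    lost nothing ex _ = ex

  Good : Str → Str → Str → Set
  Good z p r = ∃[ w ] Extends z p r w

  extendable⇒good : ∀ z p r → Extendable (query z p r) → Good z p r
  extendable⇒good z p r (w , _ , v) = w , verified⇒extends z p r w v

  good⇒extendable : ∀ z p r → Good z p r → Extendable (query z p r)
  good⇒extendable z p r (w , ex) = w , ≤-trans (Extends.short ex) (≤-trans fits (≤-trans (m≤m+n n 1) (≤-reflexive (cong (_+ 1) (sym (trans (+-identityʳ _) (*-identityʳ n))))))) ,
    z , p , r , w , refl , ex
    where
    n : ℕ
    n = length (query z p r)
    suffix : ∀ x y → length y ≤ length (pair x y)
    suffix x y = ≤-trans (m≤n+m (length y) (2 * length x + 2)) (≤-reflexive (trans (+-assoc (2 * length x) 2 (length y)) (sym (length-pair x y))))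
    fits : length r ≤ n
    fits = ≤-trans (suffix p r) (suffix z (pair p r))

  choose : Str → Str → Str → Bool → Bool → Str
  ask : Str → Str → Str → Bool → Bool
  search : Str → Str → Str → Str

  ask z p r b = is-just (verdict (query z (p ++ b ∷ []) r))
  choose z p r true  _     = p ++ true ∷ []
  choose z p r false true  = p ++ false ∷ []
  choose z p r false false = p
  search z p []      = p
  search z p (_ ∷ r) = search z (choose z p r (ask z p r true) (ask z p r false)) r

  -- `Good` is the invariant of the search: `p` has an extension by at most `length r` letters that
  -- is mapped to `z`. Once `r` is empty, the extension can only be `p` itself.
  search-hits : ∀ z p r → Good z p r → τ (search z p r) ≡ just z
  search-hits z p [] ([] , extends _ hits) = trans (cong τ (sym (++-identityʳ p))) hits
  search-hits z p (c ∷ r) g = search-hits z _ r (chosen (ask z p r true) refl (ask z p r false) refl g)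
    where
    shift : ∀ b w → p ++ b ∷ w ≡ (p ++ b ∷ []) ++ w
    shift b w = sym (++-assoc p (b ∷ []) w)
    next-good : ∀ b w → Extends z p (c ∷ r) (b ∷ w) → Good z (p ++ b ∷ []) r
    next-good b w (extends (s≤s le) hits) = w , extends le (trans (cong τ (sym (shift b w))) hits)
    chosen : ∀ b₁ → ask z p r true ≡ b₁ → ∀ b₀ → ask z p r false ≡ b₀ → Good z p (c ∷ r) → Good z (choose z p r b₁ b₀) r
    chosen true  e₁ _     _  _ = extendable⇒good z _ r (verdict-sound _ e₁)
    chosen false _  true  e₀ _ = extendable⇒good z _ r (verdict-sound _ e₀)
    -- The empty extension is a hit, so `p` is already a preimage. The search is not stopped:
    -- keeping `p` preserves the invariant.
    chosen false _  false _  ([] , extends _ hits) = [] , extends z≤n hits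
    chosen false e₁ false e₀ (true ∷ w , ex)  = ⊥-elim (verdict-complete _ e₁ (good⇒extendable z _ r (next-good true w ex)))
    chosen false e₁ false e₀ (false ∷ w , ex) = ⊥-elim (verdict-complete _ e₀ (good⇒extendable z _ r (next-good false w ex)))

pair-snoc : ∀ p b r → pair (p ++ b ∷ []) r ≡ concatMap (λ b → b ∷ b ∷ []) p ++ b ∷ b ∷ false ∷ true ∷ r
pair-snoc []      b r = refl
pair-snoc (c ∷ p) b r = cong (λ s → c ∷ c ∷ s) (pair-snoc p b r)

double : Bool → Str
double b = b ∷ b ∷ []

rewords-double : ∀ x acc → rewords double (reverse x) acc ≡ concatMap double x ++ acc
rewords-double x acc = trans (rewords-concatMap double (reverse x) acc) (cong (λ x → concatMap double x ++ acc) (reverse-involutive x))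

rewords-reverse : ∀ x → rewords (_∷ []) (reverse x) [] ≡ x
rewords-reverse x = trans (rewords-move (reverse x) []) (reverse-involutive x)

module SearchProgram (σ : Fun2) (FPσ : FP₂ σ) (K : ℕ) (pnp : ∀ A → InNP A → InP A) where

  open Inverter σ FPσ pnp

  -- With `p` reversed, appending a letter is a push. Spilling a reversed string restores its order,
  -- as is wanted for `p` and `z` when a query is composed.
  searchEnv : Str → Str → Str → Env
  searchEnv z p r = [] ∷ [] ∷ [] ∷ [] ∷ reverse p ∷ [] ∷ r ∷ reverse z ∷ [] ∷ []

  tidy : Bool → Prog Bool
  tidy ok = clear #1 #2 #8 ⨾ ret ok

  askBit : Bool → Prog Bool
  -- Pushing prepends, so the query is composed from its end: `r`, the separator 01 with the doubled
  -- new letter before it, `p` doubled, 01, `z` doubled. Each part is copied back to its stack on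
  -- the way.
  askBit b = move #6 #5 #8 ⨾ spill #5 #1 (_∷ []) #6 (_∷ []) ⨾ pushWord #1 (b ∷ b ∷ false ∷ true ∷ []) ⨾
             spill #4 #1 double #5 (_∷ []) ⨾ move #5 #4 #8 ⨾ pushWord #1 (false ∷ true ∷ []) ⨾
             spill #7 #1 double #5 (_∷ []) ⨾ move #5 #7 #8 ⨾ bind (call MA kA) tidy

  Runs-askBit : ∀ z p r b → Runs (askBit b) (searchEnv z p r) (ask z p r b) (searchEnv z p r)
  Runs-askBit z p r b =
    Runs-move (λ ()) (λ ()) (λ ()) ⟫
    Runs-to (Runs-spill #5 #1 (_∷ []) #6 (_∷ []) (λ ()) (λ ()) (λ ()))
      (cong (λ r → [] ∷ r ∷ [] ∷ [] ∷ reverse p ∷ [] ∷ r ∷ reverse z ∷ [] ∷ []) (rewords-reverse r)) ⟫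
    Runs-pushWord (b ∷ b ∷ false ∷ true ∷ []) ⟫
    Runs-to (Runs-spill #4 #1 double #5 (_∷ []) (λ ()) (λ ()) (λ ()))
      (cong₂ (λ s p → [] ∷ s ∷ [] ∷ [] ∷ [] ∷ p ∷ r ∷ reverse z ∷ [] ∷ []) (trans (rewords-double p _) (sym (pair-snoc p b r))) (rewords-reverse p)) ⟫
    Runs-move (λ ()) (λ ()) (λ ()) ⟫
    Runs-pushWord (false ∷ true ∷ []) ⟫
    Runs-to (Runs-spill #7 #1 double #5 (_∷ []) (λ ()) (λ ()) (λ ()))
      (cong₂ (λ s z → [] ∷ s ∷ [] ∷ [] ∷ reverse p ∷ z ∷ r ∷ [] ∷ [] ∷ []) (rewords-double z _) (rewords-reverse z)) ⟫
    Runs-move (λ ()) (λ ()) (λ ()) ⟫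
    Runs-call MA kA (exec-verdict (query z (p ++ b ∷ []) r)) ⟫
    Runs-clear (λ ()) (λ ()) (λ ()) ⟫ Runs-ret

  after₀ : Bool → Prog (⊤ ⊎ ⊤)
  after₀ true  = push #4 false ⨾ ret (inj₁ tt)
  after₀ false = ret (inj₁ tt)

  after₁ : Bool → Prog (⊤ ⊎ ⊤)
  after₁ true  = push #4 true ⨾ ret (inj₁ tt)
  after₁ false = bind (askBit false) after₀

  searchStep : Maybe Bool → Prog (⊤ ⊎ ⊤)
  searchStep nothing  = ret (inj₂ tt)
  searchStep (just _) = bind (askBit true) after₁

  searchBody : Prog (⊤ ⊎ ⊤)
  searchBody = bind (pop #6) searchStep

  -- Opaque, since comparing two unfolded running times is infeasible.
  abstract
    bodyTime : ℕ → ℕ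
    bodyTime = time searchBody

    Pol-bodyTime : Pol bodyTime
    Pol-bodyTime = Pol-time searchBody

    J-body : ∀ {e a e′} → Runs searchBody e a e′ → J searchBody e a e′ (bodyTime (size e))
    J-body = judged

  searchLoop : Prog ⊤
  searchLoop = loop (iterated bodyTime) (Pol-iterated Pol-bodyTime) (λ _ → searchBody) tt

  reverse-snoc : ∀ (p : Str) b → reverse (p ++ b ∷ []) ≡ b ∷ reverse p
  reverse-snoc p b = reverse-++ p (b ∷ [])

  Runs-searchBody : ∀ z p c r → Runs searchBody (searchEnv z p (c ∷ r)) (inj₁ tt) (searchEnv z (choose z p r (ask z p r true) (ask z p r false)) r)
  Runs-searchBody z p c r = Runs-pop-∷ refl ⟫ Runs-askBit z p r true ⟫ run₁ (ask z p r true)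
    where
    pushed : ∀ b → searchEnv z p r [ #4 ]≔ (b ∷ reverse p) ≡ searchEnv z (p ++ b ∷ []) r
    pushed b = cong (λ p → [] ∷ [] ∷ [] ∷ [] ∷ p ∷ [] ∷ r ∷ reverse z ∷ [] ∷ []) (sym (reverse-snoc p b))
    run₀ : ∀ b₀ → Runs (after₀ b₀) (searchEnv z p r) (inj₁ tt) (searchEnv z (choose z p r false b₀) r)
    run₀ true  = Runs-to Runs-push (pushed false) ⟫ Runs-ret
    run₀ false = Runs-ret
    run₁ : ∀ b₁ → Runs (after₁ b₁) (searchEnv z p r) (inj₁ tt) (searchEnv z (choose z p r b₁ (ask z p r false)) r)
    run₁ true  = Runs-to Runs-push (pushed true) ⟫ Runs-ret
    run₁ false = Runs-askBit z p r false ⟫ run₀ (ask z p r false)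

  Runs-searchBody-end : ∀ z p → Runs searchBody (searchEnv z p []) (inj₂ tt) (searchEnv z p [])
  Runs-searchBody-end z p = Runs-bind (Runs-pop-[] refl) Runs-ret

  size-searchEnv : ∀ z p r → size (searchEnv z p r) ≡ length p + (length r + (length z + 0))
  size-searchEnv z p r = cong₂ (λ p z → p + (length r + (z + 0))) (length-reverse p) (length-reverse z)

  length-choose : ∀ z p r b₁ b₀ → length (choose z p r b₁ b₀) ≤ suc (length p)
  length-choose z p r true  _     = ≤-reflexive (trans (length-++ p) (+-comm (length p) 1))
  length-choose z p r false true  = ≤-reflexive (trans (length-++ p) (+-comm (length p) 1))
  length-choose z p r false false = n≤1+n (length p)

  -- `p` gains at most the one letter that `r` loses. The stacks never outgrow their initial size,
  -- and the same time bound holds for every round.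
  size-step : ∀ z p c r b₁ b₀ → size (searchEnv z (choose z p r b₁ b₀) r) ≤ size (searchEnv z p (c ∷ r))
  size-step z p c r b₁ b₀ = ≤-trans (≤-reflexive (size-searchEnv z (choose z p r b₁ b₀) r)) (≤-trans (+-monoˡ-≤ _ (length-choose z p r b₁ b₀))
    (≤-reflexive (trans (sym (+-suc (length p) _)) (sym (size-searchEnv z p (c ∷ r))))))

  J-searchLoop : ∀ z p r n → size (searchEnv z p r) ≤ n →
                 J searchLoop (searchEnv z p r) tt (searchEnv z (search z p r) []) (suc (length r) * bodyTime n)
  J-searchLoop z p []      n le = J-weaken (J-exit (J-body (Runs-searchBody-end z p)))
    (≤-trans (Pol.mono Pol-bodyTime le) (m≤m+n (bodyTime n) 0))
  J-searchLoop z p (c ∷ r) n le = J-weaken (J-again (J-body (Runs-searchBody z p c r))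
    (J-searchLoop z (choose z p r (ask z p r true) (ask z p r false)) r n (≤-trans (size-step z p c r (ask z p r true) (ask z p r false)) le)))
    (+-monoˡ-≤ (suc (length r) * bodyTime n) (Pol.mono Pol-bodyTime le))

  Runs-searchLoop : ∀ z p r → Runs searchLoop (searchEnv z p r) tt (searchEnv z (search z p r) [])
  Runs-searchLoop z p r = Runs-loop (J-searchLoop z p r (size e) ≤-refl) (iterated-≤ bodyTime (length r) (size e) (length≤size e #6))
    where
    e : Env
    e = searchEnv z p r

  budget : Str → Str
  budget z = unary (poly K (length z))

  invert : Prog Bool
  invert = spill #1 #7 (_∷ []) #3 (_∷ []) ⨾ polyUnary K ⨾ clear #3 #1 #2 ⨾ spill₁ #4 #6 one #8 ⨾ searchLoop ⨾ move #4 #1 #2 ⨾ ret true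

  invert-yields : ∀ z → Yields invert (inputEnv z) (just (search z [] (budget z)))
  invert-yields z = accepts (
    Runs-to (Runs-spill #1 #7 (_∷ []) #3 (_∷ []) (λ ()) (λ ()) (λ ()))
      (cong (λ z → [] ∷ [] ∷ [] ∷ z ∷ [] ∷ [] ∷ [] ∷ z ∷ [] ∷ []) (rewords-move z [])) ⟫
    Runs-to (Runs-polyUnary (reverse z) K)
      (cong (λ l → [] ∷ [] ∷ [] ∷ reverse z ∷ unary (poly K l) ∷ [] ∷ [] ∷ reverse z ∷ [] ∷ []) (length-reverse z)) ⟫
    Runs-clear (λ ()) (λ ()) (λ ()) ⟫
    Runs-to (Runs-spill₁ (λ ()) (λ ()) (λ ())) (cong (λ r → [] ∷ [] ∷ [] ∷ [] ∷ [] ∷ [] ∷ r ∷ reverse z ∷ [] ∷ [])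
      (trans (rewords-one (budget z) 0) (cong unary (trans (+-identityʳ _) (length-replicate (poly K (length z))))))) ⟫
    Runs-searchLoop z [] (budget z) ⟫
    Runs-to (Runs-move (λ ()) (λ ()) (λ ())) (cong (λ y → [] ∷ y ∷ [] ∷ [] ∷ [] ∷ [] ∷ [] ∷ reverse z ∷ [] ∷ []) (reverse-involutive (search z [] (budget z)))) ⟫
    Runs-ret)

oneWay⇒P≢NP : ∀ {σ} → OneWay σ → P≢NP
oneWay⇒P≢NP {σ} (FPσ , (k , honest) , noninvertible) pnp = noninvertible ((λ z → just (found z)) , FP-intro invert invert-yields , inverts)
  where
  pairTime : ℕ → ℕ
  -- The length of a pair whose components both have length `poly k n`. The search runs over coded
  -- pairs, so the bound from honesty has to be converted.
  pairTime n = 2 * poly k n + (2 + poly k n)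
  dominated : ∃[ K ] (∀ n → pairTime n ≤ poly K n)
  dominated = poly-dominates (Pol-+ (Pol-* (Pol-const 2) (Pol-poly k)) (Pol-+ (Pol-const 2) (Pol-poly k)))
  K : ℕ
  K = proj₁ dominated
  open Inverter σ FPσ pnp
  open SearchProgram σ FPσ K pnp
  found : Str → Str
  found z = search z [] (budget z)
  preimage-fits : ∀ z x y → length x + length y ≤ poly k (length z) → length (pair x y) ≤ length (budget z)
  preimage-fits z x y le = ≤-trans (≤-reflexive (length-pair x y))
    (≤-trans (+-mono-≤ (*-monoʳ-≤ 2 (≤-trans (m≤m+n (length x) (length y)) le)) (+-monoʳ-≤ 2 (≤-trans (m≤n+m (length y) (length x)) le)))
    (≤-trans (proj₂ dominated (length z)) (≤-reflexive (sym (length-replicate (poly K (length z)))))))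
  inverts : ∀ x y z → σ x y ≡ just z → ∃[ x′ ] ∃[ y′ ] (just (found z) ≡ just (pair x′ y′) × σ x′ y′ ≡ just z)
  inverts x y z eq with honest x y z eq
  ... | x₁ , y₁ , eq₁ , le with onPairs⁻ σ (found z) (search-hits z [] (budget z)
          (pair x₁ y₁ , extends (preimage-fits z x₁ y₁ le) (trans (onPairs-pair σ x₁ y₁) eq₁)))
  ...   | x′ , y′ , eq′ , hit = x′ , y′ , cong just eq′ , hit

-- The universal verifier

data Op : Set where
  halts : Bool → Op
  goes  : Sym → Move → Op

decodeSym : Bool → Bool → Sym
decodeSym false false = s0
decodeSym false true  = s1
decodeSym true  _     = blank

decodeMove : Bool → Bool → Move
decodeMove false false = L
decodeMove false true  = R
decodeMove true  _     = S

-- Total on five bits, so that no instruction of this length is malformed and a fixed number of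
-- letters is read.
decodeOp : Bool → Bool → Bool → Bool → Bool → Op
decodeOp true  b _ _ _ = halts b
decodeOp false a b c d = goes (decodeSym a b) (decodeMove c d)

symBits : Sym → Str
symBits s0    = false ∷ false ∷ []
symBits s1    = false ∷ true ∷ []
symBits blank = true ∷ false ∷ []

moveBits : Move → Str
moveBits L = false ∷ false ∷ []
moveBits R = false ∷ true ∷ []
moveBits S = true ∷ false ∷ []

opBits : Op → Str
opBits (halts b)  = true ∷ b ∷ false ∷ false ∷ false ∷ []
opBits (goes s m) = false ∷ symBits s ++ moveBits m

symIndex : Sym → ℕ
symIndex s0    = 0
symIndex s1    = 1
symIndex blank = 2

data Phase : Set where
  fetch skip jump : Phase

instance
  Finite-Phase : Finite Phase
  Finite-Phase = record { elems = fetch ∷ skip ∷ jump ∷ []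
                        ; complete = λ { fetch → here refl ; skip → there (here refl) ; jump → there (there (here refl)) } }

-- Interprets a straight-line program of instructions, each an operation followed by 1ⁿ0.  When the
-- skip counter is positive an instruction is only counted; otherwise it is executed and, unless it
-- halts, the counter is set to n plus the index of the symbol then scanned.
universal : Phase → Tape → ℕ → Str → Bool
universal fetch w zero    (b₁ ∷ b₂ ∷ b₃ ∷ b₄ ∷ b₅ ∷ it) with decodeOp b₁ b₂ b₃ b₄ b₅
... | halts b  = b
... | goes s m = universal jump (moveT w s m) 0 it
universal fetch w (suc c) (_ ∷ _ ∷ _ ∷ _ ∷ _ ∷ it) = universal skip w c it
universal fetch w c       _            = false
universal skip  w c       (true ∷ it)  = universal skip w c it
universal skip  w c       (false ∷ it) = universal fetch w c it
universal skip  w c       []           = false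
universal jump  w c       (true ∷ it)  = universal jump w (suc c) it
universal jump  w c       (false ∷ it) = universal fetch w (symIndex (cur w) + c) it
universal jump  w c       []           = false

universal-[] : ∀ w c → universal fetch w c [] ≡ false
universal-[] w zero    = refl
universal-[] w (suc c) = refl

Item : Set
Item = Op × ℕ

itemBits : Item → Str
itemBits (op , n) = opBits op ++ unary n ++ false ∷ []

program : List Item → Str
program = concatMap itemBits

skip-unary : ∀ n w c it → universal skip w c ((unary n ++ false ∷ []) ++ it) ≡ universal fetch w c it
skip-unary zero    w c it = refl
skip-unary (suc n) w c it = skip-unary n w c it

jump-unary : ∀ n w c it → universal jump w c ((unary n ++ false ∷ []) ++ it) ≡ universal fetch w (symIndex (cur w) + (n + c)) it
jump-unary zero    w c it = refl
jump-unary (suc n) w c it = trans (jump-unary n w (suc c) it) (cong (λ n → universal fetch w (symIndex (cur w) + n) it) (+-suc n c))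

skip-item : ∀ i w c it → universal fetch w (suc c) (itemBits i ++ it) ≡ universal fetch w c it
skip-item (halts b , n)      w c it = skip-unary n w c it
skip-item (goes s0 L , n)    w c it = skip-unary n w c it
skip-item (goes s0 R , n)    w c it = skip-unary n w c it
skip-item (goes s0 S , n)    w c it = skip-unary n w c it
skip-item (goes s1 L , n)    w c it = skip-unary n w c it
skip-item (goes s1 R , n)    w c it = skip-unary n w c it
skip-item (goes s1 S , n)    w c it = skip-unary n w c it
skip-item (goes blank L , n) w c it = skip-unary n w c it
skip-item (goes blank R , n) w c it = skip-unary n w c it
skip-item (goes blank S , n) w c it = skip-unary n w c it

run-goes : ∀ s m n w it → universal fetch w 0 (itemBits (goes s m , n) ++ it) ≡ universal jump (moveT w s m) 0 ((unary n ++ false ∷ []) ++ it)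
run-goes s0    L n w it = refl
run-goes s0    R n w it = refl
run-goes s0    S n w it = refl
run-goes s1    L n w it = refl
run-goes s1    R n w it = refl
run-goes s1    S n w it = refl
run-goes blank L n w it = refl
run-goes blank R n w it = refl
run-goes blank S n w it = refl

skip-items : ∀ is w c it → universal fetch w (length is + c) (program is ++ it) ≡ universal fetch w c it
skip-items []       w c it = refl
skip-items (i ∷ is) w c it = trans (cong (universal fetch w (suc (length is + c))) (++-assoc (itemBits i) (program is) it))
  (trans (skip-item i w (length is + c) (program is ++ it)) (skip-items is w c it))

tabulate-split : ∀ {A : Set} {n} (f : Fin n → A) i → ∃[ pre ] ∃[ post ]
                 (tabulate f ≡ pre ++ f i ∷ post × length pre ≡ toℕ i × length post ≡ n ∸ suc (toℕ i))
tabulate-split {n = suc n} f zero = [] , tabulate (f ∘ suc) , refl , refl , length-tabulate (f ∘ suc)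
tabulate-split {n = suc n} f (suc i) with tabulate-split (f ∘ suc) i
... | pre , post , eq , l₁ , l₂ = f zero ∷ pre , post , cong (f zero ∷_) eq , cong suc l₁ , l₂

symFin : Sym → Fin 3
symFin s0    = zero
symFin s1    = suc zero
symFin blank = suc (suc zero)

finSym : Fin 3 → Sym
finSym zero             = s0
finSym (suc zero)       = s1
finSym (suc (suc zero)) = blank

finSym-symFin : ∀ s → finSym (symFin s) ≡ s
finSym-symFin s0    = refl
finSym-symFin s1    = refl
finSym-symFin blank = refl

toℕ-symFin : ∀ s → toℕ (symFin s) ≡ symIndex s
toℕ-symFin s0    = refl
toℕ-symFin s1    = refl
toℕ-symFin blank = refl

repeat : ℕ → Str → Str
repeat zero    s = []
repeat (suc n) s = s ++ repeat n s

-- One copy of the table per step: the instruction for (q , s) skips to that for (q′ , s′) in the next copy.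
module Table (M : TM) where

  n : ℕ
  n = suc (TM.states M)

  entry : ℕ → Action n → Item
  entry i accept      = halts true , 0
  entry i reject      = halts false , 0
  -- After entry `i`, `n * 3 ∸ suc i` entries are left in this copy. The entries for state `q` begin
  -- at `3 * toℕ q` in the next one, and the interpreter adds the index of the symbol that it then
  -- scans.
  entry i (go q s m)  = goes s m , (n * 3 ∸ suc i) + 3 * toℕ q

  entryAt : Fin (n * 3) → Item
  entryAt i = entry (toℕ i) (TM.δ M (proj₁ (remQuot {n} 3 i)) (finSym (proj₂ (remQuot {n} 3 i))))

  table : Str
  table = program (tabulate entryAt)

  position : Fin n → Tape → Fin (n * 3)
  position q w = combine q (symFin (cur w))

  entryAt-position : ∀ q w → entryAt (position q w) ≡ entry (toℕ (position q w)) (TM.δ M q (cur w))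
  entryAt-position q w = cong₂ (λ q s → entry (toℕ (position q′ w)) (TM.δ M q s)) (cong proj₁ (remQuot-combine q (symFin (cur w))))
    (trans (cong finSym (cong proj₂ (remQuot-combine q (symFin (cur w))))) (finSym-symFin (cur w)))
    where q′ = q

  resume : Action n → Tape → Str → Bool
  resume accept      w it = true
  resume reject      w it = false
  resume (go q s m)  w it = universal fetch (moveT w s m) (toℕ (position q (moveT w s m))) it

  -- The counter passes over `pre` and selects one entry. The distance set there is consumed first
  -- by `post` and then counts within `it`, where the next copy is expected.
  one-pass : ∀ q w it → universal fetch w (toℕ (position q w)) (table ++ it) ≡ resume (TM.δ M q (cur w)) w it
  one-pass q w it with tabulate-split entryAt (position q w)
  ... | pre , post , eq , len-pre , len-post = begin
    universal fetch w (toℕ i) (table ++ it)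
      ≡⟨ cong₂ (λ c t → universal fetch w c (t ++ it)) (trans (sym len-pre) (sym (+-identityʳ _))) (trans (cong program eq) (concatMap-++ itemBits pre (entryAt i ∷ post))) ⟩
    universal fetch w (length pre + 0) ((program pre ++ itemBits (entryAt i) ++ program post) ++ it)
      ≡⟨ cong (universal fetch w (length pre + 0)) (trans (++-assoc (program pre) (itemBits (entryAt i) ++ program post) it) (cong (program pre ++_) (++-assoc (itemBits (entryAt i)) (program post) it))) ⟩
    universal fetch w (length pre + 0) (program pre ++ itemBits (entryAt i) ++ program post ++ it)
      ≡⟨ skip-items pre w 0 _ ⟩
    universal fetch w 0 (itemBits (entryAt i) ++ program post ++ it)
      ≡⟨ cong (λ e → universal fetch w 0 (itemBits e ++ program post ++ it)) (entryAt-position q w) ⟩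
    universal fetch w 0 (itemBits (entry (toℕ i) (TM.δ M q (cur w))) ++ program post ++ it)
      ≡⟨ execute (TM.δ M q (cur w)) ⟩
    resume (TM.δ M q (cur w)) w it ∎
    where
    open ≡-Reasoning
    i : Fin (n * 3)
    i = position q w
    landing : ∀ q′ w′ → symIndex (cur w′) + (((n * 3 ∸ suc (toℕ i)) + 3 * toℕ q′) + 0) ≡ length post + toℕ (position q′ w′)
    landing q′ w′ = begin
      symIndex (cur w′) + (((n * 3 ∸ suc (toℕ i)) + 3 * toℕ q′) + 0) ≡⟨ cong (symIndex (cur w′) +_) (+-identityʳ _) ⟩
      symIndex (cur w′) + ((n * 3 ∸ suc (toℕ i)) + 3 * toℕ q′)       ≡⟨ +-comm (symIndex (cur w′)) _ ⟩
      ((n * 3 ∸ suc (toℕ i)) + 3 * toℕ q′) + symIndex (cur w′)       ≡⟨ +-assoc (n * 3 ∸ suc (toℕ i)) _ _ ⟩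
      (n * 3 ∸ suc (toℕ i)) + (3 * toℕ q′ + symIndex (cur w′))       ≡⟨ cong₂ _+_ (sym len-post) (trans (cong (3 * toℕ q′ +_) (sym (toℕ-symFin (cur w′)))) (sym (toℕ-combine q′ (symFin (cur w′))))) ⟩
      length post + toℕ (position q′ w′) ∎
    execute : ∀ a → universal fetch w 0 (itemBits (entry (toℕ i) a) ++ program post ++ it) ≡ resume a w it
    execute accept      = refl
    execute reject      = refl
    execute (go q′ s m) = let w′ = moveT w s m in begin
      universal fetch w 0 (itemBits (goes s m , k q′) ++ program post ++ it)   ≡⟨ run-goes s m (k q′) w (program post ++ it) ⟩
      universal jump w′ 0 ((unary (k q′) ++ false ∷ []) ++ program post ++ it) ≡⟨ jump-unary (k q′) w′ 0 (program post ++ it) ⟩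
      universal fetch w′ (symIndex (cur w′) + (k q′ + 0)) (program post ++ it) ≡⟨ cong (λ c → universal fetch w′ c (program post ++ it)) (landing q′ w′) ⟩
      universal fetch w′ (length post + toℕ (position q′ w′)) (program post ++ it) ≡⟨ skip-items post w′ _ it ⟩
      universal fetch w′ (toℕ (position q′ w′)) it ∎
      where
      k : Fin n → ℕ
      k q = (n * 3 ∸ suc (toℕ i)) + 3 * toℕ q

  accepted : Maybe (Bool × Config n) → Bool
  accepted (just (b , _)) = b
  accepted nothing        = false

  -- A run with clock `t` may make `t` steps and then still look up a halting action, hence `suc t`
  -- copies. If it has not halted by then, the program is exhausted and the answer is `false`.
  universal-run : ∀ t q w → universal fetch w (toℕ (position q w)) (repeat (suc t) table) ≡ accepted (run M t (toConf q w))
  universal-run t q w = trans (one-pass q w (repeat t table)) (continue t)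
    where
    continue : ∀ t → resume (TM.δ M q (cur w)) w (repeat t table) ≡ accepted (run M t (toConf q w))
    continue t with TM.δ M q (cur w)
    continue t       | accept      = refl
    continue t       | reject      = refl
    continue zero    | go q′ s m   = universal-[] (moveT w s m) (toℕ (position q′ (moveT w s m)))
    continue (suc t) | go q′ s m   = trans (universal-run t q′ (moveT w s m)) (cong (accepted ∘ run M t) (sym (moveConf≡ q′ w s m)))

  position-zero : ∀ w → toℕ (position zero w) ≡ symIndex (cur w)
  position-zero w = trans (toℕ-combine {n} {3} zero (symFin (cur w))) (toℕ-symFin (cur w))

Control : Set
Control = Phase × Sym

get : (Bool → Prog (Control ⊎ Bool)) → Prog (Control ⊎ Bool)
get k = bind (pop #1) λ { nothing → ret (inj₂ false) ; (just b) → k b }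

execute : Sym → Op → Maybe Bool → Prog (Control ⊎ Bool)
execute s op         (just _) = ret (inj₁ (skip , s))
execute s (halts b)  nothing  = ret (inj₂ b)
execute s (goes s′ m) nothing = bind (moveHead s′ m) (λ c → ret (inj₁ (jump , c)))

interpret : Control → Prog (Control ⊎ Bool)
interpret (fetch , s) = get λ b₁ → get λ b₂ → get λ b₃ → get λ b₄ → get λ b₅ → bind (pop #4) (execute s (decodeOp b₁ b₂ b₃ b₄ b₅))
interpret (skip , s)  = get λ { true → ret (inj₁ (skip , s)) ; false → ret (inj₁ (fetch , s)) }
interpret (jump , s)  = get λ { true  → push #4 true ⨾ ret (inj₁ (jump , s))
                              ; false → pushWord #4 (unary (symIndex s)) ⨾ ret (inj₁ (fetch , s)) }

-- The costliest round executes an instruction: five letters and the counter are popped, the head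
-- takes six operations, and one is the `ret`, 13 in all. Every continuing round consumes a letter
-- of the program.
universalP : Sym → Prog Bool
universalP s = loop (linear 13) (Pol-linear 13) interpret (fetch , s)

module _ {io : Str} {rest : Vec Str 4} where

  universalEnv : Str → Tape → ℕ → Env
  universalEnv it w c = tapeEnv io it w (unary c ∷ rest)

  InterpretsAs : Phase → Tape → ℕ → Str → Bool → Set
  InterpretsAs ph w c it b = ∃[ it′ ] ∃[ l ] ∃[ r ] ∃[ c′ ]
    J (loop (linear 13) (Pol-linear 13) interpret (ph , cur w)) (universalEnv it w c) b (io ∷ it′ ∷ l ∷ r ∷ c′ ∷ rest) (suc (length it) * 13)

  stopped : ∀ w c {ph it e b t} → J (interpret (ph , cur w)) (universalEnv it w c) (inj₂ b) e t → t ≤ suc (length it) * 13 →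
            J (loop (linear 13) (Pol-linear 13) interpret (ph , cur w)) (universalEnv it w c) b e (suc (length it) * 13)
  stopped w c j le = J-weaken (J-exit j) le

  onward : ∀ w c w′ c′ {ph it ph′ it′ b} → J (interpret (ph , cur w)) (universalEnv it w c) (inj₁ (ph′ , cur w′)) (universalEnv it′ w′ c′) 13 →
           InterpretsAs ph′ w′ c′ it′ b → suc (length it′) ≤ length it → InterpretsAs ph w c it b
  onward w c w′ c′ j (_ , _ , _ , _ , j′) le = _ , _ , _ , _ , J-weaken (J-again j j′) (+-monoʳ-≤ 13 (*-monoˡ-≤ 13 le))

  fetched : ∀ {b₁ b₂ b₃ b₄ b₅ it w a e t} → J (execute (cur w) (decodeOp b₁ b₂ b₃ b₄ b₅) nothing) (universalEnv it w 0) a e t →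
            J (interpret (fetch , cur w)) (universalEnv (b₁ ∷ b₂ ∷ b₃ ∷ b₄ ∷ b₅ ∷ it) w 0) a e (6 + t)
  fetched j = J-bind (J-pop-∷ refl) (J-bind (J-pop-∷ refl) (J-bind (J-pop-∷ refl) (J-bind (J-pop-∷ refl) (J-bind (J-pop-∷ refl) (J-bind (J-pop-[] refl) j)))))

  J-universal : ∀ it ph w c → InterpretsAs ph w c it (universal ph w c it)
  J-universal (b₁ ∷ b₂ ∷ b₃ ∷ b₄ ∷ b₅ ∷ it) fetch w (suc c) =
    onward w (suc c) w c (J-weaken (J-bind (J-pop-∷ refl) (J-bind (J-pop-∷ refl) (J-bind (J-pop-∷ refl) (J-bind (J-pop-∷ refl) (J-bind (J-pop-∷ refl) (J-bind (J-pop-∷ refl) J-ret))))))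
      (m≤m+n 7 6)) (J-universal it skip w c) (m≤n+m (suc (length it)) 4)
  J-universal (b₁ ∷ b₂ ∷ b₃ ∷ b₄ ∷ b₅ ∷ it) fetch w zero with decodeOp b₁ b₂ b₃ b₄ b₅ in eq
  ... | halts b = _ , _ , _ , _ , stopped w 0 (fetched {w = w} (J-is (cong (λ op → execute (cur w) op nothing) eq) J-ret)) (m≤m+n 7 _)
  ... | goes s m =
    onward w 0 (moveT w s m) 0 (fetched {w = w} (J-is (cong (λ op → execute (cur w) op nothing) eq) (J-bind (J-moveHead w s m) J-ret))) (J-universal it jump (moveT w s m) 0) (m≤n+m (suc (length it)) 4)
  J-universal [] fetch w zero = _ , _ , _ , _ , stopped w 0 (J-bind (J-pop-[] refl) J-ret) (m≤m+n 2 11)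
  J-universal [] fetch w (suc c) = _ , _ , _ , _ , stopped w (suc c) (J-bind (J-pop-[] refl) J-ret) (m≤m+n 2 11)
  J-universal (_ ∷ []) fetch w zero = _ , _ , _ , _ , stopped w 0 (J-bind (J-pop-∷ refl) (J-bind (J-pop-[] refl) J-ret)) (m≤m+n 3 _)
  J-universal (_ ∷ []) fetch w (suc c) = _ , _ , _ , _ , stopped w (suc c) (J-bind (J-pop-∷ refl) (J-bind (J-pop-[] refl) J-ret)) (m≤m+n 3 _)
  J-universal (_ ∷ _ ∷ []) fetch w zero = _ , _ , _ , _ , stopped w 0 (J-bind (J-pop-∷ refl) (J-bind (J-pop-∷ refl) (J-bind (J-pop-[] refl) J-ret))) (m≤m+n 4 _)
  J-universal (_ ∷ _ ∷ []) fetch w (suc c) = _ , _ , _ , _ , stopped w (suc c) (J-bind (J-pop-∷ refl) (J-bind (J-pop-∷ refl) (J-bind (J-pop-[] refl) J-ret))) (m≤m+n 4 _)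
  J-universal (_ ∷ _ ∷ _ ∷ []) fetch w zero = _ , _ , _ , _ , stopped w 0 (J-bind (J-pop-∷ refl) (J-bind (J-pop-∷ refl) (J-bind (J-pop-∷ refl) (J-bind (J-pop-[] refl) J-ret)))) (m≤m+n 5 _)
  J-universal (_ ∷ _ ∷ _ ∷ []) fetch w (suc c) = _ , _ , _ , _ , stopped w (suc c) (J-bind (J-pop-∷ refl) (J-bind (J-pop-∷ refl) (J-bind (J-pop-∷ refl) (J-bind (J-pop-[] refl) J-ret)))) (m≤m+n 5 _)
  J-universal (_ ∷ _ ∷ _ ∷ _ ∷ []) fetch w zero = _ , _ , _ , _ , stopped w 0 (J-bind (J-pop-∷ refl) (J-bind (J-pop-∷ refl) (J-bind (J-pop-∷ refl) (J-bind (J-pop-∷ refl) (J-bind (J-pop-[] refl) J-ret))))) (m≤m+n 6 _)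
  J-universal (_ ∷ _ ∷ _ ∷ _ ∷ []) fetch w (suc c) = _ , _ , _ , _ , stopped w (suc c) (J-bind (J-pop-∷ refl) (J-bind (J-pop-∷ refl) (J-bind (J-pop-∷ refl) (J-bind (J-pop-∷ refl) (J-bind (J-pop-[] refl) J-ret))))) (m≤m+n 6 _)
  J-universal [] skip w c = _ , _ , _ , _ , stopped w c (J-bind (J-pop-[] refl) J-ret) (m≤m+n 2 11)
  J-universal (true ∷ it)  skip w c = onward w c w c (J-weaken (J-bind (J-pop-∷ refl) J-ret) (m≤m+n 2 11)) (J-universal it skip w c) ≤-refl
  J-universal (false ∷ it) skip w c = onward w c w c (J-weaken (J-bind (J-pop-∷ refl) J-ret) (m≤m+n 2 11)) (J-universal it fetch w c) ≤-refl
  J-universal [] jump w c = _ , _ , _ , _ , stopped w c (J-bind (J-pop-[] refl) J-ret) (m≤m+n 2 11)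
  J-universal (true ∷ it)  jump w c = onward w c w (suc c) (J-weaken (J-bind (J-pop-∷ refl) (J-bind J-push J-ret)) (m≤m+n 3 10)) (J-universal it jump w (suc c)) ≤-refl
  J-universal (false ∷ it) jump w c = onward w c w (symIndex (cur w) + c) (J-weaken (J-bind (J-pop-∷ refl) (J-bind (J-to (J-pushWord (unary (symIndex (cur w))))
      (cong (λ c → tapeEnv io it w (c ∷ rest)) (unary-+ (symIndex (cur w)) c))) J-ret)) (short (cur w))) (J-universal it fetch w (symIndex (cur w) + c)) ≤-refl
    where
    short : ∀ s → 1 + (suc (length (unary (symIndex s))) + 1) ≤ 13
    short s0    = m≤m+n 3 10
    short s1    = m≤m+n 4 9
    short blank = m≤m+n 5 8

  Runs-universal : ∀ it w c → ∃[ it′ ] ∃[ l ] ∃[ r ] ∃[ c′ ]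
    Runs (universalP (cur w)) (universalEnv it w c) (universal fetch w c it) (io ∷ it′ ∷ l ∷ r ∷ c′ ∷ rest)
  Runs-universal it w c = let it′ , l , r , c′ , j = J-universal it fetch w c in
    it′ , l , r , c′ , Runs-loop j (*-monoˡ-≤ 13 (s≤s (length≤size (universalEnv it w c) #1)))

-- Instances and their witnesses

universalAccepts : Str → Str → Bool
universalAccepts s it = universal fetch (initTape s) (symIndex (cur (initTape s))) it

onlyIf : Bool → Str → Maybe Str
onlyIf true  I = just I
onlyIf false I = nothing

-- Each stage of `check` takes the outcome of the previous parse or comparison as an argument, so
-- that proofs can replace it by an equation or by cases. The first component of a parse arrives
-- reversed; for the bound this is left so, as only its length counts.
check₄ : Str → Str → Str → ∀ {m n} → Dec (m ≤ n) → Maybe Str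
check₄ I s it (yes _) = onlyIf (universalAccepts s it) I
check₄ I s it (no _)  = nothing

check₃ : Str → Str → Str → Bool × Str × Str → Maybe Str
check₃ w I px (true , bound , it) = check₄ I (px ++ w) it (length w ≤? length bound)
check₃ w I px (false , _ , _)     = nothing

check₂ : Str → Str → Bool × Str × Str → Maybe Str
check₂ w I (true , px , q) = check₃ w I (reverse px) (undouble [] q)
check₂ w I (false , _ , _) = nothing

check₁ : Bool × Str × Str → Maybe Str
check₁ (true , w , I)  = check₂ (reverse w) I (undouble [] I)
check₁ (false , _ , _) = nothing

-- check u = just I when u = ⟨ w , I ⟩ for a witness w of the instance I = ⟨ px , ⟨ bound , it ⟩ ⟩, that
-- is, when the straight-line program it accepts the tape px w and w is no longer than bound.
check : Str → Maybe Str
check u = check₁ (undouble [] u)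

check-sound : ∀ u {I} → check u ≡ just I → ∃[ w ] ∃[ px ] ∃[ bound ] ∃[ it ]
              (u ≡ pair w I × I ≡ pair px (pair bound it) × length w ≤ length bound × universalAccepts (px ++ w) it ≡ true)
check-sound u eq with pairView u
... | notPair fails _ = case trans (sym (cong check₁ fails)) eq of λ ()
... | isPair w I = at₁ (pairView I) (trans (sym (trans (cong check₁ (undouble-pair [] w I)) (cong (λ w → check₂ w I (undouble [] I)) (reverse-involutive w)))) eq)
  where
  at₄ : ∀ px b it {I′} (d : Dec (length w ≤ length (reverse b))) → check₄ (pair px (pair b it)) (px ++ w) it d ≡ just I′ →
        pair px (pair b it) ≡ I′ × length w ≤ length b × universalAccepts (px ++ w) it ≡ true
  at₄ px b it (yes le) eq with universalAccepts (px ++ w) it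
  ... | true = just-injective eq , ≤-trans le (≤-reflexive (length-reverse b)) , refl
  at₂ : ∀ px q {I′} → PairView q → check₃ w (pair px q) px (undouble [] q) ≡ just I′ → ∃[ px′ ] ∃[ bound ] ∃[ it ]
        (pair w (pair px q) ≡ pair w I′ × I′ ≡ pair px′ (pair bound it) × length w ≤ length bound × universalAccepts (px′ ++ w) it ≡ true)
  at₂ px .(pair b it) (isPair b it) eq with at₄ px b it (length w ≤? length (reverse b)) (trans (sym (cong (check₃ w _ px) (undouble-pair [] b it))) eq)
  ... | refl , le , acc = px , b , it , refl , refl , le , acc
  at₂ px q (notPair fails _) eq = case trans (sym (cong (check₃ w _ px) fails)) eq of λ ()
  at₁ : ∀ {I I′} → PairView I → check₂ w I (undouble [] I) ≡ just I′ → ∃[ w′ ] ∃[ px ] ∃[ bound ] ∃[ it ]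
        (pair w I ≡ pair w′ I′ × I′ ≡ pair px (pair bound it) × length w′ ≤ length bound × universalAccepts (px ++ w′) it ≡ true)
  at₁ (isPair px q) eq = w , at₂ px q (pairView q) (trans (sym (trans (cong (check₂ w _) (undouble-pair [] px q)) (cong (λ px′ → check₃ w (pair px q) px′ (undouble [] q)) (reverse-involutive px)))) eq)
  at₁ (notPair fails _) eq = case trans (sym (cong (check₂ w _) fails)) eq of λ ()

check-complete : ∀ w px bound it → length w ≤ length bound → universalAccepts (px ++ w) it ≡ true →
                 check (pair w (pair px (pair bound it))) ≡ just (pair px (pair bound it))
check-complete w px bound it le acc = begin
  check (pair w I)                                        ≡⟨ cong check₁ (undouble-pair [] w I) ⟩
  check₂ (reverse (reverse w)) I (undouble [] I)          ≡⟨ cong₂ (λ w → check₂ w I) (reverse-involutive w) (undouble-pair [] px q) ⟩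
  check₃ w I (reverse (reverse px)) (undouble [] q)       ≡⟨ cong₂ (check₃ w I) (reverse-involutive px) (undouble-pair [] bound it) ⟩
  check₄ I (px ++ w) it (length w ≤? length (reverse bound)) ≡⟨ last (length w ≤? length (reverse bound)) ⟩
  just I                                                  ∎
  where
  open ≡-Reasoning
  q I : Str
  q = pair bound it
  I = pair px q
  last : ∀ (d : Dec (length w ≤ length (reverse bound))) → check₄ I (px ++ w) it d ≡ just I
  last (yes _)  = cong (λ b → onlyIf b I) acc
  last (no nle) = ⊥-elim (nle (≤-trans le (≤-reflexive (sym (length-reverse bound)))))

-- Parsing and interpreting use up the instance, so a spare copy is kept on stack 7, where `emit`
-- fetches the value of σ.
data Checks (p : Prog Bool) (e : Env) : Maybe Str → Set where
  passes : ∀ {a b c d f g h I} → Runs p e true ([] ∷ a ∷ b ∷ c ∷ d ∷ f ∷ g ∷ I ∷ h ∷ []) → Checks p e (just I)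
  fails  : ∀ {e′} → Runs p e false ([] ∷ e′) → Checks p e nothing

infixr 3 _⟫ᶜ_

_⟫ᶜ_ : ∀ {B} {{_ : Finite B}} {p : Prog B} {f : B → Prog Bool} {e b e₁ r} →
       Runs p e b e₁ → Checks (f b) e₁ r → Checks (bind p f) e r
run ⟫ᶜ passes run′ = passes (Runs-bind run run′)
run ⟫ᶜ fails run′  = fails (Runs-bind run run′)

simulateP : Sym → Prog Bool
simulateP c = pushWord #4 (unary (symIndex c)) ⨾ universalP c

checkP₄ : Bool → Prog Bool
checkP₄ = onTrue (clear #3 #6 #8 ⨾ move #4 #1 #8 ⨾ spill₁ #5 #3 bitWord #8 ⨾ bind (popSym #3) simulateP)

checkP₃ : Bool → Prog Bool
checkP₃ = onTrue (move #1 #4 #8 ⨾ move #2 #1 #8 ⨾ bind moveWithin checkP₄)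

checkP₂ : Bool → Prog Bool
checkP₂ = onTrue (bind (unpair #1 #3) checkP₃)

checkP₁ : Bool → Prog Bool
checkP₁ = onTrue (move #1 #6 #8 ⨾ spill #6 #1 (_∷ []) #7 (_∷ []) ⨾ bind (unpair #1 #5) checkP₂)

checkP : Prog Bool
checkP = bind (unpair #1 #2) checkP₁

checks₄ : ∀ I px w it s₃ → Checks (checkP₄ true) ([] ∷ [] ∷ [] ∷ s₃ ∷ reverse it ∷ (w ʳ++ reverse px) ∷ [] ∷ I ∷ [] ∷ []) (onlyIf (universalAccepts (px ++ w) it) I)
checks₄ I px w it s₃ =
  Runs-clear (λ ()) (λ ()) (λ ()) ⟫ᶜ
  Runs-to (Runs-move (λ ()) (λ ()) (λ ())) (cong (λ it → [] ∷ it ∷ [] ∷ [] ∷ [] ∷ (w ʳ++ reverse px) ∷ [] ∷ I ∷ [] ∷ []) (reverse-involutive it)) ⟫ᶜ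
  Runs-to (Runs-spill₁ (λ ()) (λ ()) (λ ())) (cong (λ s → [] ∷ it ∷ [] ∷ s ∷ [] ∷ [] ∷ [] ∷ I ∷ [] ∷ []) loaded) ⟫ᶜ
  Runs-popSym (map toSym (px ++ w)) refl ⟫ᶜ
  Runs-to (Runs-pushWord (unary (symIndex c))) (cong (λ u → [] ∷ it ∷ [] ∷ code (right (initTape (px ++ w))) ∷ u ∷ [] ∷ [] ∷ I ∷ [] ∷ []) (++-identityʳ (unary (symIndex c)))) ⟫ᶜ
  final (universalAccepts (px ++ w) it) (Runs-universal it (initTape (px ++ w)) (symIndex c))
  where
  c : Sym
  c = cur (initTape (px ++ w))
  loaded : rewords bitWord (w ʳ++ reverse px) [] ≡ code (map toSym (px ++ w))
  loaded = trans (cong (λ s → rewords bitWord s []) (trans (sym (reverse-involutive (w ʳ++ reverse px))) (cong reverse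
    (trans (ʳ++-ʳ++ w) (trans (ʳ++-ʳ++ px) (cong (px ++_) (++-identityʳ w))))))) (rewords-bits (px ++ w))
  final : ∀ {p e} b → (∃[ it′ ] ∃[ l ] ∃[ r ] ∃[ c′ ] Runs p e b ([] ∷ it′ ∷ l ∷ r ∷ c′ ∷ [] ∷ [] ∷ I ∷ [] ∷ [])) → Checks p e (onlyIf b I)
  final true  (_ , _ , _ , _ , run) = passes run
  final false (_ , _ , _ , _ , run) = fails run

checks₃ : ∀ I px w b it (d : Dec (length w ≤ length b)) → Checks (checkP₃ true) ([] ∷ it ∷ reverse w ∷ b ∷ [] ∷ reverse px ∷ [] ∷ I ∷ [] ∷ []) (check₄ I (px ++ w) it d)
checks₃ I px w b it d =
  Runs-move (λ ()) (λ ()) (λ ()) ⟫ᶜ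
  Runs-to (Runs-move (λ ()) (λ ()) (λ ())) (cong (λ w → [] ∷ w ∷ [] ∷ b ∷ reverse it ∷ reverse px ∷ [] ∷ I ∷ [] ∷ []) (reverse-involutive w)) ⟫ᶜ
  paid d
  where
  paid : (d : Dec (length w ≤ length b)) → Checks (bind moveWithin checkP₄) ([] ∷ w ∷ [] ∷ b ∷ reverse it ∷ reverse px ∷ [] ∷ I ∷ [] ∷ []) (check₄ I (px ++ w) it d)
  paid (yes le) = let r , run = Runs-moveWithin w b (reverse px) le in run ⟫ᶜ checks₄ I px w it r
  paid (no nle) = let _ , _ , run = Runs-moveWithin-fails w b (reverse px) nle in run ⟫ᶜ fails Runs-ret

checks₂ : ∀ I px w q u → undouble [] q ≡ u → Checks (checkP₂ true) ([] ∷ q ∷ reverse w ∷ [] ∷ [] ∷ reverse px ∷ [] ∷ I ∷ [] ∷ []) (check₃ w I px u)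
checks₂ I px w q (true , b , it) eq = Runs-unpair #1 #3 (λ ()) eq ⟫ᶜ checks₃ I px w b it (length w ≤? length b)
checks₂ I px w q (false , _ , _) eq = Runs-unpair #1 #3 (λ ()) eq ⟫ᶜ fails Runs-ret

checks₁ : ∀ I w u → undouble [] I ≡ u → Checks (checkP₁ true) ([] ∷ I ∷ reverse w ∷ V.replicate 6 []) (check₂ w I u)
checks₁ I w u eq =
  Runs-move (λ ()) (λ ()) (λ ()) ⟫ᶜ
  Runs-to (Runs-spill #6 #1 (_∷ []) #7 (_∷ []) (λ ()) (λ ()) (λ ())) (cong (λ I → [] ∷ I ∷ reverse w ∷ [] ∷ [] ∷ [] ∷ [] ∷ I ∷ [] ∷ []) (rewords-reverse I)) ⟫ᶜ
  parsed u eq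
  where
  parsed : ∀ u → undouble [] I ≡ u → Checks (bind (unpair #1 #5) checkP₂) ([] ∷ I ∷ reverse w ∷ [] ∷ [] ∷ [] ∷ [] ∷ I ∷ [] ∷ []) (check₂ w I u)
  parsed (true , px , q) eq = Runs-to (Runs-unpair #1 #5 (λ ()) eq) (cong (λ px → [] ∷ q ∷ reverse w ∷ [] ∷ [] ∷ px ∷ [] ∷ I ∷ [] ∷ []) (sym (reverse-involutive px))) ⟫ᶜ
    checks₂ I (reverse px) w q (undouble [] q) refl
  parsed (false , _ , _) eq = Runs-unpair #1 #5 (λ ()) eq ⟫ᶜ fails Runs-ret

checks : ∀ u → Checks checkP (inputEnv u) (check u)
checks u = parsed (undouble [] u) refl
  where
  parsed : ∀ v → undouble [] u ≡ v → Checks checkP (inputEnv u) (check₁ v)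
  parsed (true , w , I) eq = Runs-to (Runs-unpair #1 #2 (λ ()) eq) (cong (λ w → [] ∷ I ∷ w ∷ V.replicate 6 []) (sym (reverse-involutive w))) ⟫ᶜ
    checks₁ I (reverse w) (undouble [] I) refl
  parsed (false , _ , _) eq = Runs-unpair #1 #2 (λ ()) eq ⟫ᶜ fails Runs-ret

-- The one-way functions

isN : Flag → Bool
isN N = true
isN _ = false

leading : Str → Maybe Bool
leading []      = nothing
leading (b ∷ _) = just b

checkSame : ∀ u {v : Str} → Dec (u ≡ v) → Maybe Str
checkSame u (yes _) = check u
checkSame u (no _)  = nothing

diagonal : Str → Str → Maybe Str
diagonal (true ∷ u)  (true ∷ v)  = checkSame u (≡-dec _≟B_ u v)
diagonal (true ∷ u)  (false ∷ v) = nothing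
diagonal (true ∷ u)  []          = nothing
diagonal (false ∷ u) y           = nothing
diagonal []          y           = nothing

tagged : Maybe Str → Maybe Str → Maybe Str
tagged (just I) d = just (false ∷ true ∷ I)
tagged nothing  d = d

-- Apart from σ (1u) (1u) = 01I for check u = just I, the value of σ x y depends on the first letters
-- only.  Unless associativity is to fail, all values start with 0 and strings starting with 0
-- annihilate, so all triple products are equal.
module OneWayFunction (t c a : Flag) where

  bottom : Maybe Str
  bottom = if isN t then nothing else just (false ∷ [])

  -- For `a = N`, the triple (ε, ε, 1) violates associativity: one side is σ 1 1 = 00, the other is
  -- `bottom`. Both entries involved are on the diagonal and do not disturb commutativity. For
  -- `c = N`, (ε, 1) differs from (1, ε); its value 00 begins with 0 and does not disturb
  -- associativity. Totality depends on `bottom` alone.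
  default : Maybe Bool → Maybe Bool → Maybe Str
  default nothing      nothing      = if isN a then just (true ∷ []) else bottom
  default nothing      (just true)  = if isN c then just (false ∷ false ∷ []) else bottom
  default nothing      (just false) = bottom
  default (just true)  nothing      = bottom
  default (just true)  (just true)  = if isN a then just (false ∷ false ∷ []) else bottom
  default (just true)  (just false) = bottom
  default (just false) _            = bottom

  σ : Fun2
  σ x y = tagged (diagonal x y) (default (leading x) (leading y))

  emitDefault : Maybe Str → Prog Bool
  emitDefault nothing  = ret false
  emitDefault (just v) = clear #1 #2 #3 ⨾ pushWord #1 v ⨾ ret true

  emit : Bool → Prog Bool
  emit true  = clear #1 #3 #4 ⨾ clear #2 #3 #4 ⨾ move #7 #2 #8 ⨾ move #2 #1 #8 ⨾ pushWord #1 (false ∷ true ∷ []) ⨾ ret true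
  emit false = emitDefault (default (just true) (just true))

  whenSame : Bool → Prog Bool
  whenSame true  = move #6 #1 #8 ⨾ bind checkP emit
  whenSame false = emitDefault (default (just true) (just true))

  branch : Maybe Bool → Maybe Bool → Prog Bool
  branch (just true)  (just true) = bind compare whenSame
  branch (just true)  d           = emitDefault (default (just true) d)
  branch (just false) d           = emitDefault (default (just false) d)
  branch nothing      d           = emitDefault (default nothing d)

  afterPops : Maybe Bool → Prog Bool
  afterPops d₂ = bind (pop #5) (λ d₁ → branch d₁ d₂)

  σP : Prog Bool
  σP = bind (unpair #1 #2) (onTrue (move #2 #5 #8 ⨾ bind (pop #1) afterPops))

  yields-default : ∀ d {s e} → Yields (emitDefault d) ([] ∷ s ∷ e) d
  yields-default nothing  = rejects Runs-ret
  yields-default (just v) {s} {e} = accepts (Runs-clear (λ ()) (λ ()) (λ ()) ⟫ Runs-to (Runs-pushWord v) (cong (λ v → [] ∷ v ∷ e) (++-identityʳ v)) ⟫ Runs-ret)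

  yields-emit : ∀ {e r} → Checks checkP e r → Yields (bind checkP emit) e (tagged r (default (just true) (just true)))
  yields-emit (passes {a} {b} {c} {d} {f} {g} {h} {I} run) = accepts (run ⟫ Runs-clear (λ ()) (λ ()) (λ ()) ⟫ Runs-clear (λ ()) (λ ()) (λ ()) ⟫
    Runs-move (λ ()) (λ ()) (λ ()) ⟫ Runs-to (Runs-move (λ ()) (λ ()) (λ ())) (cong (λ I → [] ∷ I ∷ [] ∷ c ∷ d ∷ f ∷ g ∷ [] ∷ h ∷ []) (reverse-involutive I)) ⟫
    Runs-pushWord (false ∷ true ∷ []) ⟫ Runs-ret)
  yields-emit (fails {s ∷ e} run) = run ⟫ʸ yields-default (default (just true) (just true))

  ready : Str → Str → Env
  ready x y = [] ∷ y ∷ [] ∷ [] ∷ [] ∷ x ∷ [] ∷ [] ∷ [] ∷ []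

  yields-diagonal : ∀ u v (d : Dec (u ≡ v)) → Yields (bind compare whenSame) (ready u v) (tagged (checkSame u d) (default (just true) (just true)))
  yields-diagonal u .u (yes refl) = Runs-compare-same u [] ⟫ʸ
    (Runs-to (Runs-move (λ ()) (λ ()) (λ ())) (cong (λ u → [] ∷ u ∷ V.replicate 7 []) (reverse-involutive u)) ⟫ʸ yields-emit (checks u))
  yields-diagonal u v (no ne) = let _ , _ , _ , run = Runs-compare-diff v u [] (ne ∘ sym) in
    run ⟫ʸ yields-default (default (just true) (just true))

  yields-branch : ∀ x y → Yields (bind (pop #1) afterPops) (ready x y) (σ x y)
  yields-branch (true ∷ u)  (true ∷ v)  = Runs-pop-∷ refl ⟫ʸ (Runs-pop-∷ refl ⟫ʸ yields-diagonal u v (≡-dec _≟B_ u v))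
  yields-branch (true ∷ u)  (false ∷ v) = Runs-pop-∷ refl ⟫ʸ (Runs-pop-∷ refl ⟫ʸ yields-default bottom)
  yields-branch (true ∷ u)  []          = Runs-pop-[] refl ⟫ʸ (Runs-pop-∷ refl ⟫ʸ yields-default bottom)
  yields-branch (false ∷ u) (b ∷ v)     = Runs-pop-∷ refl ⟫ʸ (Runs-pop-∷ refl ⟫ʸ yields-default bottom)
  yields-branch (false ∷ u) []          = Runs-pop-[] refl ⟫ʸ (Runs-pop-∷ refl ⟫ʸ yields-default bottom)
  yields-branch []          (b ∷ v)     = Runs-pop-∷ refl ⟫ʸ (Runs-pop-[] refl ⟫ʸ yields-default (default nothing (just b)))
  yields-branch []          []          = Runs-pop-[] refl ⟫ʸ (Runs-pop-[] refl ⟫ʸ yields-default (default nothing nothing))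

  FP₂-σ : FP₂ σ
  FP₂-σ = FP₂-intro σP λ x y → Runs-unpair #1 #2 (λ ()) (undouble-pair [] x y) ⟫ʸ
    (Runs-to (Runs-move (λ ()) (λ ()) (λ ())) (cong (λ x → ready x y) (reverse-involutive x)) ⟫ʸ yields-branch x y)

  data Origin (x y z : Str) : Set where
    fromCheck   : ∀ u I → x ≡ true ∷ u → y ≡ true ∷ u → check u ≡ just I → z ≡ false ∷ true ∷ I → Origin x y z
    fromDefault : diagonal x y ≡ nothing → default (leading x) (leading y) ≡ just z → Origin x y z

  diagonal⁻ : ∀ x y {I} → diagonal x y ≡ just I → ∃[ u ] (x ≡ true ∷ u × y ≡ true ∷ u × check u ≡ just I)
  diagonal⁻ (true ∷ u) (true ∷ v) eq = same (≡-dec _≟B_ u v) eq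
    where
    same : (d : Dec (u ≡ v)) → ∀ {I} → checkSame u d ≡ just I → ∃[ u′ ] (true ∷ u ≡ true ∷ u′ × true ∷ v ≡ true ∷ u′ × check u′ ≡ just I)
    same (yes refl) eq = u , refl , refl , eq
  diagonal⁻ (true ∷ u)  (false ∷ v) ()
  diagonal⁻ (true ∷ u)  []          ()
  diagonal⁻ (false ∷ u) y           ()
  diagonal⁻ []          y           ()

  origin : ∀ x y {z} → σ x y ≡ just z → Origin x y z
  origin x y {z} = by (diagonal x y) refl
    where
    by : ∀ m → diagonal x y ≡ m → tagged m (default (leading x) (leading y)) ≡ just z → Origin x y z
    by (just I) eq refl = let u , xe , ye , ce = diagonal⁻ x y eq in fromCheck u I xe ye ce refl
    by nothing  eq eq′  = fromDefault eq eq′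

  -- Honesty rests on this: `u` = ⟨w, I⟩, and w is no longer than the bound contained in I.
  check-length : ∀ u {I} → check u ≡ just I → length u ≤ 3 * length I + 2
  check-length u {I} eq with check-sound u eq
  ... | w , px , b , it , refl , refl , le , _ = begin
    length (pair w I)                     ≡⟨ length-pair w I ⟩
    2 * length w + (2 + length I)         ≤⟨ +-monoˡ-≤ (2 + length I) (*-monoʳ-≤ 2 w≤I) ⟩
    2 * length I + (2 + length I)         ≡⟨ cong (2 * length I +_) (+-comm 2 (length I)) ⟩
    2 * length I + (length I + 2)         ≡⟨ sym (+-assoc (2 * length I) (length I) 2) ⟩
    2 * length I + length I + 2           ≡⟨ cong (_+ 2) (+-comm (2 * length I) (length I)) ⟩
    3 * length I + 2                      ∎
    where
    open ≤-Reasoning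
    w≤I : length w ≤ length I
    w≤I = begin
      length w                                     ≤⟨ le ⟩
      length b                                     ≤⟨ m≤n*m (length b) 2 ⟩
      2 * length b                                 ≤⟨ m≤m+n (2 * length b) (2 + length it) ⟩
      2 * length b + (2 + length it)               ≡⟨ sym (length-pair b it) ⟩
      length (pair b it)                           ≤⟨ m≤n+m (length (pair b it)) (2 * length px + 2) ⟩
      2 * length px + 2 + length (pair b it)       ≡⟨ +-assoc (2 * length px) 2 (length (pair b it)) ⟩
      2 * length px + (2 + length (pair b it))     ≡⟨ sym (length-pair px (pair b it)) ⟩
      length I                                     ∎

  n≤n^6 : ∀ n → n ≤ n ^ 6
  n≤n^6 zero    = z≤n
  n≤n^6 (suc n) = ≤-trans (≤-reflexive (sym (*-identityʳ (suc n)))) (^-monoʳ-≤ (suc n) {1} {6} (s≤s z≤n))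

  representative : Maybe Bool → Str
  representative nothing  = []
  representative (just b) = b ∷ []

  -- `check` fails on ε, so the one-letter strings meet no instance, and every value of the table
  -- has a preimage of total length at most 2.
  σ-representative : ∀ d₁ d₂ → σ (representative d₁) (representative d₂) ≡ default d₁ d₂
  σ-representative nothing      nothing      = refl
  σ-representative nothing      (just true)  = refl
  σ-representative nothing      (just false) = refl
  σ-representative (just true)  nothing      = refl
  σ-representative (just true)  (just true)  = refl
  σ-representative (just true)  (just false) = refl
  σ-representative (just false) nothing      = refl
  σ-representative (just false) (just b)     = refl

  honest : Honest σ
  -- A tagged preimage has length at most 2(1 + 3n + 2) = 6n + 6, where n is the length of the
  -- instance.
  honest = 6 , λ x y z eq → preimage x y z eq (origin x y eq)
    where
    representative≤1 : ∀ d → length (representative d) ≤ 1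
    representative≤1 nothing  = z≤n
    representative≤1 (just b) = ≤-refl
    preimage : ∀ x y z → σ x y ≡ just z → Origin x y z → ∃[ x′ ] ∃[ y′ ] (σ x′ y′ ≡ just z × length x′ + length y′ ≤ poly 6 (length z))
    preimage x y z eq (fromDefault _ eq′) = representative (leading x) , representative (leading y) ,
      trans (σ-representative (leading x) (leading y)) eq′ ,
      ≤-trans (+-mono-≤ (representative≤1 (leading x)) (representative≤1 (leading y))) (≤-trans (m≤m+n 2 4) (m≤n+m 6 (6 * length z ^ 6)))
    preimage x y z eq (fromCheck u I refl refl ce refl) = true ∷ u , true ∷ u , eq , (begin
      suc (length u) + suc (length u)          ≤⟨ +-mono-≤ (s≤s (check-length u ce)) (s≤s (check-length u ce)) ⟩
      suc (3 * n + 2) + suc (3 * n + 2)        ≡⟨ tidy n ⟩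
      6 * n + 6                                ≤⟨ +-monoˡ-≤ 6 (*-monoʳ-≤ 6 (≤-trans (m≤n+m n 2) (n≤n^6 (2 + n)))) ⟩
      6 * (2 + n) ^ 6 + 6                      ∎)
      where
      open ≤-Reasoning
      n : ℕ
      n = length I
      tidy : ∀ n → suc (3 * n + 2) + suc (3 * n + 2) ≡ 6 * n + 6
      tidy = solve-∀

  -- Inverts the table by its values: 1 occurs only with y = ε, 00 only with y beginning with 1, and
  -- 0 is `bottom`, which y = 0 gives for every x. The tag 01 points to the diagonal, where y = x.
  guess : Str → Str → Str
  guess x []                   = []
  guess x (true ∷ z)           = []
  guess x (false ∷ [])         = false ∷ []
  guess x (false ∷ false ∷ z)  = true ∷ []
  guess x (false ∷ true ∷ z)   = x

  constant : Str → Prog Bool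
  constant v = emitDefault (just v)

  guessP₂ : Maybe Bool → Prog Bool
  guessP₂ nothing      = constant (false ∷ [])
  guessP₂ (just false) = constant (true ∷ [])
  guessP₂ (just true)  = clear #1 #3 #4 ⨾ move #2 #1 #8 ⨾ ret true

  guessP₁ : Maybe Bool → Prog Bool
  guessP₁ nothing      = constant []
  guessP₁ (just true)  = constant []
  guessP₁ (just false) = bind (pop #1) guessP₂

  guessP : Prog Bool
  guessP = bind (unpair #1 #2) (λ _ → bind (pop #1) guessP₁)

  guessOf : Bool × Str × Str → Str
  guessOf (_ , x , z) = guess (reverse x) z

  yields-guess : ∀ s → Yields guessP (inputEnv s) (just (guessOf (undouble [] s)))
  yields-guess s = Runs-unpair #1 #2 (λ ()) refl ⟫ʸ by (proj₁ (proj₂ (undouble [] s))) (proj₂ (proj₂ (undouble [] s)))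
    where
    by : ∀ x z → Yields (bind (pop #1) guessP₁) ([] ∷ z ∷ x ∷ V.replicate 6 []) (just (guess (reverse x) z))
    by x []                  = Runs-pop-[] refl ⟫ʸ yields-default (just [])
    by x (true ∷ z)          = Runs-pop-∷ refl ⟫ʸ yields-default (just [])
    by x (false ∷ [])        = Runs-pop-∷ refl ⟫ʸ (Runs-pop-[] refl ⟫ʸ yields-default (just (false ∷ [])))
    by x (false ∷ false ∷ z) = Runs-pop-∷ refl ⟫ʸ (Runs-pop-∷ refl ⟫ʸ yields-default (just (true ∷ [])))
    by x (false ∷ true ∷ z)  = Runs-pop-∷ refl ⟫ʸ (Runs-pop-∷ refl ⟫ʸ accepts (Runs-clear (λ ()) (λ ()) (λ ()) ⟫ Runs-move (λ ()) (λ ()) (λ ()) ⟫ Runs-ret))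

  guessOf-pair : ∀ x z → guessOf (undouble [] (pair x z)) ≡ guess x z
  guessOf-pair x z = trans (cong guessOf (undouble-pair [] x z)) (cong (λ x → guess x z) (reverse-involutive x))

  σ-right-annihilates : ∀ x → σ x (false ∷ []) ≡ bottom
  σ-right-annihilates []          = refl
  σ-right-annihilates (true ∷ x)  = refl
  σ-right-annihilates (false ∷ x) = refl

  bottom-guess : ∀ x z → bottom ≡ just z → σ x (guess x z) ≡ just z
  bottom-guess x z eq with isN t | σ-right-annihilates x
  bottom-guess x .(false ∷ []) refl | false | ann = ann

  choice : ∀ b {v : Str} {d : Maybe Str} {z} {P : Str → Set} → (if b then just v else d) ≡ just z → (b ≡ true → P v) → (d ≡ just z → P z) → P z
  choice true  refl p q = p refl
  choice false eq   p q = q eq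

  default-guess : ∀ x y z → default (leading x) (leading y) ≡ just z → σ x (guess x z) ≡ just z
  default-guess [] [] z eq = choice (isN a) {P = λ z → σ [] (guess [] z) ≡ just z} eq (λ n → cong (λ b → if b then just (true ∷ []) else bottom) n) (bottom-guess [] z)
  default-guess [] (true ∷ y) z eq = choice (isN c) {P = λ z → σ [] (guess [] z) ≡ just z} eq (λ n → cong (λ b → if b then just (false ∷ false ∷ []) else bottom) n) (bottom-guess [] z)
  default-guess [] (false ∷ y) z eq = bottom-guess [] z eq
  default-guess (true ∷ x) [] z eq = bottom-guess (true ∷ x) z eq
  default-guess (true ∷ x) (true ∷ y) z eq = choice (isN a) {P = λ z → σ (true ∷ x) (guess (true ∷ x) z) ≡ just z} eq
    (λ n → trans (no-check x) (cong (λ b → if b then just (false ∷ false ∷ []) else bottom) n)) (bottom-guess (true ∷ x) z)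
    where
    -- The second argument is 1 here: either the arguments differ, or the string to check is ε,
    -- which is not a pair.
    no-check : ∀ x → σ (true ∷ x) (true ∷ []) ≡ default (just true) (just true)
    no-check []      = refl
    no-check (_ ∷ _) = refl
  default-guess (true ∷ x) (false ∷ y) z eq = bottom-guess (true ∷ x) z eq
  default-guess (false ∷ x) y z eq = bottom-guess (false ∷ x) z eq

  invertibleFirst : InvertibleFirst σ
  invertibleFirst = (λ s → just (guessOf (undouble [] s))) , FP-intro guessP yields-guess ,
    λ x y z eq → guess x z , cong just (guessOf-pair x z) , correct x y z eq (origin x y eq)
    where
    correct : ∀ x y z → σ x y ≡ just z → Origin x y z → σ x (guess x z) ≡ just z
    correct x y z eq (fromDefault _ eq′) = default-guess x y z eq′
    correct x y z eq (fromCheck u I refl refl _ refl) = eq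

  notStrong : ¬ Strong σ
  notStrong (_ , _ , notFirst , _) = notFirst invertibleFirst

total : ∀ t c a → Cond t (Total (OneWayFunction.σ t c a))
total ⋆ c a = tt
total N c a tot = case tot (false ∷ []) (false ∷ []) of λ ()
total Y c a x y = by (diagonal x y) (leading x) (leading y)
  where
  open OneWayFunction Y c a
  either : ∀ b {v w : Str} → ∃[ z ] ((if b then just v else just w) ≡ just z)
  either true  = _ , refl
  either false = _ , refl
  by : ∀ m d₁ d₂ → ∃[ z ] (tagged m (default d₁ d₂) ≡ just z)
  by (just I) _            _            = _ , refl
  by nothing  nothing      nothing      = either (isN a)
  by nothing  nothing      (just true)  = either (isN c)
  by nothing  nothing      (just false) = _ , refl
  by nothing  (just true)  nothing      = _ , refl
  by nothing  (just true)  (just true)  = either (isN a)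
  by nothing  (just true)  (just false) = _ , refl
  by nothing  (just false) _            = _ , refl

commutative : ∀ t c a → Cond c (Commutative (OneWayFunction.σ t c a))
commutative t ⋆ a = tt
commutative Y N a comm = case comm [] (true ∷ []) of λ ()
commutative N N a comm = case comm [] (true ∷ []) of λ ()
commutative ⋆ N a comm = case comm [] (true ∷ []) of λ ()
commutative t Y a x y = cong₂ tagged (diagonal-comm x y) (default-comm (leading x) (leading y))
  where
  open OneWayFunction t Y a
  checkSame-comm : ∀ {u v} (d : Dec (u ≡ v)) (d′ : Dec (v ≡ u)) → checkSame u d ≡ checkSame v d′
  checkSame-comm (yes refl) (yes _) = refl
  checkSame-comm (yes refl) (no ne) = ⊥-elim (ne refl)
  checkSame-comm (no ne) (yes refl) = ⊥-elim (ne refl)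
  checkSame-comm (no _)  (no _)     = refl
  diagonal-comm : ∀ x y → diagonal x y ≡ diagonal y x
  diagonal-comm (true ∷ u)  (true ∷ v)  = checkSame-comm (≡-dec _≟B_ u v) (≡-dec _≟B_ v u)
  diagonal-comm (true ∷ u)  (false ∷ v) = refl
  diagonal-comm (true ∷ u)  []          = refl
  diagonal-comm (false ∷ u) (true ∷ v)  = refl
  diagonal-comm (false ∷ u) (false ∷ v) = refl
  diagonal-comm (false ∷ u) []          = refl
  diagonal-comm []          (true ∷ v)  = refl
  diagonal-comm []          (false ∷ v) = refl
  diagonal-comm []          []          = refl
  default-comm : ∀ d₁ d₂ → default d₁ d₂ ≡ default d₂ d₁
  default-comm nothing      nothing      = refl
  default-comm nothing      (just true)  = refl
  default-comm nothing      (just false) = refl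
  default-comm (just true)  nothing      = refl
  default-comm (just true)  (just true)  = refl
  default-comm (just true)  (just false) = refl
  default-comm (just false) nothing      = refl
  default-comm (just false) (just true)  = refl
  default-comm (just false) (just false) = refl

associative : ∀ t c a → Cond a (Associative (OneWayFunction.σ t c a))
associative t c ⋆ = tt
associative Y Y N assoc = case assoc [] [] (true ∷ []) of λ ()
associative Y N N assoc = case assoc [] [] (true ∷ []) of λ ()
associative Y ⋆ N assoc = case assoc [] [] (true ∷ []) of λ ()
associative N Y N assoc = case assoc [] [] (true ∷ []) of λ ()
associative N N N assoc = case assoc [] [] (true ∷ []) of λ ()
associative N ⋆ N assoc = case assoc [] [] (true ∷ []) of λ ()
associative ⋆ Y N assoc = case assoc [] [] (true ∷ []) of λ ()
associative ⋆ N N assoc = case assoc [] [] (true ∷ []) of λ ()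
associative ⋆ ⋆ N assoc = case assoc [] [] (true ∷ []) of λ ()
associative t c Y x y z = trans (annihilates (σ x y) (λ w → σ w z) (class x y) (λ _ → refl)) (sym (annihilates (σ y z) (σ x) (class y z) (onRight x)))
  where
  open OneWayFunction t c Y
  -- A product is undefined only when `bottom` is, and otherwise begins with 0. Either way a further
  -- product gives `bottom`, on both sides of the law.
  data Vanishing : Maybe Str → Set where
    undef : bottom ≡ nothing → Vanishing nothing
    zeroed : ∀ w → Vanishing (just (false ∷ w))
  bottom-vanishing : ∀ b → (if b then nothing else just (false ∷ [])) ≡ bottom → Vanishing (if b then nothing else just (false ∷ []))
  bottom-vanishing true  eq = undef (sym eq)
  bottom-vanishing false eq = zeroed []
  default-vanishing : ∀ d₁ d₂ → Vanishing (default d₁ d₂)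
  default-vanishing nothing      nothing      = bottom-vanishing (isN t) refl
  default-vanishing nothing      (just true)  = by (isN c)
    where by : ∀ b → Vanishing (if b then just (false ∷ false ∷ []) else bottom)
          by true  = zeroed _
          by false = bottom-vanishing (isN t) refl
  default-vanishing nothing      (just false) = bottom-vanishing (isN t) refl
  default-vanishing (just true)  nothing      = bottom-vanishing (isN t) refl
  default-vanishing (just true)  (just true)  = bottom-vanishing (isN t) refl
  default-vanishing (just true)  (just false) = bottom-vanishing (isN t) refl
  default-vanishing (just false) _            = bottom-vanishing (isN t) refl
  class : ∀ x y → Vanishing (σ x y)
  class x y = by (diagonal x y)
    where by : ∀ m → Vanishing (tagged m (default (leading x) (leading y)))
          by (just I) = zeroed _
          by nothing  = default-vanishing (leading x) (leading y)
  onRight : ∀ x w → σ x (false ∷ w) ≡ bottom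
  onRight []          w = refl
  onRight (true ∷ x)  w = refl
  onRight (false ∷ x) w = refl
  annihilates : ∀ m (f : Str → Maybe Str) → Vanishing m → (∀ w → f (false ∷ w) ≡ bottom) → (m >>= f) ≡ bottom
  annihilates .nothing  f (undef eq) h = sym eq
  annihilates .(just _) f (zeroed w) h = h w

-- Inverting σ decides NP

run-mono : ∀ M {T T′} q w {r} → T ≤ T′ → run M T (toConf q w) ≡ just r → run M T′ (toConf q w) ≡ just r
run-mono M q w le eq with TM.δ M q (cur w)
run-mono M q w le eq                           | accept     = eq
run-mono M q w le eq                           | reject     = eq
run-mono M {suc T} {suc T′} q w (s≤s le) eq | go q′ s m =
  trans (cong (run M T′) (moveConf≡ q′ w s m)) (run-mono M q′ (moveT w s m) le (trans (cong (run M T) (sym (moveConf≡ q′ w s m))) eq))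

quadruple : Bool → Str
quadruple b = b ∷ b ∷ b ∷ b ∷ []

pair-pair : ∀ x q → pair (pair x []) q ≡ concatMap quadruple x ++ false ∷ false ∷ true ∷ true ∷ false ∷ true ∷ q
pair-pair []      q = refl
pair-pair (b ∷ x) q = cong (λ s → b ∷ b ∷ b ∷ b ∷ s) (pair-pair x q)

-- The second component of a pair is written plainly at the end. So ⟨x, ε⟩ is a tape prefix that
-- every candidate w completes to the input of the verifier.
pair-[]-++ : ∀ x w → pair x [] ++ w ≡ pair x w
pair-[]-++ []      w = refl
pair-[]-++ (b ∷ x) w = cong (λ s → b ∷ b ∷ s) (pair-[]-++ x w)

rewords-quadruple : ∀ x acc → rewords quadruple (reverse x) acc ≡ concatMap quadruple x ++ acc
rewords-quadruple x acc = trans (rewords-concatMap quadruple (reverse x) acc) (cong (λ x → concatMap quadruple x ++ acc) (reverse-involutive x))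

repeat-comm : ∀ n s acc → repeat n s ++ s ++ acc ≡ s ++ repeat n s ++ acc
repeat-comm zero    s acc = refl
repeat-comm (suc n) s acc = trans (++-assoc s (repeat n s) (s ++ acc)) (cong (s ++_) (trans (repeat-comm n s acc) (sym (++-assoc s (repeat n s) acc))))

rewords-repeat : ∀ n s acc → rewords (λ _ → s) (unary n) acc ≡ repeat n s ++ acc
rewords-repeat zero    s acc = refl
rewords-repeat (suc n) s acc = trans (rewords-repeat n s (s ++ acc)) (trans (repeat-comm n s acc) (sym (++-assoc s (repeat n s) acc)))

-- Decides A ∈ NP with the help of an inverter f of σ: x ∈ A iff σ (f z) = z, where z = reduce x.
module Decider (t c a : Flag) (A : Str → Set) (np : InNP A) (f : Str → Maybe Str) (FPf : FP f)
  (inverts : ∀ x y z → OneWayFunction.σ t c a x y ≡ just z →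
             ∃[ x′ ] ∃[ y′ ] (f z ≡ just (pair x′ y′) × OneWayFunction.σ t c a x′ y′ ≡ just z)) where

  open OneWayFunction t c a

  V : Str → Set
  V = proj₁ np

  k : ℕ
  k = proj₁ (proj₂ np)

  V∈P : InP V
  V∈P = proj₁ (proj₂ (proj₂ np))

  witnesses : ∀ x → (A x → ∃[ w ] (length w ≤ poly k (length x) × V (pair x w))) × (∃[ w ] (length w ≤ poly k (length x) × V (pair x w)) → A x)
  witnesses = proj₂ (proj₂ (proj₂ np))

  MV : TM
  MV = proj₁ V∈P

  kV : ℕ
  kV = proj₁ (proj₂ V∈P)

  open Table MV

  -- Bounds the verifier on ⟨x, w⟩ for all admissible w together, since the number of copies of the
  -- table is fixed before w is known.
  runtime : ℕ → ℕ
  runtime n = poly kV (2 * n + (2 + poly k n))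

  Pol-runtime : Pol runtime
  Pol-runtime = Pol-∘ (Pol-poly kV) (Pol-+ (Pol-* (Pol-const 2) Pol-id) (Pol-+ (Pol-const 2) (Pol-poly k)))

  -- The 1 is the copy in which the halting action is looked up.
  dominated : ∃[ K ] (∀ n → 1 + runtime n ≤ poly K n)
  dominated = poly-dominates (Pol-+ (Pol-const 1) Pol-runtime)

  K : ℕ
  K = proj₁ dominated

  rounds : Str → ℕ
  rounds x = poly K (length x)

  -- As a string of equal letters it equals its reversal; this form is the one that
  -- `rewords-concatMap` delivers in `Runs-reduce`.
  witnessBound : Str → Str
  witnessBound x = reverse (unary (poly k (length x)))

  encode : Str → Str
  encode x = pair (pair x []) (pair (witnessBound x) (repeat (rounds x) table))

  reduce : Str → Str
  reduce x = false ∷ true ∷ encode x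

  accepts-iff : ∀ s n → suc (poly kV (length s)) ≤ n → (universalAccepts s (repeat n table) ≡ true → V s) × (V s → universalAccepts s (repeat n table) ≡ true)
  accepts-iff s (suc n) (s≤s le) with proj₂ (proj₂ (proj₂ (proj₂ V∈P) s))
  ... | r , halted with Call.exec-run⁻ MV (poly kV (length s)) s halted
  ... | b , cf , ran , refl = by b refl
    where
    ranLonger : run MV n (toConf zero (initTape s)) ≡ just (b , cf)
    ranLonger = run-mono MV zero (initTape s) le (trans (cong (run MV (poly kV (length s))) (sym (initConf≡ _ s))) ran)
    simulated : universalAccepts s (repeat (suc n) table) ≡ b
    simulated = trans (cong (λ p → universal fetch (initTape s) p (repeat (suc n) table)) (sym (position-zero (initTape s))))
      (trans (universal-run n zero (initTape s)) (cong accepted ranLonger))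
    by : ∀ b′ → b ≡ b′ → (universalAccepts s (repeat (suc n) table) ≡ true → V s) × (V s → universalAccepts s (repeat (suc n) table) ≡ true)
    by true  refl = (λ _ → proj₁ (proj₂ (proj₂ (proj₂ V∈P) s)) (_ , halted)) , (λ _ → simulated)
    by false refl = (λ eq → case trans (sym eq) simulated of λ ()) , (λ v → ⊥-elim (proj₁ (proj₂ (proj₂ V∈P) s) halted v))

  enough-passes : ∀ x w → length w ≤ poly k (length x) → suc (poly kV (length (pair x w))) ≤ rounds x
  enough-passes x w le = ≤-trans (s≤s (Pol.mono (Pol-poly kV) (≤-trans (≤-reflexive (length-pair x w)) (+-monoʳ-≤ (2 * length x) (+-monoʳ-≤ 2 le))))) (proj₂ dominated (length x))

  length-bound : ∀ x → length (witnessBound x) ≡ poly k (length x)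
  length-bound x = trans (length-reverse (unary (poly k (length x)))) (length-replicate (poly k (length x)))

  σ-check : ∀ u {I} → check u ≡ just I → σ (true ∷ u) (true ∷ u) ≡ just (false ∷ true ∷ I)
  σ-check u {I} eq = by (≡-dec _≟B_ u u)
    where
    by : (d : Dec (u ≡ u)) → tagged (checkSame u d) (default (just true) (just true)) ≡ just (false ∷ true ∷ I)
    by (yes _) = cong (λ m → tagged m (default (just true) (just true))) eq
    by (no ne) = ⊥-elim (ne refl)

  inverted : ∀ x → A x → ∃[ v ] (f (reduce x) ≡ just v × onPairs σ v ≡ just (reduce x))
  inverted x a with proj₁ (witnesses x) a
  ... | w , le , v with inverts (true ∷ pair w (encode x)) (true ∷ pair w (encode x)) (reduce x)
          (σ-check (pair w (encode x)) (check-complete w (pair x []) (witnessBound x) (repeat (rounds x) table) (≤-trans le (≤-reflexive (sym (length-bound x))))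
            (trans (cong (λ s → universalAccepts s (repeat (rounds x) table)) (pair-[]-++ x w)) (proj₂ (accepts-iff (pair x w) (rounds x) (enough-passes x w le)) v))))
  ...   | x′ , y′ , eq , eq′ = pair x′ y′ , eq , trans (onPairs-pair σ x′ y′) eq′

  -- Without this, a preimage of `reduce x` could come from the table and carry no witness.
  default-untagged : ∀ d₁ d₂ {I} → default d₁ d₂ ≢ just (false ∷ true ∷ I)
  default-untagged d₁ d₂ {I} = by d₁ d₂
    where
    at-bottom : bottom ≢ just (false ∷ true ∷ I)
    at-bottom = no-bottom (isN t)
      where no-bottom : ∀ b → (if b then nothing else just (false ∷ [])) ≢ just (false ∷ true ∷ I)
            no-bottom true  ()
            no-bottom false ()
    unless : ∀ b {v} → v ≢ false ∷ true ∷ I → (if b then just v else bottom) ≢ just (false ∷ true ∷ I)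
    unless true  ne eq = ne (just-injective eq)
    unless false ne eq = at-bottom eq
    by : ∀ d₁ d₂ → default d₁ d₂ ≢ just (false ∷ true ∷ I)
    by nothing      nothing      = unless (isN a) λ ()
    by nothing      (just true)  = unless (isN c) λ ()
    by nothing      (just false) = at-bottom
    by (just true)  nothing      = at-bottom
    by (just true)  (just true)  = unless (isN a) λ ()
    by (just true)  (just false) = at-bottom
    by (just false) _            = at-bottom

  -- It does not matter how `v` was found: a preimage of a tagged value comes from the diagonal and
  -- contains a witness that passes `check`, and the verifier accepts it.
  member : ∀ x v → onPairs σ v ≡ just (reduce x) → A x
  member x v eq with onPairs⁻ σ v eq
  ... | x′ , y′ , _ , eq′ with origin x′ y′ eq′
  ... | fromDefault _ eq″ = ⊥-elim (default-untagged (leading x′) (leading y′) eq″)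
  ... | fromCheck u .(encode x) _ _ ce refl with check-sound u ce
  ... | w , px , b , it , _ , Ieq , le , acc with pair-injective (pair x []) (pair (witnessBound x) (repeat (rounds x) table)) px (pair b it) Ieq
  ... | refl , qeq with pair-injective (witnessBound x) (repeat (rounds x) table) b it qeq
  ... | refl , refl = proj₂ (witnesses x) (w , short , proj₁ (accepts-iff (pair x w) (rounds x) (enough-passes x w short))
          (trans (cong (λ s → universalAccepts s (repeat (rounds x) table)) (sym (pair-[]-++ x w))) acc))
    where
    short : length w ≤ poly k (length x)
    short = ≤-trans le (≤-reflexive (length-bound x))

  reduceP : Prog ⊤
  -- Composed from its end: the copies of the table, 01, the doubled bound, then 001101, and `x`
  -- with each letter fourfold, because ⟨x, ε⟩ is itself doubled. The tag 01 comes last.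
  reduceP = spill #1 #3 (_∷ []) #7 (_∷ []) ⨾ polyUnary K ⨾ spill₁ #4 #1 (λ _ → table) #8 ⨾ polyUnary k ⨾
            pushWord #1 (false ∷ true ∷ []) ⨾ spill₁ #4 #1 double #8 ⨾
            pushWord #1 (false ∷ false ∷ true ∷ true ∷ false ∷ true ∷ []) ⨾ spill₁ #7 #1 quadruple #8 ⨾
            pushWord #1 (false ∷ true ∷ []) ⨾ clear #3 #4 #5

  Runs-reduce : ∀ x → Runs reduceP (inputEnv x) tt (inputEnv (reduce x))
  Runs-reduce x =
    Runs-to (Runs-spill #1 #3 (_∷ []) #7 (_∷ []) (λ ()) (λ ()) (λ ())) (cong (λ x → [] ∷ [] ∷ [] ∷ x ∷ [] ∷ [] ∷ [] ∷ x ∷ [] ∷ []) (rewords-move x [])) ⟫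
    Runs-to (Runs-polyUnary (reverse x) K) (cong (λ l → [] ∷ [] ∷ [] ∷ reverse x ∷ unary (poly K l) ∷ [] ∷ [] ∷ reverse x ∷ [] ∷ []) (length-reverse x)) ⟫
    Runs-to (Runs-spill₁ (λ ()) (λ ()) (λ ())) (cong (λ it → [] ∷ it ∷ [] ∷ reverse x ∷ [] ∷ [] ∷ [] ∷ reverse x ∷ [] ∷ [])
      (trans (rewords-repeat (rounds x) table []) (++-identityʳ (repeat (rounds x) table)))) ⟫
    Runs-to (Runs-polyUnary (reverse x) k) (cong (λ l → [] ∷ repeat (rounds x) table ∷ [] ∷ reverse x ∷ unary (poly k l) ∷ [] ∷ [] ∷ reverse x ∷ [] ∷ []) (length-reverse x)) ⟫
    Runs-pushWord (false ∷ true ∷ []) ⟫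
    Runs-to (Runs-spill₁ (λ ()) (λ ()) (λ ())) (cong (λ q → [] ∷ q ∷ [] ∷ reverse x ∷ [] ∷ [] ∷ [] ∷ reverse x ∷ [] ∷ [])
      (rewords-concatMap double (unary (poly k (length x))) (false ∷ true ∷ repeat (rounds x) table))) ⟫
    Runs-pushWord (false ∷ false ∷ true ∷ true ∷ false ∷ true ∷ []) ⟫
    Runs-to (Runs-spill₁ (λ ()) (λ ()) (λ ())) (cong (λ i → [] ∷ i ∷ [] ∷ reverse x ∷ [] ∷ [] ∷ [] ∷ [] ∷ [] ∷ [])
      (trans (rewords-quadruple x _) (sym (pair-pair x (pair (witnessBound x) (repeat (rounds x) table)))))) ⟫
    Runs-pushWord (false ∷ true ∷ []) ⟫
    Runs-clear (λ ()) (λ ()) (λ ())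

  Mf : TM
  Mf = proj₁ FPf

  kf : ℕ
  kf = proj₁ (proj₂ FPf)

  -- Outside the image of σ the inverter may return any string. Its answer is checked by evaluating
  -- σ, which must therefore be safe on strings that are not pairs.
  FPσ : FP (onPairs σ)
  FPσ = FP-onPairs FP₂-σ

  Mσ : TM
  Mσ = proj₁ FPσ

  kσ : ℕ
  kσ = proj₁ (proj₂ FPσ)

  compareP : Bool → Prog Bool
  compareP = onTrue (move #4 #5 #8 ⨾ compare)

  applyP : Bool → Prog Bool
  applyP = onTrue (bind (call Mσ kσ) compareP)

  decideP : Prog Bool
  decideP = reduceP ⨾ spill #1 #2 (_∷ []) #4 (_∷ []) ⨾ move #2 #1 #8 ⨾ bind (call Mf kf) applyP

  decides : ∀ x → Decides decideP (inputEnv x) (A x)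
  decides x =
    Runs-reduce x ⟫ᵈ
    Runs-to (Runs-spill #1 #2 (_∷ []) #4 (_∷ []) (λ ()) (λ ()) (λ ())) (cong (λ z → [] ∷ [] ∷ z ∷ [] ∷ z ∷ V.replicate 4 []) (rewords-move z [])) ⟫ᵈ
    Runs-to (Runs-move (λ ()) (λ ()) (λ ())) (cong (λ y → [] ∷ y ∷ [] ∷ [] ∷ reverse z ∷ V.replicate 4 []) (reverse-involutive z)) ⟫ᵈ
    afterF (f z) refl
    where
    z : Str
    z = reduce x
    final : ∀ v y → f z ≡ just v → onPairs σ v ≡ just y → Dec (y ≡ z) → Decides compare ([] ∷ y ∷ [] ∷ [] ∷ [] ∷ z ∷ [] ∷ [] ∷ [] ∷ []) (A x)
    final v .z _ eq′ (yes refl) = accepts (member x v eq′) (Runs-compare-same z [])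
    final v y eq eq′ (no ne) = let _ , _ , _ , run = Runs-compare-diff y z [] ne in rejects absent run
      where
      -- For a member x the inverter would have returned a preimage of `z`; but its only answer is
      -- `v`, which is mapped to `y`.
      absent : ¬ A x
      absent a with inverted x a
      ... | v′ , e , e′ with trans (sym eq) e
      ... | refl = ne (just-injective (trans (sym eq′) e′))
    afterσ : ∀ v y → f z ≡ just v → onPairs σ v ≡ y → Decides (bind (call Mσ kσ) compareP) ([] ∷ v ∷ [] ∷ [] ∷ reverse z ∷ V.replicate 4 []) (A x)
    afterσ v (just y) eq eq′ = Runs-call Mσ kσ (trans (proj₂ (proj₂ FPσ) v) (cong just eq′)) ⟫ᵈ
      Runs-to (Runs-move (λ ()) (λ ()) (λ ())) (cong (λ z → [] ∷ y ∷ [] ∷ [] ∷ [] ∷ z ∷ V.replicate 3 []) (reverse-involutive z)) ⟫ᵈ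
      final v y eq eq′ (≡-dec _≟B_ y z)
    afterσ v nothing eq eq′ = Runs-call Mσ kσ (trans (proj₂ (proj₂ FPσ) v) (cong just eq′)) ⟫ᵈ rejects absent Runs-ret
      where
      absent : ¬ A x
      absent a with inverted x a
      ... | v′ , e , e′ with trans (sym eq) e
      ... | refl = case trans (sym eq′) e′ of λ ()
    afterF : ∀ v → f z ≡ v → Decides (bind (call Mf kf) applyP) ([] ∷ z ∷ [] ∷ [] ∷ reverse z ∷ V.replicate 4 []) (A x)
    afterF (just v) eq = Runs-call Mf kf (trans (proj₂ (proj₂ FPf) z) (cong just eq)) ⟫ᵈ afterσ v (onPairs σ v) eq refl
    afterF nothing  eq = Runs-call Mf kf (trans (proj₂ (proj₂ FPf) z) (cong just eq)) ⟫ᵈ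
      rejects (λ a → case trans (sym eq) (proj₁ (proj₂ (inverted x a))) of λ ()) Runs-ret

  A∈P : InP A
  A∈P = InP-intro decideP decides

P≢NP⇒noninvertible : ∀ t c a → P≢NP → Noninvertible (OneWayFunction.σ t c a)
P≢NP⇒noninvertible t c a p≢np (f , FPf , inverts) = p≢np (λ A np → Decider.A∈P t c a A np f FPf inverts)

theorem20 : (t c a : Flag) → (∃[ σ ] IsOWF N t c a σ) ⇔ P≢NP
theorem20 t c a = mk⇔ (λ { (σ , oneWay , _) → oneWay⇒P≢NP oneWay }) λ p≢np →
  σ , (FP₂-σ , honest , P≢NP⇒noninvertible t c a p≢np) , notStrong , total t c a , commutative t c a , associative t c a
  where open OneWayFunction t c a
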